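{- For every recursive (decidable) set $A\subseteq\{0,1\}^*$ with $A\notin \mathrm{NP}\cap\mathrm{coNP}$, there exists a set $B$ such that $A\le_T^{SN}B$ and $A\not\le_T^{RS}B$.
   Context: An NPTM is a nondeterministic oracle Turing machine $N$ each of whose computation paths ends in one of three outcomes $\mathbf{acc}$, $\mathbf{rej}$, $\mathbf{?}$, such that there is a polynomial $p$ with: for every oracle $D$ and every input $x$, every computation path of $N^D(x)$ has length at most $p(|x|)$. For an oracle $D$ and input $x$, let $out_{N^D}(x)$ be the set of outcomes occurring on some path of $N^D(x)$; $L(N^D)=\{x:\mathbf{acc}\in out_{N^D}(x)\}$. $N^D(x)$ is underproductive if $\{\mathbf{acc},\mathbf{rej}\}\not\subseteq out_{N^D}(x)$, and overproductive if $out_{N^D}(x)\neq\{\mathbf{?}\}$; $N^D$ is underproductive (overproductive) if $N^D(x)$ is so for every $x$. $N$ is robustly underproductive (overproductive) if $N^D$ is underproductive (overproductive) for every oracle $D$. $A\le_T^{SN}B$ if there is an NPTM $N$ with $N^B$ both overproductive and underproductive and $A=L(N^B)$. $A\le_T^{RS}B$ if this holds via an $N$ that is both robustly overproductive and robustly underproductive. -}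

module Defs where

open import Data.Nat using (ℕ; zero; suc; _+_; _*_; _^_; _≤_; _≡ᵇ_; pred)
open import Data.Fin using (Fin; zero; suc)
open import Data.Bool using (Bool; true; false; if_then_else_)
open import Data.List using (List; []; _∷_; _++_; [_]; length)
open import Data.List.NonEmpty using (List⁺; toList)
open import Data.List.Membership.Propositional using (_∈_)
open import Data.Maybe using (Maybe; just; nothing)
open import Data.Product using (Σ; ∃; ∃-syntax; _×_; _,_)
open import Data.Sum using (_⊎_)
open import Data.Empty using (⊥)
open import Relation.Nullary using (¬_)
open import Relation.Unary using (Decidable)
open import Relation.Binary.PropositionalEquality using (_≡_)
open import Function.Bundles using (_⇔_)

Word : Set
Word = List Bool

Lang : Set₁
Lang = Word → Set

co : Lang → Lang
co A x = ¬ A x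

data Outcome : Set where
  acc rej unk : Outcome

data Kind : Set where
  work  : Kind
  query : Kind
  halt  : Outcome → Kind

data Move : Set where
  left right stay : Move

Sym : ℕ → Set
Sym nΓ = Fin (3 + nΓ)

blank : ∀ {nΓ} → Sym nΓ
blank = zero

bitSym : ∀ {nΓ} → Bool → Sym nΓ
bitSym false = suc zero
bitSym true  = suc (suc zero)

-- One work tape (one-way infinite, cells indexed by ℕ, initially holding
-- the input) and a write-only oracle query tape to which each transition
-- may append a bit.  In a query state the machine passes to the state
-- 'yesS' or 'noS' according to whether the query string is in the
-- oracle, and the query tape is erased.  Non-halting ordinary states
-- always have at least one transition (List⁺), so every maximal
-- computation path ends in a halting state, i.e. in an outcome.
record NOTM : Set where
  field
    nS    : ℕ
    nΓ    : ℕ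
    kind  : Fin nS → Kind
    start : Fin nS
    yesS  : Fin nS
    noS   : Fin nS
    δ     : Fin nS → Sym nΓ → List⁺ (Fin nS × Sym nΓ × Move × Maybe Bool)

record Config (M : NOTM) : Set where
  constructor cfg
  open NOTM M
  field
    state : Fin nS
    head  : ℕ
    tape  : ℕ → Sym nΓ
    qtape : Word

moveHead : Move → ℕ → ℕ
moveHead left  h = pred h
moveHead right h = suc h
moveHead stay  h = h

writeTape : {S : Set} → ℕ → S → (ℕ → S) → (ℕ → S)
writeTape h a t i = if i ≡ᵇ h then a else t i

appendQ : Word → Maybe Bool → Word
appendQ q nothing  = q
appendQ q (just b) = q ++ [ b ]

inputTape : ∀ {nΓ} → Word → ℕ → Sym nΓ
inputTape []      _       = blank
inputTape (b ∷ x) zero    = bitSym b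
inputTape (b ∷ x) (suc i) = inputTape x i

initCfg : (M : NOTM) → Word → Config M
initCfg M x = cfg (NOTM.start M) 0 (inputTape x) []

data Step (M : NOTM) (D : Lang) : Config M → Config M → Set where
  work-step : ∀ {s h t q s' a m w} →
    NOTM.kind M s ≡ work →
    (s' , a , m , w) ∈ toList (NOTM.δ M s (t h)) →
    Step M D (cfg s h t q) (cfg s' (moveHead m h) (writeTape h a t) (appendQ q w))
  query-yes : ∀ {s h t q} →
    NOTM.kind M s ≡ query → D q →
    Step M D (cfg s h t q) (cfg (NOTM.yesS M) h t [])
  query-no : ∀ {s h t q} →
    NOTM.kind M s ≡ query → ¬ D q →
    Step M D (cfg s h t q) (cfg (NOTM.noS M) h t [])

data Reach (M : NOTM) (D : Lang) (x : Word) : ℕ → Config M → Set where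
  here : Reach M D x 0 (initCfg M x)
  next : ∀ {n c c'} → Reach M D x n c → Step M D c c' → Reach M D x (suc n) c'

Out : (M : NOTM) → Lang → Word → Outcome → Set
Out M D x o = ∃[ n ] Σ (Config M) λ c →
  Reach M D x n c × NOTM.kind M (Config.state c) ≡ halt o

PolyTime : NOTM → Set₁
PolyTime M = ∃[ c ] ∃[ k ] ∀ (D : Lang) (x : Word) (n : ℕ) (cf : Config M) →
  Reach M D x n cf → n ≤ c * length x ^ k + c

record NPTM : Set₁ where
  field
    machine : NOTM
    poly    : PolyTime machine

Lof : NPTM → Lang → Lang
Lof N D x = Out (NPTM.machine N) D x acc

UnderprodAt : NPTM → Lang → Word → Set
UnderprodAt N D x = ¬ (Out (NPTM.machine N) D x acc × Out (NPTM.machine N) D x rej)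

-- out ≠ {?} : some outcome other than ? occurs
OverprodAt : NPTM → Lang → Word → Set
OverprodAt N D x = Out (NPTM.machine N) D x acc ⊎ Out (NPTM.machine N) D x rej

Underproductive : NPTM → Lang → Set
Underproductive N D = ∀ x → UnderprodAt N D x

Overproductive : NPTM → Lang → Set
Overproductive N D = ∀ x → OverprodAt N D x

RobustlyUnderproductive : NPTM → Set₁
RobustlyUnderproductive N = ∀ (D : Lang) → Underproductive N D

RobustlyOverproductive : NPTM → Set₁
RobustlyOverproductive N = ∀ (D : Lang) → Overproductive N D

SameLang : Lang → Lang → Set
SameLang A B = ∀ x → A x ⇔ B x

_≤SN_ : Lang → Lang → Set₁
A ≤SN B = Σ NPTM λ N →
  Overproductive N B × Underproductive N B × SameLang A (Lof N B)

_≤RS_ : Lang → Lang → Set₁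
A ≤RS B = Σ NPTM λ N →
  RobustlyOverproductive N × RobustlyUnderproductive N × SameLang A (Lof N B)

emptyOracle : Lang
emptyOracle _ = ⊥

InNP : Lang → Set₁
InNP L = Σ NPTM λ N → SameLang L (Lof N emptyOracle)

InCoNP : Lang → Set₁
InCoNP L = InNP (co L)

Recursive : Lang → Set
Recursive A = Decidable A

{-# OPTIONS --safe #-}
-- A is coded into B by one word code x y (A x) per x, with a pad y of length
-- |x| that depends on |x| only; guessing the pad gives A ≤SN B.  Requirements
-- (M, c, k) are met one after the other.  At stage m, which fixes the pad of
-- length m, the current M is run on all x with cutoff c k |x| = m, where
-- 2 ^ m ≥ 2 (c |x| ^ k + c), with the oracle coding the words shorter than m.
-- If some path answers wrongly, the later pads avoid the words queried on it, so
-- that the wrong answer persists in B; if M runs too long or gives no answer, it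
-- is not a robust reduction.  Either way the next requirement is taken up.
-- If this never happens, the pads are eventually all 0^m, and M decides A(x)
-- from the values of A on words of length O(log |x|).  Obtaining these values
-- recursively takes polynomial time altogether and puts A in NP ∩ coNP.  Hence
-- no requirement can be current forever; this negative statement is all that is
-- used, and B is computable without any unbounded search.

module Submission where

open import Defs
open import Data.Bool using (Bool; true; false; not; _∧_; if_then_else_; T) renaming (_≟_ to _≟ᵇ_)
open import Data.Empty using (⊥; ⊥-elim)
open import Data.Fin using (Fin; zero; suc; fromℕ; inject₁)
import Data.Fin as Fin
import Data.Fin.Properties as Fin
open import Data.List using (List; []; _∷_; _++_; [_]; length; map; reverse; replicate; concatMap; head)
import Data.List.NonEmpty as List⁺
open import Data.List.NonEmpty using (List⁺; toList; _∷_)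
open import Data.List.Membership.Propositional using (_∈_; _∉_; lose; find)
open import Data.List.Membership.Propositional.Properties using (∈-map⁺; ∈-map⁻; ∈-concatMap⁺; ∈-concatMap⁻; ∈-++⁺ˡ; ∈-++⁺ʳ)
open import Data.List.Properties using (≡-dec; length-++; ++-assoc; length-map; map-++; length-replicate; ++-identityʳ; ∷-injective; unfold-reverse; reverse-++; length-reverse; reverse-involutive)
open import Data.List.Relation.Unary.Any using (here; there; any?)
open import Data.Maybe using (Maybe; just; nothing; maybe′)
import Data.Maybe as Maybe
open import Data.Nat using (ℕ; zero; suc; _+_; _*_; _^_; _∸_; _≤_; _<_; _≥_; _≡ᵇ_; pred; z≤n; s≤s; s≤s⁻¹; _≤?_; _<?_; _≟_; ⌊_/2⌋; NonZero; >-nonZero; _/_; _%_)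
open import Data.Nat.DivMod using (m/n*n≤m; m≡m%n+[m/n]*n; m%n<n)
open import Data.Nat.Induction using (<-rec)
open import Data.Nat.ListAction using (sum)
open import Data.Nat.Properties hiding (_≟_; _≤?_; _<?_)
open import Data.Nat.Tactic.RingSolver using (solve-∀)
open import Data.Product using (Σ; ∃; ∃-syntax; _×_; _,_; proj₁; proj₂)
open import Data.Sum using (_⊎_; inj₁; inj₂)
open import Data.Unit using (⊤; tt)
open import Data.Vec using (Vec; []; _∷_; lookup; updateAt; zipWith; tabulate)
import Data.Vec as Vec
open import Data.Vec.Properties using (toList∘fromList)
open import Data.Vec.Properties using (lookup∘updateAt; lookup∘updateAt′; lookup-zipWith; lookup-replicate; lookup∘tabulate)
open import Function using (_∘_; id; case_of_; _∋_)
open import Function.Bundles using (mk⇔; Equivalence)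
open import Relation.Nullary using (¬_; Dec; yes; no; does)
open import Relation.Nullary.Decidable using (_×-dec_; dec-true)
open import Relation.Unary using (Decidable)
open import Relation.Binary.PropositionalEquality using (_≡_; _≢_; refl; sym; trans; cong; cong₂; subst; subst₂)
import Data.Fin.Patterns as Fin

-- Finite types and stack programs

-- Pads depend on lengths alone and settle to 0^m, so a long query can be judged by inspection up to
-- one unknown, the value A(x') it announces. A table cannot supply this value, as A is only
-- recursive; but M itself computes it, on an input of length at most K lg |x|. Such a call costs a
-- polynomial in lg |x|, which is at most |x| for long inputs, so the same time bound holds at every
-- depth of the recursion; short inputs go into a finite table. The call is nondeterministic. Paths
-- of M ending in ? die; the quiet stages guarantee some path with an answer and none with a wrong
-- one, so every surviving call returns the true value. Hence one simulation serves NP and, with its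
-- last answer swapped, coNP. The clock c, k is part of the requirement so that slowness shows on a
-- single input. The factor 2 in the choice of m shares 2 ^ m between the words already forbidden
-- and the queries of one new path. Machines of the model have a single work tape; the simulator is
-- therefore written for seven stacks and compiled.

record Finite (A : Set) : Set where
  field
    size    : ℕ
    to      : A → Fin size
    from    : Fin size → A
    from∘to : ∀ a → from (to a) ≡ a

open Finite public

finite-Fin : ∀ n → Finite (Fin n)
finite-Fin n = record { size = n ; to = id ; from = id ; from∘to = λ _ → refl }

finite-retract : ∀ {A B} → Finite A → (f : B → A) (g : A → B) → (∀ b → g (f b) ≡ b) → Finite B
finite-retract F f g gf = record
  { size = size F ; to = to F ∘ f ; from = g ∘ from F
  ; from∘to = λ b → trans (cong g (from∘to F (f b))) (gf b) }

finite-⊤ : Finite ⊤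
finite-⊤ = record { size = 1 ; to = λ _ → zero ; from = λ _ → tt ; from∘to = λ _ → refl }

finite-⊎ : ∀ {A B} → Finite A → Finite B → Finite (A ⊎ B)
finite-⊎ {A} {B} F G = record
  { size = size F + size G ; to = enc ; from = dec ; from∘to = dec∘enc }
  where
  enc : A ⊎ B → Fin (size F + size G)
  enc (inj₁ a) = Fin.join (size F) (size G) (inj₁ (to F a))
  enc (inj₂ b) = Fin.join (size F) (size G) (inj₂ (to G b))
  dec′ : Fin (size F) ⊎ Fin (size G) → A ⊎ B
  dec′ (inj₁ i) = inj₁ (from F i)
  dec′ (inj₂ j) = inj₂ (from G j)
  dec : Fin (size F + size G) → A ⊎ B
  dec i = dec′ (Fin.splitAt (size F) i)
  dec∘enc : ∀ a → dec (enc a) ≡ a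
  dec∘enc (inj₁ a) rewrite Fin.splitAt-join (size F) (size G) (inj₁ (to F a)) = cong inj₁ (from∘to F a)
  dec∘enc (inj₂ b) rewrite Fin.splitAt-join (size F) (size G) (inj₂ (to G b)) = cong inj₂ (from∘to G b)

finite-× : ∀ {A B} → Finite A → Finite B → Finite (A × B)
finite-× {A} {B} F G = record
  { size = size F * size G ; to = λ { (a , b) → Fin.combine (to F a) (to G b) } ; from = dec
  ; from∘to = dec∘enc }
  where
  dec : Fin (size F * size G) → A × B
  dec i = from F (proj₁ (Fin.remQuot {size F} (size G) i)) , from G (proj₂ (Fin.remQuot {size F} (size G) i))
  dec∘enc : ∀ p → dec (Fin.combine (to F (proj₁ p)) (to G (proj₂ p))) ≡ p
  dec∘enc (a , b) = trans
    (cong (λ r → from F (proj₁ r) , from G (proj₂ r)) (Fin.remQuot-combine (to F a) (to G b)))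
    (cong₂ _,_ (from∘to F a) (from∘to G b))

finite-Maybe : ∀ {A} → Finite A → Finite (Maybe A)
finite-Maybe F = finite-retract (finite-⊎ finite-⊤ F)
  (λ { nothing → inj₁ tt ; (just a) → inj₂ a })
  (λ { (inj₁ _) → nothing ; (inj₂ a) → just a })
  (λ { nothing → refl ; (just _) → refl })

finite-Bool : Finite Bool
finite-Bool = finite-retract (finite-⊎ finite-⊤ finite-⊤)
  (λ { false → inj₁ tt ; true → inj₂ tt })
  (λ { (inj₁ _) → false ; (inj₂ _) → true })
  (λ { false → refl ; true → refl })

finite-Vec : ∀ {A} → Finite A → ∀ n → Finite (Vec A n)
finite-Vec F zero = finite-retract finite-⊤ (λ _ → tt) (λ _ → []) (λ { [] → refl })
finite-Vec F (suc n) = finite-retract (finite-× F (finite-Vec F n))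
  (λ { (x ∷ xs) → x , xs }) (λ { (x , xs) → x ∷ xs }) (λ { (_ ∷ _) → refl })

finite-Outcome : Finite Outcome
finite-Outcome = finite-retract (finite-⊎ finite-⊤ finite-Bool)
  (λ { unk → inj₁ tt ; acc → inj₂ true ; rej → inj₂ false })
  (λ { (inj₁ _) → unk ; (inj₂ true) → acc ; (inj₂ false) → rej })
  (λ { acc → refl ; rej → refl ; unk → refl })

-- Nondeterministic multi-stack programs: a step pops the stack named by the
-- state, then a rule chosen by state and popped symbol pushes at most one
-- symbol on each stack.
record Prog : Set₁ where
  field
    St Γ   : Set
    k      : ℕ
    finSt  : Finite St
    finΓ   : Finite Γ
    start  : St
    src    : St → Fin (suc k)
    halts  : St → Maybe Outcome
    rule   : St → Maybe Γ → List⁺ (St × Vec (Maybe Γ) (suc k))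
    bit    : Bool → Γ

push? : {A : Set} → Maybe A → List A → List A
push? (just a) w = a ∷ w
push? nothing  w = w

pop : {A : Set} → List A → List A
pop []      = []
pop (_ ∷ w) = w

module Run (P : Prog) where
  open Prog P

  PC : Set
  PC = St × Vec (List Γ) (suc k)

  -- Reversal puts the first letter at the bottom, so that height i on stack 0 corresponds to cell i
  -- of the input tape.
  initPC : Word → PC
  initPC x = start , (map bit (reverse x) ∷ Vec.replicate k [])

  data _⟶_ : PC → PC → Set where
    step : ∀ {s s' σ p} → halts s ≡ nothing →
      (s' , p) ∈ toList (rule s (head (lookup σ (src s)))) →
      (s , σ) ⟶ (s' , zipWith push? p (updateAt σ (src s) pop))

  data Run (x : Word) : ℕ → PC → Set where
    here : Run x 0 (initPC x)
    next : ∀ {n c c'} → Run x n c → c ⟶ c' → Run x (suc n) c'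

  ProgOut : Word → Outcome → Set
  ProgOut x o = ∃[ n ] Σ PC λ c → Run x n c × halts (proj₁ c) ≡ just o

-- Stacks as columns of a tape

≡ᵇ-true : ∀ {i h} → i ≡ h → (i ≡ᵇ h) ≡ true
≡ᵇ-true {i} refl = lem i
  where
  lem : ∀ i → (i ≡ᵇ i) ≡ true
  lem zero    = refl
  lem (suc i) = lem i

≡ᵇ-false : ∀ {i h} → i ≢ h → (i ≡ᵇ h) ≡ false
≡ᵇ-false {i} {h} i≢h with i ≡ᵇ h in eq
... | false = refl
... | true  = ⊥-elim (i≢h (≡ᵇ⇒≡ i h (subst T (sym eq) tt)))

-- Symbol at height i, counted from the bottom of the stack.
at : {A : Set} → List A → ℕ → Maybe A
at []      i = nothing
at (a ∷ w) i = if i ≡ᵇ length w then just a else at w i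

at-≥ : {A : Set} (w : List A) {i : ℕ} → length w ≤ i → at w i ≡ nothing
at-≥ []      _  = refl
at-≥ (a ∷ w) {i} le rewrite ≡ᵇ-false {i} {length w} (λ e → <⇒≢ le (sym e)) = at-≥ w (<⇒≤ le)

at-< : {A : Set} (w : List A) {i : ℕ} → i < length w → ∃ λ a → at w i ≡ just a
at-< (a ∷ w) {i} (s≤s le) with i ≡ᵇ length w in eq
... | true  = a , refl
... | false = at-< w (≤∧≢⇒< le (λ e → case trans (sym eq) (≡ᵇ-true e) of λ ()))

at-just-< : {A : Set} (w : List A) {i : ℕ} {a : A} → at w i ≡ just a → i < length w
at-just-< w {i} e with i <? length w
... | yes lt = lt
... | no  ge = case trans (sym e) (at-≥ w (≮⇒≥ ge)) of λ ()

at-nothing-≥ : {A : Set} (w : List A) {i : ℕ} → at w i ≡ nothing → length w ≤ i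
at-nothing-≥ w {i} e with i <? length w
... | yes lt = case trans (sym e) (proj₂ (at-< w lt)) of λ ()
... | no  ge = ≮⇒≥ ge

at-∷ʳ-zero : {A : Set} (w : List A) (a : A) → at (w ++ [ a ]) 0 ≡ just a
at-∷ʳ-zero []      a = refl
at-∷ʳ-zero (b ∷ w) a rewrite length-++ w {[ a ]} | +-comm (length w) 1 = at-∷ʳ-zero w a

at-∷ʳ-suc : {A : Set} (w : List A) (a : A) (i : ℕ) → at (w ++ [ a ]) (suc i) ≡ at w i
at-∷ʳ-suc []      a i = refl
at-∷ʳ-suc (b ∷ w) a i rewrite length-++ w {[ a ]} | +-comm (length w) 1 | at-∷ʳ-suc w a i = refl

-- `fill` and `keep` treat one column at the head during the right sweep: an empty cell receives the
-- pending symbol, an occupied one leaves it pending.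
fill : {A : Set} → Maybe A → Maybe A → Maybe A
fill p (just a) = just a
fill p nothing  = p

keep : {A : Set} → Maybe A → Maybe A → Maybe A
keep p (just _) = p
keep p nothing  = nothing

found : {A : Set} → Maybe A → Maybe A → Maybe A
found (just a) _ = just a
found nothing  c = c

upd : {A : Set} → ℕ → A → (ℕ → A) → ℕ → A
upd h c f i = if i ≡ᵇ h then c else f i

upd-same : ∀ {A : Set} {f : ℕ → A} {c} h → f h ≡ c → ∀ i → upd h c f i ≡ f i
upd-same h e i with i ≡ᵇ h in eq
... | false = refl
... | true rewrite ≡ᵇ⇒≡ i h (subst T (sym eq) tt) = sym e

-- Rightward sweep: a column with its pending push, relative to the stack it
-- has to represent once the push is carried out.
data CompR {A : Set} (h : ℕ) (f : ℕ → Maybe A) : Maybe A → List A → Set where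
  done : ∀ {w} → (∀ i → f i ≡ at w i) → CompR h f nothing w
  todo : ∀ {a w} → h ≤ length w → (∀ i → f i ≡ at w i) → CompR h f (just a) (a ∷ w)

-- A stack occupies its cells without gaps, so an empty cell at `h ≤ length w` is the one just above
-- the top, where the push belongs.
compR-step : ∀ {A : Set} {h} {f f′ : ℕ → Maybe A} {p w} → CompR h f p w →
  (∀ i → f′ i ≡ upd h (fill p (f h)) f i) → CompR (suc h) f′ (keep p (f h)) w
compR-step {h = h} {f} {w = w} (done rep) eq with f h in fh
... | just a  = done λ i → trans (eq i) (trans (upd-same h fh i) (rep i))
... | nothing = done λ i → trans (eq i) (trans (upd-same h fh i) (rep i))
compR-step {h = h} {f} (todo {a} {w} le rep) eq with f h in fh
... | just b  = todo (at-just-< w (trans (sym (rep h)) fh)) λ i → trans (eq i) (trans (upd-same h fh i) (rep i))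
... | nothing = done λ i → trans (eq i) (lem i)
  where
  h≡ : h ≡ length w
  h≡ = ≤-antisym le (at-nothing-≥ w (trans (sym (rep h)) fh))
  lem : ∀ i → upd h (just a) f i ≡ (if i ≡ᵇ length w then just a else at w i)
  lem i rewrite h≡ with i ≡ᵇ length w
  ... | true  = refl
  ... | false = rep i

compR-< : ∀ {A : Set} {h} {f : ℕ → Maybe A} {p w a} → CompR h f p w → f h ≡ just a → h < length w
compR-< {h = h} {w = w} (done rep) e = at-just-< w (trans (sym (rep h)) e)
compR-< {h = h} (todo {w = w} le rep) e = m<n⇒m<1+n (at-just-< w (trans (sym (rep h)) e))

-- The push may land in cell `h` itself, so the height can be `suc h`; this is the bound with which
-- `search` starts.
compR-end : ∀ {A : Set} {h} {f : ℕ → Maybe A} {p w} → CompR h f p w → f h ≡ nothing → length w ≤ suc h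
compR-end {h = h} {w = w} (done rep) e = m≤n⇒m≤1+n (at-nothing-≥ w (trans (sym (rep h)) e))
compR-end {h = h} (todo {w = w} le rep) e = s≤s (at-nothing-≥ w (trans (sym (rep h)) e))

compR-done : ∀ {A : Set} {h} {f : ℕ → Maybe A} {w} → CompR h f nothing w → ∀ i → f i ≡ at w i
compR-done (done rep) = rep

-- Leftward sweep over the column of the popped stack.
data CompL {A : Set} (h : ℕ) (f : ℕ → Maybe A) : Maybe A → List A → Set where
  search : ∀ {w} → length w ≤ suc h → (∀ i → f i ≡ at w i) → CompL h f nothing w
  popped : ∀ {a w} → (∀ i → f i ≡ at w i) → CompL h f (just a) (a ∷ w)

erase : {A : Set} → Maybe A → Maybe A → Maybe A
erase (just _) c = c
erase nothing  _ = nothing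

-- Coming from the right, the first occupied cell is the top of the stack; it is erased and
-- remembered, and the rest of the column stays. At cell 0 the search is over, and an empty stack
-- has yielded `nothing`.
compL-erase : ∀ {A : Set} {h} {f f′ : ℕ → Maybe A} {g w} → CompL h f g w →
  (∀ i → f′ i ≡ upd h (erase g (f h)) f i) →
  CompL (pred h) f′ (found g (f h)) w × (h ≡ 0 → found g (f h) ≡ head w × (∀ i → f′ i ≡ at (pop w) i))
compL-erase {h = h} (popped {a} {w} rep) eq = popped rep′ , λ _ → refl , rep′
  where
  rep′ : ∀ i → _ ≡ at w i
  rep′ i = trans (eq i) (trans (upd-same h refl i) (rep i))
compL-erase {h = h} {f} {f′} {w = []} (search le rep) eq with f h in fh
... | just a  = case trans (sym fh) (rep h) of λ ()
... | nothing = search z≤n rep′ , λ _ → refl , rep′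
  where
  rep′ : ∀ i → f′ i ≡ nothing
  rep′ i = trans (eq i) (trans (upd-same h fh i) (rep i))
compL-erase {h = h} {f} {f′} {w = b ∷ w} (search (s≤s le) rep) eq with f h in fh
... | nothing = search (lem h (at-nothing-≥ (b ∷ w) {h} (trans (sym (rep h)) fh))) rep′ ,
    λ { refl → case at-nothing-≥ (b ∷ w) {0} (trans (sym (rep 0)) fh) of λ () }
  where
  rep′ : ∀ i → f′ i ≡ at (b ∷ w) i
  rep′ i = trans (eq i) (trans (upd-same h fh i) (rep i))
  lem : ∀ h → length (b ∷ w) ≤ h → length (b ∷ w) ≤ suc (pred h)
  lem (suc h) l = l
... | just a = subst (λ c → CompL (pred h) f′ (just c) (b ∷ w) × (h ≡ 0 → just c ≡ just b × (∀ i → f′ i ≡ at w i)))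
                 (sym a≡b) (popped rep′ , λ _ → refl , rep′)
  where
  h≡ : h ≡ length w
  h≡ = ≤-antisym (s≤s⁻¹ (at-just-< (b ∷ w) (trans (sym (rep h)) fh))) le
  a≡b : a ≡ b
  a≡b with trans (sym fh) (rep h)
  ... | e rewrite ≡ᵇ-true h≡ = case e of λ { refl → refl }
  rep′ : ∀ i → f′ i ≡ at w i
  rep′ i with i ≟ h
  ... | yes refl = trans (eq i) (trans (cong (λ c → if c then nothing else f i) (≡ᵇ-true {i} refl))
                     (sym (at-≥ w (≤-reflexive (sym h≡)))))
  ... | no  i≢h  = trans (eq i) (trans (cong (λ c → if c then nothing else f i) (≡ᵇ-false i≢h))
                     (trans (rep i) (cong (λ c → if c then just b else at w i) (≡ᵇ-false (λ e → i≢h (trans e (sym h≡)))))))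

if-map : {A B : Set} (f : A → B) (b : Bool) {x y : A} → f (if b then x else y) ≡ (if b then f x else f y)
if-map f true  = refl
if-map f false = refl

allNothing : ∀ {A : Set} {n} → Vec (Maybe A) n → Bool
allNothing []            = true
allNothing (just _ ∷ v)  = false
allNothing (nothing ∷ v) = allNothing v

allNothing-true : ∀ {A : Set} {n} (v : Vec (Maybe A) n) → allNothing v ≡ true → ∀ j → lookup v j ≡ nothing
allNothing-true (nothing ∷ v) e zero    = refl
allNothing-true (nothing ∷ v) e (suc j) = allNothing-true v e j

allNothing-false : ∀ {A : Set} {n} (v : Vec (Maybe A) n) → allNothing v ≡ false →
  ∃ λ j → ∃ λ a → lookup v j ≡ just a
allNothing-false (just a ∷ v)  e = zero , a , refl
allNothing-false (nothing ∷ v) e with allNothing-false v e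
... | j , a , eq = suc j , a , eq

-- A program is run on one tape with a track per stack: pushes are carried out
-- while sweeping right, and the pop of the next step while sweeping back.
-- Cell 0 carries a mark.
module Compile (P : Prog) where
  open Prog P
  open Run P

  data CSt : Set where
    boot : CSt
    rgt  : St → Vec (Maybe Γ) (suc k) → CSt
    lft  : St → Maybe Γ → CSt

  abstract
    finCSt : Finite CSt
    finCSt = finite-retract
      (finite-⊎ finite-⊤ (finite-⊎ (finite-× finSt (finite-Vec (finite-Maybe finΓ) (suc k))) (finite-× finSt (finite-Maybe finΓ))))
      (λ { boot → inj₁ tt ; (rgt s p) → inj₂ (inj₁ (s , p)) ; (lft s f) → inj₂ (inj₂ (s , f)) })
      (λ { (inj₁ _) → boot ; (inj₂ (inj₁ (s , p))) → rgt s p ; (inj₂ (inj₂ (s , f))) → lft s f })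
      (λ { boot → refl ; (rgt _ _) → refl ; (lft _ _) → refl })

  Cell : Set
  Cell = Bool × Vec (Maybe Γ) (suc k)

  abstract
    finCell : Finite Cell
    finCell = finite-× finite-Bool (finite-Vec (finite-Maybe finΓ) (suc k))

  nCell : ℕ
  nCell = size finCell

  -- The three raw symbols are read as unmarked cells with at most track 0 in use. The input thus is
  -- a legal tape without any translation; only cell 0 still needs its mark.
  decode : Sym nCell → Cell
  decode zero                = false , Vec.replicate (suc k) nothing
  decode (suc zero)          = false , just (bit false) ∷ Vec.replicate k nothing
  decode (suc (suc zero))    = false , just (bit true) ∷ Vec.replicate k nothing
  decode (suc (suc (suc i))) = from finCell i

  encode : Cell → Sym nCell
  encode c = suc (suc (suc (to finCell c)))

  kindC : CSt → Kind
  kindC boot      = work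
  kindC (rgt s p) = maybe′ halt work (halts s)
  kindC (lft s f) = work

  eraseAt : Fin (suc k) → Maybe Γ → Vec (Maybe Γ) (suc k) → Vec (Maybe Γ) (suc k)
  eraseAt j f v = updateAt v j (erase f)

  -- At a cell empty in every column all pending pushes are carried out, so the sweep can turn. It
  -- turns in place because this cell may have just received a top.
  δC : CSt → Cell → List⁺ (CSt × Cell × Move)
  δC boot      (m , v) = (rgt start (Vec.replicate (suc k) nothing) , (true , v) , stay) ∷ []
  δC (rgt s p) (m , v) = if allNothing v
    then (lft s nothing , (m , zipWith fill p v) , stay) ∷ []
    else (rgt s (zipWith keep p v) , (m , zipWith fill p v) , right) ∷ []
  δC (lft s f) (m , v) = if m
    then List⁺.map (λ { (s′ , p) → rgt s′ p , (m , eraseAt (src s) f v) , stay }) (rule s (found f (lookup v (src s))))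
    else (lft s (found f (lookup v (src s))) , (m , eraseAt (src s) f v) , left) ∷ []

  emit : CSt × Cell × Move → Fin (size finCSt) × Sym nCell × Move × Maybe Bool
  emit (c , cell , m) = to finCSt c , encode cell , m , nothing

  machine : NOTM
  machine = record
    { nS = size finCSt ; nΓ = nCell
    ; kind = kindC ∘ from finCSt
    ; start = to finCSt boot ; yesS = to finCSt boot ; noS = to finCSt boot
    ; δ = λ s a → List⁺.map emit (δC (from finCSt s) (decode a)) }

  Cf : Set
  Cf = Config machine

  Tape : Set
  Tape = ℕ → Sym nCell

  conf : CSt → ℕ → Tape → Word → Cf
  conf c = cfg (to finCSt c)

  kind-conf : ∀ c → NOTM.kind machine (to finCSt c) ≡ kindC c
  kind-conf c = cong kindC (from∘to finCSt c)

  wr : ℕ → Cell → Tape → Tape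
  wr h c = writeTape h (encode c)

  kind≢query : ∀ c → kindC c ≢ query
  kind≢query (rgt s p) with halts s
  ... | just _  = λ ()
  ... | nothing = λ ()

  step-inv : ∀ {D} c {h t q cf} → Step machine D (conf c h t q) cf →
    ∃ λ c′ → ∃ λ cell → ∃ λ m → (c′ , cell , m) ∈ toList (δC c (decode (t h))) × kindC c ≡ work ×
      cf ≡ conf c′ (moveHead m h) (wr h cell t) q
  step-inv c {h} {t} (work-step kw mem) rewrite from∘to finCSt c with ∈-map⁻ emit mem
  ... | (c′ , cell , m) , mem′ , refl = c′ , cell , m , mem′ , kw , refl
  step-inv c (query-yes kq _) = ⊥-elim (kind≢query c (trans (sym (kind-conf c)) kq))
  step-inv c (query-no kq _)  = ⊥-elim (kind≢query c (trans (sym (kind-conf c)) kq))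

  step-intro : ∀ {D c h t q c′ cell m} → (c′ , cell , m) ∈ toList (δC c (decode (t h))) → kindC c ≡ work →
    Step machine D (conf c h t q) (conf c′ (moveHead m h) (wr h cell t) q)
  step-intro {c = c} {h} {t} mem kw = work-step (trans (kind-conf c) kw)
    (subst (λ c → _ ∈ toList (List⁺.map emit (δC c (decode (t h))))) (sym (from∘to finCSt c)) (∈-map⁺ emit mem))

  col : Tape → Fin (suc k) → ℕ → Maybe Γ
  col t j i = lookup (proj₂ (decode (t i))) j

  mark : Tape → ℕ → Bool
  mark t i = proj₁ (decode (t i))

  decode-wr : ∀ h c t i → decode (wr h c t i) ≡ upd h c (decode ∘ t) i
  decode-wr h c t i with i ≡ᵇ h
  ... | true  = from∘to finCell c
  ... | false = refl

  col-wr : ∀ h m v t j i → col (wr h (m , v) t) j i ≡ upd h (lookup v j) (col t j) i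
  col-wr h m v t j i rewrite decode-wr h (m , v) t i = if-map (λ c → lookup (proj₂ c) j) (i ≡ᵇ h)

  Marked : Tape → Set
  Marked t = ∀ i → mark t i ≡ (i ≡ᵇ 0)

  marked-wr : ∀ {h t} v → Marked t → Marked (wr h (mark t h , v) t)
  marked-wr {h} {t} v mk i rewrite decode-wr h (mark t h , v) t i
    with i ≡ᵇ h in eq
  ... | false = mk i
  ... | true  rewrite ≡ᵇ⇒≡ i h (subst T (sym eq) tt) = mk h

  Short : ℕ → PC → Set
  Short H (s , σ) = ∀ j → length (lookup σ j) ≤ H

  -- Sim H r cf c: cf works towards c and is at most r tape steps away from
  -- choosing the rule to be applied in c.
  data Sim (H : ℕ) : ℕ → Cf → PC → Set where
    simR : ∀ {s p h t q σ} → h ≤ H → Marked t →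
      (∀ j → CompR h (col t j) (lookup p j) (lookup σ j)) →
      Sim H ((H ∸ h) + (2 + H)) (conf (rgt s p) h t q) (s , σ)
    simL : ∀ {s f h t q σ} → halts s ≡ nothing → Marked t →
      (∀ j → j ≢ src s → ∀ i → col t j i ≡ at (lookup σ j) i) →
      CompL h (col t (src s)) f (lookup σ (src s)) →
      Sim H (suc h) (conf (lft s f) h t q) (s , σ)

  -- One program step takes up to H moves to the right, the turn, and up to H + 1 steps back, the
  -- last of which chooses the rule at the mark.
  full : ℕ → ℕ
  full H = H + (2 + H)

  data Advance (H r : ℕ) (cf : Cf) (c : PC) : Set where
    inner : ∀ {r′} → r′ < r → Sim H r′ cf c → Advance H r cf c
    outer : ∀ {c′} → 0 < r → c ⟶ c′ → Sim H (full H) cf c′ → Advance H r cf c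

  turn : ∀ {H s p h t q σ} → halts s ≡ nothing → Marked t → (∀ j → CompR h (col t j) (lookup p j) (lookup σ j)) →
    allNothing (proj₂ (decode (t h))) ≡ true →
    Sim H (suc h) (conf (lft s nothing) h (wr h (mark t h , zipWith fill p (proj₂ (decode (t h)))) t) q) (s , σ)
  turn {s = s} {p} {h} {t} {σ = σ} hs mk cs an = simL hs (marked-wr _ mk)
    (λ j _ → compR-done (cs″ j))
    (search (compR-end (cs (src s)) (empties (src s))) (compR-done (cs″ (src s))))
    where
    v = proj₂ (decode (t h))
    empties : ∀ j → lookup v j ≡ nothing
    empties = allNothing-true v an
    keep≡ : ∀ j → keep (lookup p j) (lookup v j) ≡ nothing
    keep≡ j rewrite empties j = refl
    cs′ : ∀ j → CompR (suc h) (col (wr h (mark t h , zipWith fill p v) t) j) (keep (lookup p j) (lookup v j)) (lookup σ j)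
    cs′ j = compR-step (cs j) λ i → trans (col-wr h _ _ t j i)
      (cong (λ c → upd h c (col t j) i) (lookup-zipWith fill j p v))
    cs″ : ∀ j → CompR (suc h) (col (wr h (mark t h , zipWith fill p v) t) j) nothing (lookup σ j)
    cs″ j = subst (λ c → CompR (suc h) (col (wr h (mark t h , zipWith fill p v) t) j) c (lookup σ j)) (keep≡ j) (cs′ j)

  sweepR : ∀ {H s p h t q σ} → h ≤ H → Short H (s , σ) → Marked t → (∀ j → CompR h (col t j) (lookup p j) (lookup σ j)) →
    allNothing (proj₂ (decode (t h))) ≡ false →
    ∃ λ r → r < (H ∸ h) + (2 + H) × Sim H r
     (conf (rgt s (zipWith keep p (proj₂ (decode (t h))))) (suc h) (wr h (mark t h , zipWith fill p (proj₂ (decode (t h)))) t) q) (s , σ)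
  sweepR {H} {s} {p} {h} {t} {σ = σ} h≤H sh mk cs an = _ , lt , simR h<H (marked-wr _ mk) cs′
    where
    v = proj₂ (decode (t h))
    h<H : h < H
    h<H with allNothing-false v an
    ... | j , a , e = ≤-trans (compR-< (cs j) e) (sh j)
    lt : (H ∸ suc h) + (2 + H) < (H ∸ h) + (2 + H)
    lt = +-monoˡ-< (2 + H) (∸-monoʳ-< (n<1+n h) h<H)
    cs′ : ∀ j → CompR (suc h) (col (wr h (mark t h , zipWith fill p v) t) j) (lookup (zipWith keep p v) j) (lookup σ j)
    cs′ j rewrite lookup-zipWith keep j p v = compR-step (cs j) λ i → trans (col-wr h _ _ t j i)
      (cong (λ c → upd h c (col t j) i) (lookup-zipWith fill j p v))

  module SweepL (s : St) (f : Maybe Γ) (h : ℕ) (t : Tape) (σ : Vec (List Γ) (suc k)) (hs : halts s ≡ nothing) (mk : Marked t)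
    (others : ∀ j → j ≢ src s → ∀ i → col t j i ≡ at (lookup σ j) i)
    (cl : CompL h (col t (src s)) f (lookup σ (src s))) where

    v = proj₂ (decode (t h))
    t′ = wr h (mark t h , eraseAt (src s) f v) t
    f′ = found f (lookup v (src s))

    others′ : ∀ j → j ≢ src s → ∀ i → col t′ j i ≡ at (lookup σ j) i
    others′ j j≢ i = trans (col-wr h _ _ t j i)
      (trans (cong (λ c → upd h c (col t j) i) (lookup∘updateAt′ j (src s) j≢ v))
        (trans (upd-same h refl i) (others j j≢ i)))

    own′ = compL-erase {f′ = col t′ (src s)} cl
      (λ i → trans (col-wr h _ _ t (src s) i) (cong (λ c → upd h c (col t (src s)) i) (lookup∘updateAt (src s) v)))

    back : ∀ {H q} → Sim H (suc (pred h)) (conf (lft s f′) (pred h) t′ q) (s , σ)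
    back = simL hs (marked-wr _ mk) others′ (proj₁ own′)

    apply : ∀ {H q} {e : St × Vec (Maybe Γ) (suc k)} → h ≡ 0 →
      Sim H (full H) (conf (rgt (proj₁ e) (proj₂ e)) 0 t′ q) (proj₁ e , zipWith push? (proj₂ e) (updateAt σ (src s) pop))
    apply {e = s′ , p} h≡0 = simR z≤n (marked-wr _ mk) comps
      where
      colp : ∀ j i → col t′ j i ≡ at (lookup (updateAt σ (src s) pop) j) i
      colp j i with j Fin.≟ src s
      ... | yes refl rewrite lookup∘updateAt (src s) {pop} σ = proj₂ (proj₂ own′ h≡0) i
      ... | no  j≢   rewrite lookup∘updateAt′ j (src s) {pop} j≢ σ = others′ j j≢ i
      comps : ∀ j → CompR 0 (col t′ j) (lookup p j) (lookup (zipWith push? p (updateAt σ (src s) pop)) j)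
      comps j rewrite lookup-zipWith push? j p (updateAt σ (src s) pop) with lookup p j
      ... | nothing = done (colp j)
      ... | just a  = todo z≤n (colp j)

    found≡ : h ≡ 0 → f′ ≡ head (lookup σ (src s))
    found≡ h≡0 = proj₁ (proj₂ own′ h≡0)

  halting-stuck : ∀ {s p h t q D cf o} → halts s ≡ just o → ¬ Step machine D (conf (rgt s p) h t q) cf
  halting-stuck {s} {p} hs st with step-inv (rgt s p) st
  ... | _ , _ , _ , _ , kw , _ rewrite hs = case kw of λ ()

  sim-step : ∀ {H r cf cf′ c D} → Short H c → Sim H r cf c → Step machine D cf cf′ → Advance H r cf′ c
  sim-step {H} {D = D} sh (simR {s} {p} {h} {t} {q} {σ} h≤H mk cs) st with halts s in hs
  ... | just _ = ⊥-elim (halting-stuck {p = p} hs st)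
  ... | nothing with step-inv (rgt s p) st
  ... | c′ , cell , m , mem , _ , refl with allNothing (proj₂ (decode (t h))) in an | mem
  ... | true  | here refl = inner (≤-trans (s≤s (s≤s h≤H)) (m≤n+m _ (H ∸ h))) (turn hs mk cs an)
  ... | false | here refl with sweepR {q = q} h≤H sh mk cs an
  ... | r , lt , sim = inner lt sim
  sim-step {H} sh (simL {s} {f} {h} {t} {q} {σ} hs mk others cl) st with step-inv (lft s f) st
  ... | c′ , cell , m , mem , _ , refl with decode (t h) in dt | mk h
  sim-step {H} sh (simL {s} {f} {suc h} {t} {q} {σ} hs mk others cl) st
      | c′ , cell , m , here refl , _ , refl | (.false , v) | refl rewrite sym (cong proj₁ dt) | sym (cong proj₂ dt) =
    inner (s≤s (s≤s ≤-refl)) (SweepL.back s f (suc h) t σ hs mk others cl)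
  sim-step {H} sh (simL {s} {f} {zero} {t} {q} {σ} hs mk others cl) st
      | c′ , cell , m , mem , _ , refl | (.true , v) | refl
    rewrite sym (cong proj₁ dt) | sym (cong proj₂ dt) with ∈-map⁻ _ mem
  ... | e , mem′ , refl = outer (s≤s z≤n)
    (step hs (subst (λ g → e ∈ toList (rule s g)) (SweepL.found≡ s f 0 t σ hs mk others cl refl) mem′))
    (SweepL.apply s f 0 t σ hs mk others cl refl)

-- Polynomial bounds

^-weakenˡ : ∀ n d e → (2 + n) ^ d ≤ (2 + n) ^ (d + e)
^-weakenˡ n d e = ^-monoʳ-≤ (2 + n) (m≤m+n d e)

^-weakenʳ : ∀ n d e → (2 + n) ^ e ≤ (2 + n) ^ (d + e)
^-weakenʳ n d e = ^-monoʳ-≤ (2 + n) (m≤n+m e d)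

n<2^n : ∀ n → n < 2 ^ n
n<2^n zero    = s≤s z≤n
n<2^n (suc n) = begin-strict
  suc n           ≡⟨ +-comm 1 n ⟩
  n + 1           <⟨ +-mono-<-≤ (n<2^n n) (m^n>0 2 n) ⟩
  2 ^ n + 2 ^ n   ≡⟨ cong (2 ^ n +_) (sym (+-identityʳ (2 ^ n))) ⟩
  2 ^ suc n       ∎
  where open ≤-Reasoning

-- A base of at least 2 absorbs coefficients and constants into the exponent, so that one number
-- describes the bound.
PolyBounded : (ℕ → ℕ) → Set
PolyBounded f = ∃ λ e → ∀ n → f n ≤ (2 + n) ^ e

pb-const : ∀ c → PolyBounded (λ _ → c)
pb-const c = c , λ n → ≤-trans (<⇒≤ (n<2^n c)) (^-monoˡ-≤ c (m≤m+n 2 n))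

pb-id : PolyBounded id
pb-id = 1 , λ n → ≤-trans (m≤n+m n 2) (≤-reflexive (sym (^-identityʳ (2 + n))))

pb-* : ∀ {f g} → PolyBounded f → PolyBounded g → PolyBounded (λ n → f n * g n)
pb-* (d , p) (e , q) = d + e , λ n → ≤-trans (*-mono-≤ (p n) (q n)) (≤-reflexive (sym (^-distribˡ-+-* (2 + n) d e)))

pb-+ : ∀ {f g} → PolyBounded f → PolyBounded g → PolyBounded (λ n → f n + g n)
pb-+ {f} {g} (d , p) (e , q) = suc (d + e) , λ n → let open ≤-Reasoning in begin
  f n + g n                                      ≤⟨ +-mono-≤ (≤-trans (p n) (^-weakenˡ n d e)) (≤-trans (q n) (^-weakenʳ n d e)) ⟩
  (2 + n) ^ (d + e) + (2 + n) ^ (d + e)          ≡⟨ cong ((2 + n) ^ (d + e) +_) (sym (+-identityʳ _)) ⟩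
  2 * (2 + n) ^ (d + e)                          ≤⟨ *-monoˡ-≤ ((2 + n) ^ (d + e)) (m≤m+n 2 n) ⟩
  (2 + n) ^ suc (d + e)                          ∎

pb-^ : ∀ k → PolyBounded (_^ k)
pb-^ k = k , λ n → ^-monoˡ-≤ k (m≤n+m n 2)

^-distribʳ-* : ∀ a b e → (a * b) ^ e ≡ a ^ e * b ^ e
^-distribʳ-* a b zero    = refl
^-distribʳ-* a b (suc e) rewrite ^-distribʳ-* a b e = *-*-comm a b (a ^ e) (b ^ e)
  where
  *-*-comm : ∀ a b c d → (a * b) * (c * d) ≡ (a * c) * (b * d)
  *-*-comm = solve-∀

pb-monomial : ∀ {f} → PolyBounded f → ∃[ c ] ∃[ k ] ∀ n → f n ≤ c * n ^ k + c
-- 2 + n ≤ 3 n for n ≥ 1; the additive constant takes care of n = 0.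
pb-monomial {f} (e , p) = 3 ^ e , e , λ n → ≤-trans (p n) (bound n)
  where
  bound : ∀ n → (2 + n) ^ e ≤ 3 ^ e * n ^ e + 3 ^ e
  bound zero    = ≤-trans (^-monoˡ-≤ e (m≤m+n 2 1)) (m≤n+m (3 ^ e) _)
  bound (suc n) = ≤-trans (^-monoˡ-≤ e le) (≤-trans (≤-reflexive (^-distribʳ-* 3 (suc n) e)) (m≤m+n _ (3 ^ e)))
    where
    le : 3 + n ≤ 3 * suc n
    le = ≤-trans (+-monoʳ-≤ 3 (m≤m+n n (n + n))) (≤-reflexive (lem n))
      where
      lem : ∀ n → 3 + (n + (n + n)) ≡ 3 * suc n
      lem = solve-∀

module Compiled (P : Prog) (T : ℕ → ℕ) (pbT : PolyBounded T)
  (bounded : ∀ x r c → Run.Run P x r c → r ≤ T (length x)) where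
  open Prog P
  open Run P
  open Compile P

  rule-turn : ∀ {m} s p v → allNothing v ≡ true →
    (lft s nothing , (m , zipWith fill p v) , stay) ∈ toList (δC (rgt s p) (m , v))
  rule-turn s p v an rewrite an = here refl

  rule-right : ∀ {m} s p v → allNothing v ≡ false →
    (rgt s (zipWith keep p v) , (m , zipWith fill p v) , right) ∈ toList (δC (rgt s p) (m , v))
  rule-right s p v an rewrite an = here refl

  no-stack : (j : Fin k) → lookup (Vec.replicate k []) j ≡ (List Γ ∋ [])
  no-stack j = lookup-replicate j []

  run-height : ∀ {x r s σ} → Run x r (s , σ) → ∀ j → length (lookup σ j) ≤ length x + r
  run-height {x} here zero    = ≤-reflexive (trans (length-map bit (reverse x)) (trans (length-reverse x) (sym (+-identityʳ _))))
  run-height {x} here (suc j) = ≤-trans (≤-reflexive (cong length (no-stack j))) z≤n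
  run-height {x} (next {n} rn (step {s = s} {σ = σ} {p} _ _)) j rewrite lookup-zipWith push? j p (updateAt σ (src s) pop) =
    ≤-trans (push-len (lookup p j) _) (≤-trans (s≤s (≤-trans pop-len (run-height rn j))) (≤-reflexive (sym (+-suc (length x) n))))
    where
    push-len : ∀ (m : Maybe Γ) w → length (push? m w) ≤ suc (length w)
    push-len (just _) w = ≤-refl
    push-len nothing  w = n≤1+n _
    len-pop : ∀ (w : List Γ) → length (pop w) ≤ length w
    len-pop []      = z≤n
    len-pop (_ ∷ w) = n≤1+n _
    pop-len : length (lookup (updateAt σ (src s) pop) j) ≤ length (lookup σ j)
    pop-len with j Fin.≟ src s
    ... | yes refl rewrite lookup∘updateAt (src s) {pop} σ = len-pop (lookup σ (src s))
    ... | no  j≢   rewrite lookup∘updateAt′ j (src s) {pop} j≢ σ = ≤-refl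

  module _ (D : Lang) (x : Word) where
    -- Bounds all heights: only stack 0 starts nonempty, and a step pushes at most one symbol on
    -- each stack.
    H : ℕ
    H = length x + T (length x)

    short : ∀ {r c} → Run x r c → Short H c
    short rn j = ≤-trans (run-height rn j) (+-monoʳ-≤ (length x) (bounded x _ _ rn))

    inputTape-col : ∀ y i → lookup (proj₂ (decode (inputTape y i))) zero ≡ at (map bit (reverse y)) i
    inputTape-col []      i       = refl
    inputTape-col (b ∷ y) i rewrite unfold-reverse b y | map-++ bit (reverse y) [ b ] with i
    inputTape-col (true  ∷ y) i | zero  = sym (at-∷ʳ-zero (map bit (reverse y)) (bit true))
    inputTape-col (false ∷ y) i | zero  = sym (at-∷ʳ-zero (map bit (reverse y)) (bit false))
    inputTape-col (b ∷ y) i     | suc i′ = trans (inputTape-col y i′) (sym (at-∷ʳ-suc (map bit (reverse y)) (bit b) i′))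

    inputTape-unmarked : ∀ y i → proj₁ (decode (inputTape y i)) ≡ false
    inputTape-unmarked []          i       = refl
    inputTape-unmarked (true ∷ y)  zero    = refl
    inputTape-unmarked (false ∷ y) zero    = refl
    inputTape-unmarked (b ∷ y)     (suc i) = inputTape-unmarked y i

    inputTape-col-suc : ∀ y i j → lookup (proj₂ (decode (inputTape y i))) (suc j) ≡ nothing
    inputTape-col-suc []          i       j = lookup-replicate j nothing
    inputTape-col-suc (true ∷ y)  zero    j = lookup-replicate j nothing
    inputTape-col-suc (false ∷ y) zero    j = lookup-replicate j nothing
    inputTape-col-suc (b ∷ y)     (suc i) j = inputTape-col-suc y i j

    v₀ = proj₂ (decode (inputTape x 0))

    cf₁ : Cf
    cf₁ = conf (rgt start (Vec.replicate (suc k) nothing)) 0 (wr 0 (true , v₀) (inputTape x)) []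

    sim₁ : Sim H (full H) cf₁ (initPC x)
    sim₁ = simR z≤n mk comps
      where
      mk : Marked (wr 0 (true , v₀) (inputTape x))
      mk i rewrite decode-wr 0 (true , v₀) (inputTape x) i with i ≡ᵇ 0
      ... | true  = refl
      ... | false = inputTape-unmarked x i
      col₀ : ∀ j i → col (inputTape x) j i ≡ at (lookup (proj₂ (initPC x)) j) i
      col₀ zero    i = inputTape-col x i
      col₀ (suc j) i = trans (inputTape-col-suc x i j) (cong (λ w → at w i) (sym (no-stack j)))
      comps : ∀ j → CompR 0 (col (wr 0 (true , v₀) (inputTape x)) j) (lookup (Vec.replicate (suc k) nothing) j) (lookup (proj₂ (initPC x)) j)
      comps j rewrite lookup-replicate {n = suc k} j (Maybe Γ ∋ nothing) = done λ i →
        trans (col-wr 0 true v₀ (inputTape x) j i) (trans (upd-same {f = col (inputTape x) j} 0 refl i) (col₀ j i))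

    -- `n + ρ` is a potential: tape steps inside a program step do not raise it, and each program
    -- step adds at most `full H`. The summand 1 is the boot step.
    data Tracks (n : ℕ) (cf : Cf) : Set where
      booting  : n ≡ 0 → cf ≡ initCfg machine x → Tracks n cf
      tracking : ∀ {r c ρ} → Run x r c → Sim H ρ cf c → n + ρ ≤ 1 + suc r * full H → Tracks n cf

    tracks : ∀ {n cf} → Reach machine D x n cf → Tracks n cf
    tracks here = booting refl refl
    tracks (next rc st) with tracks rc
    ... | booting refl refl with step-inv boot st
    ... | _ , _ , _ , here refl , _ , refl = tracking here sim₁ (s≤s (≤-reflexive (sym (+-identityʳ _))))
    tracks (next {n} rc st) | tracking {r} {c} {ρ} rn sim le with sim-step (short rn) sim st
    ... | inner {r′} lt sim′ = tracking rn sim′ (≤-trans (≤-reflexive (sym (+-suc n r′))) (≤-trans (+-monoʳ-≤ n lt) le))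
    ... | outer {c′} 0<ρ st′ sim′ = tracking (next rn st′) sim′ (begin
        suc n + full H                    ≤⟨ +-monoˡ-≤ (full H) (≤-trans (≤-trans (≤-reflexive (+-comm 1 n)) (+-monoʳ-≤ n 0<ρ)) le) ⟩
        1 + suc r * full H + full H       ≡⟨ cong suc (+-comm (suc r * full H) (full H)) ⟩
        1 + suc (suc r) * full H          ∎)
      where open ≤-Reasoning

    time : ∀ {n cf} → Reach machine D x n cf → n ≤ 1 + suc (T (length x)) * full H
    time rc with tracks rc
    ... | booting refl _ = z≤n
    ... | tracking rn _ le = ≤-trans (m≤m+n _ _) (≤-trans le (s≤s (*-monoˡ-≤ (full H) (s≤s (bounded x _ _ rn)))))

    sound : ∀ {o} → Out machine D x o → ProgOut x o
    sound (n , cf , rc , ko) with tracks rc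
    ... | booting refl refl = case trans (sym ko) (kind-conf boot) of λ ()
    ... | tracking rn (simL {s} {f} _ _ _ _) _ = case trans (sym ko) (kind-conf (lft s f)) of λ ()
    ... | tracking {r} rn (simR {s} {p} {σ = σ} _ _ _) _ = r , (s , σ) , rn , lem (trans (sym (kind-conf (rgt s p))) ko)
      where
      lem : ∀ {o} → kindC (rgt s p) ≡ halt o → halts s ≡ just o
      lem e with halts s
      lem refl | just o = refl

    Extends : PC → Set
    Extends c = ∃ λ n → ∃ λ cf → ∃ λ ρ → Reach machine D x n cf × Sim H ρ cf c

    forward : ∀ fuel {n cf ρ c c′} → ρ ≤ fuel → Short H c → Reach machine D x n cf → Sim H ρ cf c → c ⟶ c′ → Extends c′
    forward zero {ρ = ρ} le sh rc sim st = ⊥-elim (n≮0 (≤-trans (pos sim) le))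
      where
      pos : ∀ {ρ cf c} → Sim H ρ cf c → 0 < ρ
      pos (simR {h = h} _ _ _) = ≤-trans (s≤s z≤n) (m≤n+m _ (H ∸ h))
      pos (simL _ _ _ _)       = s≤s z≤n
    forward (suc fuel) le sh rc (simR {s} {p} {h} {t} {q} h≤H mk cs) st@(step hs _)
      with allNothing (proj₂ (decode (t h))) in an
    ... | true  = forward fuel (s≤s⁻¹ (≤-trans (≤-trans (s≤s (s≤s h≤H)) (m≤n+m _ (H ∸ h))) le)) sh
          (next rc (step-intro (rule-turn s p _ an) (cong (maybe′ halt work) hs))) (turn hs mk cs an) st
    ... | false with sweepR {q = q} h≤H sh mk cs an
    ... | r , lt , sim = forward fuel (s≤s⁻¹ (≤-trans lt le)) sh
          (next rc (step-intro (rule-right s p _ an) (cong (maybe′ halt work) hs))) sim st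
    forward (suc fuel) le sh rc (simL {s} {f} {suc h} {t} {q} {σ} hs mk others cl) st = forward fuel (s≤s⁻¹ le) sh
        (next rc (step-intro mem refl)) (SweepL.back s f (suc h) t σ hs mk others cl) st
      where
      mem : (lft s (found f (lookup (proj₂ (decode (t (suc h)))) (src s))) ,
             (mark t (suc h) , eraseAt (src s) f (proj₂ (decode (t (suc h))))) , left) ∈ toList (δC (lft s f) (decode (t (suc h))))
      mem rewrite mk (suc h) = here refl
    forward (suc fuel) le sh rc (simL {s} {f} {zero} {t} {q} {σ} hs mk others cl) (step {s' = s′} {p = p} _ mem) =
        _ , _ , _ , next rc (step-intro mem′ refl) , SweepL.apply s f 0 t σ hs mk others cl refl
      where
      v = proj₂ (decode (t 0))
      mem″ : (s′ , p) ∈ toList (rule s (found f (lookup v (src s))))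
      mem″ = subst (λ g → (s′ , p) ∈ toList (rule s g)) (sym (SweepL.found≡ s f 0 t σ hs mk others cl refl)) mem
      mem′ : (rgt s′ p , (mark t 0 , eraseAt (src s) f v) , stay) ∈ toList (δC (lft s f) (decode (t 0)))
      mem′ with mark t 0 | mk 0
      ... | .true | refl = ∈-map⁺ _ mem″

    reachable : ∀ {r c} → Run x r c → Extends c
    reachable here = 1 , cf₁ , _ , next here (step-intro {c = boot} (here refl) refl) , sim₁
    reachable (next rn st) with reachable rn
    ... | n , cf , ρ , rc , sim = forward ρ ≤-refl (short rn) rc sim st

    complete : ∀ {o} → ProgOut x o → Out machine D x o
    complete (r , (s , σ) , rn , ho) with reachable rn
    ... | n , _ , _ , rc , simR {p = p} _ _ _ = n , _ , rc , trans (kind-conf (rgt s p)) (cong (maybe′ halt work) ho)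
    ... | n , _ , _ , rc , simL hs _ _ _ = case trans (sym ho) hs of λ ()

  nptm : NPTM
  nptm = record { machine = machine ; poly = polyTime }
    where
    pbH : PolyBounded (λ n → n + T n)
    pbH = pb-+ pb-id pbT
    pbTime = pb-monomial (pb-+ (pb-const 1) (pb-* (pb-+ (pb-const 1) pbT) (pb-+ pbH (pb-+ (pb-const 2) pbH))))
    polyTime : PolyTime machine
    polyTime = proj₁ pbTime , proj₁ (proj₂ pbTime) , λ D x n cf rc →
      ≤-trans (time D x rc) (proj₂ (proj₂ pbTime) (length x))

  accepts : ∀ {D x} → Out machine D x acc → ProgOut x acc
  accepts {D} {x} = sound D x

  accepted : ∀ {D x} → ProgOut x acc → Out machine D x acc
  accepted {D} {x} = complete D x

-- Coding A into an oracle

-- The query tape is append-only; interleaving letter by letter lets a machine write the code during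
-- a single scan of x.
interleave : Word → Word → Word
interleave (a ∷ x) (c ∷ y) = a ∷ c ∷ interleave x y
interleave _       _       = []

-- Oracle word announcing A(x) = b, valid when y is the pad reserved for length |x|.
code : Word → Word → Bool → Word
code x y b = interleave x y ++ [ b ]

interleave-∷ʳ : ∀ u y b c → length y ≡ length u →
  (interleave u y ++ [ b ]) ++ [ c ] ≡ interleave (u ++ [ b ]) (y ++ [ c ])
interleave-∷ʳ []      []      b c e = refl
interleave-∷ʳ (a ∷ u) (d ∷ y) b c e = cong (λ w → a ∷ d ∷ w) (interleave-∷ʳ u y b c (suc-injective e))

length-code : ∀ x y b → length y ≡ length x → length (code x y b) ≡ suc (length x + length x)
length-code []      []      b e = refl
length-code (a ∷ x) (c ∷ y) b e = cong suc (trans (cong suc (length-code x y b (suc-injective e)))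
  (cong suc (sym (+-suc (length x) (length x)))))

code-injective : ∀ x x′ y y′ b b′ → length y ≡ length x → length y′ ≡ length x′ →
  code x y b ≡ code x′ y′ b′ → x ≡ x′ × y ≡ y′ × b ≡ b′
code-injective []      []        []      []        b .b _ _ refl = refl , refl , refl
code-injective []      (_ ∷ _)   []      (_ ∷ _)   b b′ _ _ ()
code-injective (_ ∷ _) []        (_ ∷ _) []        b b′ _ _ ()
code-injective (a ∷ x) (a′ ∷ x′) (c ∷ y) (c′ ∷ y′) b b′ e e′ eq with ∷-injective eq
... | refl , eq₁ with ∷-injective eq₁
... | refl , eq₂ with code-injective x x′ y y′ b b′ (suc-injective e) (suc-injective e′) eq₂
... | refl , refl , refl = refl , refl , refl

pattern scanSt  = zero
pattern guessSt = suc zero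
pattern askSt   = suc (suc zero)
pattern hitSt   = suc (suc (suc zero))
pattern missSt  = suc (suc (suc (suc zero)))
pattern endSt b = suc (suc (suc (suc (suc b))))

decoderKind : Fin 7 → Kind
decoderKind scanSt           = work
decoderKind guessSt          = work
decoderKind askSt            = query
decoderKind hitSt            = work
decoderKind missSt           = halt unk
decoderKind (endSt zero)     = halt rej
decoderKind (endSt (suc _))  = halt acc

endOf : Bool → Fin 7
endOf b = endSt (if b then suc zero else zero)

decoderδ : Fin 7 → Sym 0 → List⁺ (Fin 7 × Sym 0 × Move × Maybe Bool)
decoderδ scanSt zero           = (askSt , bitSym true , stay , just true) ∷ (askSt , bitSym false , stay , just false) ∷ []
decoderδ scanSt (suc zero)     = (guessSt , suc zero , stay , just false) ∷ []
decoderδ scanSt a              = (guessSt , a , stay , just true) ∷ []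
decoderδ guessSt a             = (scanSt , a , right , just true) ∷ (scanSt , a , right , just false) ∷ []
decoderδ hitSt (suc (suc a))   = (endOf true , suc (suc a) , stay , nothing) ∷ []
decoderδ hitSt a               = (endOf false , a , stay , nothing) ∷ []
decoderδ _ a                   = (missSt , a , stay , nothing) ∷ []

-- Guesses a pad and a value, asks for the corresponding code word, and answers
-- with the guessed value (kept on the tape) if the oracle contains it.
decoder : NOTM
decoder = record { nS = 7 ; nΓ = 0 ; kind = decoderKind ; start = scanSt ; yesS = hitSt ; noS = missSt ; δ = decoderδ }

module Decoder (D : Lang) (x : Word) where

  HoldsAt : ℕ → (ℕ → Sym 0) → Word → Set
  HoldsAt h t v = ∀ i → t (h + i) ≡ inputTape v i

  -- The index is the exact number of steps made, so the linear time bound can be read off.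
  data Inv : ℕ → Config decoder → Set where
    inScan  : ∀ {t} u v y → x ≡ u ++ v → length y ≡ length u → HoldsAt (length u) t v →
      Inv (length u + length u) (cfg scanSt (length u) t (interleave u y))
    inGuess : ∀ {t} u b v y → x ≡ u ++ b ∷ v → length y ≡ length u → HoldsAt (length u) t (b ∷ v) →
      Inv (suc (length u + length u)) (cfg guessSt (length u) t (interleave u y ++ [ b ]))
    inAsk   : ∀ {t} y b → length y ≡ length x → t (length x) ≡ bitSym b →
      Inv (1 + (length x + length x)) (cfg askSt (length x) t (code x y b))
    inHit   : ∀ {t q} y b → length y ≡ length x → t (length x) ≡ bitSym b → D (code x y b) →
      Inv (2 + (length x + length x)) (cfg hitSt (length x) t q)
    inMiss  : ∀ {h t q} → Inv (2 + (length x + length x)) (cfg missSt h t q)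
    inEnd   : ∀ {h t q} y b → length y ≡ length x → D (code x y b) →
      Inv (3 + (length x + length x)) (cfg (endOf b) h t q)

  holds-rewrite : ∀ h t v {a} → t h ≡ a → HoldsAt h t v → HoldsAt h (writeTape h a t) v
  holds-rewrite h t v e H i = trans (upd-same {f = t} h e (h + i)) (H i)

  holds-next : ∀ h t v {a} b → t h ≡ a → HoldsAt h t (b ∷ v) → HoldsAt (suc h) (writeTape h a t) v
  holds-next h t v b e H i = trans (upd-same {f = t} h e (suc h + i))
    (trans (cong t (sym (+-suc h i))) (H (suc i)))

  at-head : ∀ {h} t v → HoldsAt h t v → t h ≡ inputTape v 0
  at-head {h} t v H = trans (cong t (sym (+-identityʳ h))) (H 0)

  written : ∀ h (a : Sym 0) t → writeTape h a t h ≡ a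
  written h a t rewrite ≡ᵇ-true {h} refl = refl

  length-∷ʳ : ∀ (u : Word) b → length (u ++ [ b ]) ≡ suc (length u)
  length-∷ʳ u b = trans (length-++ u) (+-comm (length u) 1)

  inScan′ : ∀ {n h t q} u v y → n ≡ length u + length u → h ≡ length u → q ≡ interleave u y →
    x ≡ u ++ v → length y ≡ length u → HoldsAt h t v → Inv n (cfg scanSt h t q)
  inScan′ u v y refl refl refl = inScan u v y

  snoc-scan : ∀ {t} u b v y c → x ≡ u ++ b ∷ v → length y ≡ length u → HoldsAt (suc (length u)) t v →
    Inv (suc (suc (length u + length u))) (cfg scanSt (suc (length u)) t ((interleave u y ++ [ b ]) ++ [ c ]))
  snoc-scan u b v y c ex ey = inScan′ (u ++ [ b ]) v (y ++ [ c ])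
    (trans (cong suc (sym (+-suc (length u) (length u)))) (sym (cong₂ _+_ (length-∷ʳ u b) (length-∷ʳ u b))))
    (sym (length-∷ʳ u b)) (interleave-∷ʳ u y b c ey) (trans ex (sym (++-assoc u [ b ] v)))
    (trans (length-∷ʳ y c) (trans (cong suc ey) (sym (length-∷ʳ u b))))

  inv-step : ∀ {n c c′} → Inv n c → Step decoder D c c′ → Inv (suc n) c′
  inv-step (inScan {t} u [] y ex ey H) (work-step _ mem) with t (length u) | at-head t [] H | mem
  ... | .zero | refl | here refl rewrite trans (sym (++-identityʳ u)) (sym ex) =
      inAsk y true ey (written (length x) (bitSym true) t)
  ... | .zero | refl | there (here refl) rewrite trans (sym (++-identityʳ u)) (sym ex) =
      inAsk y false ey (written (length x) (bitSym false) t)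
  inv-step (inScan {t} u (false ∷ v) y ex ey H) (work-step _ mem) with t (length u) in e | at-head t (false ∷ v) H | mem
  ... | .(suc zero) | refl | here refl = inGuess u false v y ex ey (holds-rewrite (length u) t (false ∷ v) e H)
  inv-step (inScan {t} u (true ∷ v) y ex ey H) (work-step _ mem) with t (length u) in e | at-head t (true ∷ v) H | mem
  ... | .(suc (suc zero)) | refl | here refl = inGuess u true v y ex ey (holds-rewrite (length u) t (true ∷ v) e H)
  inv-step (inGuess {t} u b v y ex ey H) (work-step _ (here refl)) =
    snoc-scan u b v y true ex ey (holds-next (length u) t v b refl H)
  inv-step (inGuess {t} u b v y ex ey H) (work-step _ (there (here refl))) =
    snoc-scan u b v y false ex ey (holds-next (length u) t v b refl H)
  inv-step (inAsk y b ey e) (query-yes _ d) = inHit y b ey e d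
  inv-step (inAsk y b ey e) (query-no _ _)  = inMiss
  inv-step (inHit {t} y true ey e d) (work-step _ mem) with t (length x) | e | mem
  ... | _ | refl | here refl = inEnd y true ey d
  inv-step (inHit {t} y false ey e d) (work-step _ mem) with t (length x) | e | mem
  ... | _ | refl | here refl = inEnd y false ey d
  inv-step (inEnd y true ey d) (work-step () _)
  inv-step (inEnd y true ey d) (query-yes () _)
  inv-step (inEnd y true ey d) (query-no () _)
  inv-step (inEnd y false ey d) (work-step () _)
  inv-step (inEnd y false ey d) (query-yes () _)
  inv-step (inEnd y false ey d) (query-no () _)

  reach-inv : ∀ {n c} → Reach decoder D x n c → Inv n c
  reach-inv here          = inScan [] x [] refl refl (λ _ → refl)
  reach-inv (next rc st) = inv-step (reach-inv rc) st

  inv-time : ∀ {n c} → Inv n c → n ≤ 3 + (length x + length x)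
  inv-time (inScan u v y ex _ _) = ≤-trans (+-mono-≤ le le) (m≤n+m _ 3)
    where
    le : length u ≤ length x
    le rewrite ex | length-++ u {v} = m≤m+n _ _
  inv-time (inGuess u b v y ex _ _) = s≤s (≤-trans (+-mono-≤ le le) (m≤n+m _ 2))
    where
    le : length u ≤ length x
    le rewrite ex | length-++ u {b ∷ v} = m≤m+n _ _
  inv-time (inAsk _ _ _ _)   = s≤s (m≤n+m _ 2)
  inv-time (inHit _ _ _ _ _) = s≤s (s≤s (m≤n+m _ 1))
  inv-time inMiss            = s≤s (s≤s (m≤n+m _ 1))
  inv-time (inEnd _ _ _ _)   = ≤-refl

  value : Outcome → Bool → Set
  value acc b = b ≡ true
  value rej b = b ≡ false
  value unk b = ⊥

  decoder-sound : ∀ {o} → o ≢ unk → Out decoder D x o → ∃ λ y → ∃ λ b → length y ≡ length x × D (code x y b) × value o b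
  decoder-sound o≢ (n , c , rc , ko) with reach-inv rc
  ... | inScan _ _ _ _ _ _    = case ko of λ ()
  ... | inGuess _ _ _ _ _ _ _ = case ko of λ ()
  ... | inAsk _ _ _ _         = case ko of λ ()
  ... | inHit _ _ _ _ _       = case ko of λ ()
  decoder-sound o≢ (n , c , rc , refl) | inMiss = ⊥-elim (o≢ refl)
  decoder-sound o≢ (n , c , rc , refl) | inEnd y true ey d  = y , true , ey , d , refl
  decoder-sound o≢ (n , c , rc , refl) | inEnd y false ey d = y , false , ey , d , refl

  Asks : Word → Bool → Set
  Asks q b = ∃ λ n → ∃ λ h → ∃ λ t → Reach decoder D x n (cfg askSt h t q) × t h ≡ bitSym b

  ask : ∀ {n t} u v y w b → length y ≡ length u → length w ≡ length v → HoldsAt (length u) t v →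
    Reach decoder D x n (cfg scanSt (length u) t (interleave u y)) → Asks (code (u ++ v) (y ++ w) b) b
  ask {t = t} u [] y [] b ey ew H rc
    rewrite ++-identityʳ u | ++-identityʳ y = _ , _ , _ , next rc (work-step refl (mem b)) , written (length u) (bitSym b) t
    where
    mem : ∀ b → (askSt , bitSym b , stay , just b) ∈ toList (decoderδ scanSt (t (length u)))
    mem true  rewrite at-head t [] H = here refl
    mem false rewrite at-head t [] H = there (here refl)
  ask {n} {t} u (a ∷ v) y (c ∷ w) b ey ew H rc = subst (λ q → Asks q b)
      (cong₂ (λ p r → code p r b) (++-assoc u [ a ] v) (++-assoc y [ c ] w))
      (ask (u ++ [ a ]) v (y ++ [ c ]) w b
        (trans (length-∷ʳ y c) (trans (cong suc ey) (sym (length-∷ʳ u a)))) (suc-injective ew)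
        (subst (λ h → HoldsAt h t₂ v) (sym (length-∷ʳ u a)) H₂)
        (subst₂ (λ h q → Reach decoder D x (suc (suc n)) (cfg scanSt h t₂ q)) (sym (length-∷ʳ u a)) (interleave-∷ʳ u y a c ey) rc₂))
    where
    h = length u
    t₁ = writeTape h (t h) t
    t₂ = writeTape h (t₁ h) t₁
    mem₁ : ∀ a → t h ≡ bitSym a → (guessSt , t h , stay , just a) ∈ toList (decoderδ scanSt (t h))
    mem₁ true  e rewrite e = here refl
    mem₁ false e rewrite e = here refl
    rc₁ : Reach decoder D x _ (cfg guessSt h t₁ (interleave u y ++ [ a ]))
    rc₁ = next rc (work-step refl (mem₁ a (at-head t (a ∷ v) H)))
    H₁ : HoldsAt h t₁ (a ∷ v)
    H₁ = holds-rewrite h t (a ∷ v) refl H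
    mem₂ : ∀ c → (scanSt , t₁ h , right , just c) ∈ toList (decoderδ guessSt (t₁ h))
    mem₂ true  = here refl
    mem₂ false = there (here refl)
    rc₂ : Reach decoder D x _ (cfg scanSt (suc h) t₂ ((interleave u y ++ [ a ]) ++ [ c ]))
    rc₂ = next rc₁ (work-step refl (mem₂ c))
    H₂ : HoldsAt (suc h) t₂ v
    H₂ = holds-next h t₁ v a refl H₁

  decoder-complete : ∀ y b → length y ≡ length x → D (code x y b) → Out decoder D x (if b then acc else rej)
  decoder-complete y b ey d with ask [] x [] y b refl ey (λ _ → refl) here
  ... | n , h , t , rc , th = _ , _ , next (next rc (query-yes refl d)) (work-step refl (mem b th)) , end b
    where
    mem : ∀ b → t h ≡ bitSym b → (endOf b , t h , stay , nothing) ∈ toList (decoderδ hitSt (t h))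
    mem true  e rewrite e = here refl
    mem false e rewrite e = here refl
    end : ∀ b → decoderKind (endOf b) ≡ halt (if b then acc else rej)
    end true  = refl
    end false = refl

decoderNPTM : NPTM
decoderNPTM = record { machine = decoder ; poly = 3 , 1 , λ D x n c rc → ≤-trans (Decoder.inv-time D x (Decoder.reach-inv D x rc)) (lin (length x)) }
  where
  lin : ∀ n → 3 + (n + n) ≤ 3 * n ^ 1 + 3
  lin n rewrite ^-identityʳ n = ≤-trans (+-monoʳ-≤ 3 (+-monoʳ-≤ n (m≤m+n n 0)))
    (≤-trans (≤-reflexive (+-comm 3 _)) (+-monoˡ-≤ 3 (+-monoʳ-≤ n (+-monoʳ-≤ n z≤n))))

Coded : (Word → Bool) → (ℕ → Word) → Lang
Coded χ y q = ∃ λ x → q ≡ code x (y (length x)) (χ x)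

Decides : (Word → Bool) → Lang → Set
Decides χ A = ∀ x → (χ x ≡ true → A x) × (χ x ≡ false → ¬ A x)

-- For each x a single guess, the true pad with the true value, meets a word of the oracle; all
-- other guesses end in ?. So some path answers and none answers wrongly.
coded-≤SN : ∀ {A χ y} → Decides χ A → (∀ m → length (y m) ≡ m) → A ≤SN Coded χ y
coded-≤SN {A} {χ} {y} dec len = decoderNPTM , over , under , λ x → mk⇔ (to′ x) (from′ x)
  where
  open Decoder (Coded χ y)
  decoded : ∀ x y′ b → length y′ ≡ length x → Coded χ y (code x y′ b) → b ≡ χ x
  decoded x y′ b e (x′ , eq) with code-injective x x′ y′ (y (length x′)) b (χ x′) e (len (length x′)) eq
  ... | refl , _ , eb = eb
  answer : ∀ x → Out decoder (Coded χ y) x (if χ x then acc else rej)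
  answer x = decoder-complete x (y (length x)) (χ x) (len (length x)) (x , refl)
  over : Overproductive decoderNPTM (Coded χ y)
  over x with χ x | answer x
  ... | true  | o = inj₁ o
  ... | false | o = inj₂ o
  under : Underproductive decoderNPTM (Coded χ y)
  under x (a , r) with decoder-sound x (λ ()) a | decoder-sound x (λ ()) r
  ... | y₁ , b₁ , e₁ , c₁ , v₁ | y₂ , b₂ , e₂ , c₂ , v₂ =
    case trans (sym (trans (sym (decoded x y₁ b₁ e₁ c₁)) v₁)) (trans (sym (decoded x y₂ b₂ e₂ c₂)) v₂) of λ ()
  to′ : ∀ x → A x → Lof decoderNPTM (Coded χ y) x
  to′ x ax with χ x in e | answer x
  ... | true  | o = o
  ... | false | o = ⊥-elim (proj₂ (dec x) e ax)
  from′ : ∀ x → Lof decoderNPTM (Coded χ y) x → A x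
  from′ x a with decoder-sound x (λ ()) a
  ... | y₁ , b₁ , e₁ , c₁ , v₁ = proj₁ (dec x) (trans (sym (decoded x y₁ b₁ e₁ c₁)) v₁)

-- Enumeration of machines

finite-≟ : ∀ {A} → Finite A → (a b : A) → Dec (a ≡ b)
finite-≟ F a b with to F a Fin.≟ to F b
... | yes e = yes (trans (sym (from∘to F a)) (trans (cong (from F) e) (from∘to F b)))
... | no ¬e = no (λ e → ¬e (cong (to F) e))

finite-Kind : Finite Kind
finite-Kind = finite-retract (finite-⊎ finite-Bool finite-Outcome)
  (λ { work → inj₁ true ; query → inj₁ false ; (halt o) → inj₂ o })
  (λ { (inj₁ true) → work ; (inj₁ false) → query ; (inj₂ o) → halt o })
  (λ { work → refl ; query → refl ; (halt _) → refl })

finite-Move : Finite Move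
finite-Move = finite-retract (finite-Maybe finite-Bool)
  (λ { stay → nothing ; left → just true ; right → just false })
  (λ { nothing → stay ; (just true) → left ; (just false) → right })
  (λ { stay → refl ; left → refl ; right → refl })

Countable : Set → Set
Countable A = Σ (ℕ → Maybe A) λ f → ∀ a → ∃ λ n → f n ≡ just a

unpair : ℕ → ℕ × ℕ
unpair zero    = 0 , 0
unpair (suc n) = nxt (unpair n)
  where
  nxt : ℕ × ℕ → ℕ × ℕ
  nxt (a , zero)  = zero , suc a
  nxt (a , suc b) = suc a , b

-- `unpair` walks along the antidiagonals a + b = s with a increasing. The recursion goes back along
-- the current one, then to the end of the preceding one.
unpair-surjective : ∀ a b → ∃ λ n → unpair n ≡ (a , b)
unpair-surjective a b = hit (a + b) a b refl
  where
  hit : ∀ s a b → a + b ≡ s → ∃ λ n → unpair n ≡ (a , b)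
  hit s       (suc a) b       e with hit s a (suc b) (trans (+-suc a b) e)
  ... | n , eq = suc n , lem eq
    where
    lem : unpair n ≡ (a , suc b) → unpair (suc n) ≡ (suc a , b)
    lem eq rewrite eq = refl
  hit zero    zero    zero    e = 0 , refl
  hit (suc s) zero    (suc b) e with hit s b zero (trans (+-identityʳ b) (suc-injective e))
  ... | n , eq = suc n , lem eq
    where
    lem : unpair n ≡ (b , zero) → unpair (suc n) ≡ (zero , suc b)
    lem eq rewrite eq = refl

countable-Σ : ∀ {A : Set} {B : A → Set} → Countable A → (∀ a → Countable (B a)) → Countable (Σ A B)
countable-Σ {A} {B} (f , f-onto) g = enum , onto
  where
  pick : ℕ → Maybe A → Maybe (Σ A B)
  pick j nothing  = nothing
  pick j (just a) = Maybe.map (a ,_) (proj₁ (g a) j)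
  enum : ℕ → Maybe (Σ A B)
  enum n = pick (proj₂ (unpair n)) (f (proj₁ (unpair n)))
  onto : ∀ p → ∃ λ n → enum n ≡ just p
  onto (a , b) with f-onto a | proj₂ (g a) b
  ... | i , fi | j , gj with unpair-surjective i j
  ... | n , eq = n , lem
    where
    lem : enum n ≡ just (a , b)
    lem rewrite eq | fi | gj = refl

countable-retract : ∀ {A B : Set} → Countable A → (f : B → A) (g : A → B) → (∀ b → g (f b) ≡ b) → Countable B
countable-retract (e , onto) f g gf = (λ n → Maybe.map g (e n)) , λ b → let n , en = onto (f b) in
  n , trans (cong (Maybe.map g) en) (cong just (gf b))

countable-ℕ : Countable ℕ
countable-ℕ = just , λ n → n , refl

countable-finite : ∀ {A} → Finite A → Countable A
countable-finite {A} F = enum , λ a → Fin.toℕ (to F a) , onto a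
  where
  enum : ℕ → Maybe A
  enum n with n <? size F
  ... | yes n< = just (from F (Fin.fromℕ< n<))
  ... | no  _  = nothing
  onto : ∀ a → enum (Fin.toℕ (to F a)) ≡ just a
  onto a with Fin.toℕ (to F a) <? size F
  ... | yes n< = cong just (trans (cong (from F) (Fin.fromℕ<-toℕ (to F a) n<)) (from∘to F a))
  ... | no  n≮ = ⊥-elim (n≮ (Fin.toℕ<n (to F a)))

countable-Vec : ∀ {A} → Countable A → ∀ n → Countable (Vec A n)
countable-Vec C zero    = countable-retract countable-ℕ (λ _ → 0) (λ _ → []) (λ { [] → refl })
countable-Vec C (suc n) = countable-retract (countable-Σ C (λ _ → countable-Vec C n))
  (λ { (a ∷ v) → a , v }) (λ { (a , v) → a ∷ v }) (λ { (_ ∷ _) → refl })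

countable-List⁺ : ∀ {A} → Countable A → Countable (List⁺ A)
countable-List⁺ C = countable-retract (countable-Σ C (λ _ → countable-Σ countable-ℕ (countable-Vec C)))
  (λ { (a ∷ l) → a , length l , Vec.fromList l }) (λ { (a , _ , v) → a ∷ Vec.toList v })
  (λ { (a ∷ l) → cong (a ∷_) (toList∘fromList l) })

Transition : ℕ → ℕ → Set
Transition nS nΓ = Fin nS × Sym nΓ × Move × Maybe Bool

-- First-order data for a machine: `kind` and `δ` become vectors, because an enumeration cannot hit
-- functions up to `≡`.
Table : Set
Table = Σ ℕ λ nS → Σ ℕ λ nΓ → Vec Kind nS × (Fin nS × Fin nS × Fin nS) × Vec (Vec (List⁺ (Transition nS nΓ)) (3 + nΓ)) nS

countable-Table : Countable Table
countable-Table = countable-Σ countable-ℕ λ nS → countable-Σ countable-ℕ λ nΓ →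
  countable-Σ (countable-finite (finite-Vec finite-Kind nS)) λ _ →
  countable-Σ (countable-finite (finite-× (finite-Fin nS) (finite-× (finite-Fin nS) (finite-Fin nS)))) λ _ →
  countable-Vec (countable-Vec (countable-List⁺ (countable-finite
    (finite-× (finite-Fin nS) (finite-× (finite-Fin (3 + nΓ)) (finite-× finite-Move (finite-Maybe finite-Bool)))))) (3 + nΓ)) nS

tableMachine : Table → NOTM
tableMachine (nS , nΓ , kinds , (start , yesS , noS) , rows) = record
  { nS = nS ; nΓ = nΓ ; kind = lookup kinds ; start = start ; yesS = yesS ; noS = noS
  ; δ = λ s a → lookup (lookup rows s) a }

table : NOTM → Table
table M = nS , nΓ , tabulate kind , (start , yesS , noS) , tabulate (λ s → tabulate (δ s))
  where open NOTM M

-- The tabulated machine differs from M only up to pointwise equality of kind and δ.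
record _≗ᴹ_ (M M′ : NOTM) : Set₁ where
  field
    conv  : Config M → Config M′
    kinds : ∀ c → NOTM.kind M′ (Config.state (conv c)) ≡ NOTM.kind M (Config.state c)
    reach : ∀ {D x n c} → Reach M D x n c → Reach M′ D x n (conv c)

open _≗ᴹ_ public

out-≗ : ∀ {M M′ D x o} → M ≗ᴹ M′ → Out M D x o → Out M′ D x o
out-≗ E (n , c , rc , ko) = n , conv E c , reach E rc , trans (kinds E c) ko

module _ {nS nΓ : ℕ} {start yesS noS : Fin nS} {kind₁ kind₂ : Fin nS → Kind}
         {δ₁ δ₂ : Fin nS → Sym nΓ → List⁺ (Transition nS nΓ)} where

  private
    M₁ = record { nS = nS ; nΓ = nΓ ; kind = kind₁ ; start = start ; yesS = yesS ; noS = noS ; δ = δ₁ }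
    M₂ = record { nS = nS ; nΓ = nΓ ; kind = kind₂ ; start = start ; yesS = yesS ; noS = noS ; δ = δ₂ }

  pointwise-≗ : (∀ s → kind₁ s ≡ kind₂ s) → (∀ s a → δ₁ s a ≡ δ₂ s a) → M₁ ≗ᴹ M₂
  pointwise-≗ ek eδ = record { conv = conv′ ; kinds = λ c → sym (ek (Config.state c)) ; reach = reach′ }
    where
    conv′ : Config M₁ → Config M₂
    conv′ (cfg s h t q) = cfg s h t q
    step′ : ∀ {D c c′} → Step M₁ D c c′ → Step M₂ D (conv′ c) (conv′ c′)
    step′ (work-step {s} {h} {t} kw mem) = work-step (trans (sym (ek s)) kw) (subst (λ l → _ ∈ toList l) (eδ s (t h)) mem)
    step′ (query-yes {s} kq d) = query-yes (trans (sym (ek s)) kq) d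
    step′ (query-no {s} kq d)  = query-no (trans (sym (ek s)) kq) d
    reach′ : ∀ {D x n c} → Reach M₁ D x n c → Reach M₂ D x n (conv′ c)
    reach′ here         = here
    reach′ (next rc st) = next (reach′ rc) (step′ st)

table-kind : ∀ M s → lookup (tabulate (NOTM.kind M)) s ≡ NOTM.kind M s
table-kind M s = lookup∘tabulate (NOTM.kind M) s

table-δ : ∀ M s a → lookup (lookup (tabulate (λ s → tabulate (NOTM.δ M s))) s) a ≡ NOTM.δ M s a
table-δ M s a = trans (cong (λ v → lookup v a) (lookup∘tabulate (λ s → tabulate (NOTM.δ M s)) s)) (lookup∘tabulate (NOTM.δ M s) a)

tabulated-≗ : ∀ M → tableMachine (table M) ≗ᴹ M
tabulated-≗ M = pointwise-≗ (table-kind M) (table-δ M)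

≗-tabulated : ∀ M → M ≗ᴹ tableMachine (table M)
≗-tabulated M = pointwise-≗ (λ s → sym (table-kind M s)) (λ s a → sym (table-δ M s a))

-- Exploring the computation paths on one input

answer : Bool → Outcome
answer true  = acc
answer false = rej

-- What a reduction with clock `P` has to fulfil on the single input x when `b` is the value of A
-- there. Only one oracle is mentioned, so a stage can test it.
record Good (M : NOTM) (D : Lang) (x : Word) (b : Bool) (P : ℕ) : Set where
  field
    fast         : ∀ {n c} → Reach M D x n c → n ≤ P
    found-answer : Out M D x (answer b)
    exact        : ¬ Out M D x (answer (not b))

module Explore (M : NOTM) (D : Lang) (D? : Decidable D) (x : Word) where
  open NOTM M

  -- A configuration together with the words queried on the way to it.
  Trace : Set
  Trace = Config M × List Word

  onAnswer : ∀ {q} → Dec (D q) → ℕ → (ℕ → Sym nΓ) → Config M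
  onAnswer (yes _) h t = cfg yesS h t []
  onAnswer (no _)  h t = cfg noS h t []

  move : ℕ → (ℕ → Sym nΓ) → Word → Transition nS nΓ → Config M
  move h t q (s , a , m , w) = cfg s (moveHead m h) (writeTape h a t) (appendQ q w)

  succsAt : Kind → Config M → List Trace
  succsAt work     (cfg s h t q) = map (λ e → move h t q e , []) (toList (δ s (t h)))
  succsAt query    (cfg s h t q) = (onAnswer (D? q) h t , [ q ]) ∷ []
  succsAt (halt _) c             = []

  succs : Trace → List Trace
  succs (c , qs) = map (λ { (c′ , qs′) → c′ , qs′ ++ qs }) (succsAt (kind (Config.state c)) c)

  layer : ℕ → List Trace
  layer zero    = (initCfg M x , []) ∷ []
  layer (suc n) = concatMap succs (layer n)

  succs-complete : ∀ {c c′} → Step M D c c′ → ∃ λ qs → (c′ , qs) ∈ succsAt (kind (Config.state c)) c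
  succs-complete (work-step {h = h} {t} {q} kw mem) rewrite kw = [] , ∈-map⁺ (λ e → move h t q e , []) mem
  succs-complete (query-yes {q = q} kq d) rewrite kq with D? q
  ... | yes _ = [ q ] , here refl
  ... | no ¬d = ⊥-elim (¬d d)
  succs-complete (query-no {q = q} kq ¬d) rewrite kq with D? q
  ... | yes d = ⊥-elim (¬d d)
  ... | no _  = [ q ] , here refl

  layer-complete : ∀ {n c} → Reach M D x n c → ∃ λ qs → (c , qs) ∈ layer n
  layer-complete here = [] , here refl
  layer-complete (next {n} rc st) with layer-complete rc | succs-complete st
  ... | qs , mem | qs′ , mem′ = qs′ ++ qs , ∈-concatMap⁺ succs (lose mem (∈-map⁺ _ mem′))

  Agree : List Word → Lang → Set
  Agree qs D′ = ∀ {q} → q ∈ qs → (D q → D′ q) × (¬ D q → ¬ D′ q)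

  succs-sound : ∀ {c c′ qs D′} → (c′ , qs) ∈ succsAt (kind (Config.state c)) c → length qs ≤ 1 × (Agree qs D′ → Step M D′ c c′)
  succs-sound {c} mem with kind (Config.state c) in eq
  succs-sound {cfg s h t q} mem | work with ∈-map⁻ (λ e → move h t q e , []) {xs = toList (δ s (t h))} mem
  ... | e , mem′ , refl = z≤n , λ _ → work-step eq mem′
  succs-sound {cfg s h t q} (here refl) | query with D? q
  ... | yes d = s≤s z≤n , λ ag → query-yes eq (proj₁ (ag (here refl)) d)
  ... | no ¬d = s≤s z≤n , λ ag → query-no eq (proj₂ (ag (here refl)) ¬d)

  -- The use principle: a path consults the oracle only on its recorded queries, at most one per
  -- step, so it persists under every oracle that agrees on them.
  layer-sound : ∀ {n c qs D′} → (c , qs) ∈ layer n → length qs ≤ n × (Agree qs D′ → Reach M D′ x n c)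
  layer-sound {zero} (here refl) = z≤n , λ _ → here
  layer-sound {suc n} {D′ = D′} mem with find (∈-concatMap⁻ succs {xs = layer n} mem)
  ... | (c₀ , qs₀) , mem₀ , mem₁ with ∈-map⁻ _ mem₁
  ... | (c′ , qs′) , mem₂ , refl with layer-sound {D′ = D′} mem₀ | succs-sound {c₀} {D′ = D′} mem₂
  ... | len₀ , reach₀ | len′ , step′ =
    ≤-trans (≤-reflexive (length-++ qs′)) (+-mono-≤ len′ len₀) ,
    λ ag → next (reach₀ (λ m → ag (∈-++⁺ʳ qs′ m))) (step′ (λ m → ag (∈-++⁺ˡ m)))

  prefix : ∀ {n c m} → m ≤ n → Reach M D x n c → ∃ λ c′ → Reach M D x m c′
  prefix {n} {c} m≤n rc with m≤n⇒m<n∨m≡n m≤n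
  prefix m≤n rc | inj₂ refl = _ , rc
  prefix m≤n (next rc st) | inj₁ m<n = prefix (s≤s⁻¹ m<n) rc

  Halts : Outcome → Trace → Set
  Halts o (c , _) = kind (Config.state c) ≡ halt o

  haltsWithin? : ∀ o P → (∃ λ n → n ≤ P × ∃ λ e → e ∈ layer n × Halts o e) ⊎ (∀ n → n ≤ P → ∀ e → e ∈ layer n → ¬ Halts o e)
  haltsWithin? o P with any? (λ e → finite-≟ finite-Kind (kind (Config.state (proj₁ e))) (halt o)) (layer P)
  ... | yes p = let e , mem , h = find p in inj₁ (P , ≤-refl , e , mem , h)
  haltsWithin? o zero | no ¬p = inj₂ λ { zero z≤n e mem h → ¬p (lose mem h) }
  haltsWithin? o (suc P) | no ¬p with haltsWithin? o P
  ... | inj₁ (n , le , r) = inj₁ (n , m≤n⇒m≤1+n le , r)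
  ... | inj₂ none = inj₂ λ n le e mem h → case m≤n⇒m<n∨m≡n le of λ
    { (inj₁ lt) → none n (s≤s⁻¹ lt) e mem h ; (inj₂ refl) → ¬p (lose mem h) }

  -- `slow` and `mute` refute a robust reduction with the oracle at hand, since its clock and
  -- overproductivity concern all oracles. A wrong value of A refutes it only in the final oracle;
  -- hence only `wrong` carries queries to be protected.
  data Event (b : Bool) (P : ℕ) : Set where
    slow  : ∀ {c} → Reach M D x (suc P) c → Event b P
    mute  : ¬ Out M D x acc → ¬ Out M D x rej → Event b P
    wrong : ∀ {n c qs} → n ≤ P → (c , qs) ∈ layer n → Halts (answer (not b)) (c , qs) → Event b P

  check : ∀ b P → Good M D x b P ⊎ Event b P
  check b P with layer (suc P) in eq
  -- Prefixes of paths are paths, so an empty layer `suc P` bounds all paths by `P`.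
  ... | (c , qs) ∷ l = inj₂ (slow (proj₂ (layer-sound {D′ = D} (subst ((c , qs) ∈_) (sym eq) (here refl))) (λ _ → id , id)))
  ... | [] with haltsWithin? (answer (not b)) P | haltsWithin? (answer b) P
  ... | inj₁ (n , le , (c , qs) , mem , h) | _ = inj₂ (wrong le mem h)
  ... | inj₂ none | r = decide r
    where
    fast′ : ∀ {n c} → Reach M D x n c → n ≤ P
    fast′ {n} rc with n ≤? P
    ... | yes le = le
    ... | no n≰ with layer-complete (proj₂ (prefix (≰⇒> n≰) rc))
    ... | _ , mem rewrite eq = case mem of λ ()
    absent : ∀ {o} → (∀ n → n ≤ P → ∀ e → e ∈ layer n → ¬ Halts o e) → ¬ Out M D x o
    absent none (n , c , rc , h) = none n (fast′ rc) _ (proj₂ (layer-complete rc)) h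
    ¬acc¬rej : ∀ b → ¬ Out M D x (answer b) → ¬ Out M D x (answer (not b)) → ¬ Out M D x acc × ¬ Out M D x rej
    ¬acc¬rej true  p q = p , q
    ¬acc¬rej false p q = q , p
    decide : _ → _
    decide (inj₁ (n , le , (c , qs) , mem , h)) = inj₁ (record
      { fast = fast′ ; found-answer = n , c , proj₂ (layer-sound {D′ = D} mem) (λ _ → id , id) , h ; exact = absent none })
    decide (inj₂ none′) = let p , q = ¬acc¬rej b (absent none′) (absent none) in inj₂ (mute p q)

-- Logarithms

lgWith : ℕ → ℕ → ℕ
lgWith zero    n       = 0
lgWith (suc f) zero    = 0
lgWith (suc f) (suc n) = suc (lgWith f ⌊ suc n /2⌋)

-- Number of halvings needed to reach 0.
lg : ℕ → ℕ
lg n = lgWith n n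

half-< : ∀ n → ⌊ suc n /2⌋ ≤ n
half-< n = s≤s⁻¹ (⌊n/2⌋<n n)

lgWith-fuel : ∀ f n → n ≤ f → lgWith f n ≡ lg n
lgWith-fuel f n n≤f = go f n n n≤f ≤-refl
  where
  go : ∀ f g n → n ≤ f → n ≤ g → lgWith f n ≡ lgWith g n
  go zero    zero    zero    p q = refl
  go zero    (suc g) zero    p q = refl
  go (suc f) zero    zero    p q = refl
  go (suc f) (suc g) zero    p q = refl
  go (suc f) (suc g) (suc n) (s≤s p) (s≤s q) = cong suc (go f g ⌊ suc n /2⌋ (≤-trans (half-< n) p) (≤-trans (half-< n) q))

lg-suc : ∀ n → lg (suc n) ≡ suc (lg ⌊ suc n /2⌋)
lg-suc n = cong suc (lgWith-fuel n ⌊ suc n /2⌋ (half-< n))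

double-half : ∀ n → ⌊ n /2⌋ + ⌊ n /2⌋ ≤ n × n ≤ suc (⌊ n /2⌋ + ⌊ n /2⌋)
double-half zero          = z≤n , z≤n
double-half (suc zero)    = z≤n , s≤s z≤n
double-half (suc (suc n)) with double-half n
... | p , q rewrite +-suc ⌊ n /2⌋ ⌊ n /2⌋ = s≤s (s≤s p) , s≤s (s≤s q)

<2^lg : ∀ n → n < 2 ^ lg n
<2^lg = <-rec _ λ
  { zero    _   → s≤s z≤n
  ; (suc n) rec → let open ≤-Reasoning ; h = ⌊ suc n /2⌋ in begin-strict
      suc n                       ≤⟨ proj₂ (double-half (suc n)) ⟩
      suc (h + h)                 <⟨ n<1+n _ ⟩
      2 + (h + h)                 ≡⟨ cong suc (sym (+-suc h h)) ⟩
      suc h + suc h               ≤⟨ +-mono-≤ (rec (⌊n/2⌋<n n)) (rec (⌊n/2⌋<n n)) ⟩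
      2 ^ lg h + 2 ^ lg h         ≡⟨ cong (2 ^ lg h +_) (sym (+-identityʳ _)) ⟩
      2 ^ suc (lg h)              ≡⟨ cong (2 ^_) (sym (lg-suc n)) ⟩
      2 ^ lg (suc n)              ∎ }

2^lg≤ : ∀ n → 2 ^ lg (suc n) ≤ suc n + suc n
2^lg≤ = <-rec _ λ
  { zero _ → s≤s (s≤s z≤n)
  ; (suc n) rec → let open ≤-Reasoning ; h = ⌊ n /2⌋ in begin
      2 ^ lg (suc (suc n))                    ≡⟨ cong (2 ^_) (lg-suc (suc n)) ⟩
      2 * 2 ^ lg (suc h)                      ≤⟨ *-monoʳ-≤ 2 (rec (s≤s (⌊n/2⌋≤n n))) ⟩
      2 * (suc h + suc h)                     ≡⟨ dist h ⟩
      (2 + (h + h)) + (2 + (h + h))           ≤⟨ +-mono-≤ (+-monoʳ-≤ 2 (proj₁ (double-half n))) (+-monoʳ-≤ 2 (proj₁ (double-half n))) ⟩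
      suc (suc n) + suc (suc n)               ∎ }
  where
  dist : ∀ h → 2 * (suc h + suc h) ≡ (2 + (h + h)) + (2 + (h + h))
  dist = solve-∀

-- Construction of the pads

zeros : ℕ → Word
zeros m = replicate m false

-- Defined on all words, so each queried word forbids a single pad, whether it is a code or not.
-- Fewer than 2 ^ m forbidden words therefore leave a pad of length m free.
padOf : Word → Word
padOf (_ ∷ c ∷ q) = c ∷ padOf q
padOf _           = []

padOf-code : ∀ x y b → length y ≡ length x → padOf (code x y b) ≡ y
padOf-code []      []      b e = refl
padOf-code (a ∷ x) (c ∷ y) b e = cong (c ∷_) (padOf-code x y b (suc-injective e))

_≟ʷ_ : (u v : Word) → Dec (u ≡ v)
_≟ʷ_ = ≡-dec _≟ᵇ_

tailsOf : Bool → List Word → List Word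
tailsOf b []            = []
tailsOf b ([] ∷ L)      = tailsOf b L
tailsOf b ((a ∷ w) ∷ L) = if does (a ≟ᵇ b) then w ∷ tailsOf b L else tailsOf b L

tailsOf-∈ : ∀ {b w} L → (b ∷ w) ∈ L → w ∈ tailsOf b L
tailsOf-∈ {b} ((a ∷ w) ∷ L) (here refl) rewrite dec-true (b ≟ᵇ b) refl = here refl
tailsOf-∈ ([] ∷ L)      (there m) = tailsOf-∈ L m
tailsOf-∈ {b} ((a ∷ w) ∷ L) (there m) with does (a ≟ᵇ b)
... | true  = there (tailsOf-∈ L m)
... | false = tailsOf-∈ L m

tailsOf-length : ∀ L → length (tailsOf true L) + length (tailsOf false L) ≤ length L
tailsOf-length []                = z≤n
tailsOf-length ([] ∷ L)          = m≤n⇒m≤1+n (tailsOf-length L)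
tailsOf-length ((true ∷ w) ∷ L)  = s≤s (tailsOf-length L)
tailsOf-length ((false ∷ w) ∷ L) = ≤-trans (≤-reflexive (+-suc _ _)) (s≤s (tailsOf-length L))

-- A computed pigeonhole principle: each letter leads to a half in which the list does not have
-- enough words to fill all 2 ^ m places. Both halves cannot be full.
fresh : List Word → ℕ → Word
fresh L zero    = []
fresh L (suc m) with length (tailsOf true L) <? 2 ^ m
... | yes _ = true ∷ fresh (tailsOf true L) m
... | no  _ = false ∷ fresh (tailsOf false L) m

fresh-length : ∀ L m → length (fresh L m) ≡ m
fresh-length L zero    = refl
fresh-length L (suc m) with length (tailsOf true L) <? 2 ^ m
... | yes _ = cong suc (fresh-length (tailsOf true L) m)
... | no  _ = cong suc (fresh-length (tailsOf false L) m)

fresh-∉ : ∀ L m → length L < 2 ^ m → fresh L m ∉ L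
fresh-∉ []      zero    lt ()
fresh-∉ (_ ∷ L) zero    (s≤s ()) _
fresh-∉ L       (suc m) lt mem with length (tailsOf true L) <? 2 ^ m
... | yes lt′ = fresh-∉ (tailsOf true L) m lt′ (tailsOf-∈ L mem)
... | no  ge  = fresh-∉ (tailsOf false L) m (+-cancelˡ-< (2 ^ m) _ _ (begin-strict
      2 ^ m + length (tailsOf false L)                      ≤⟨ +-monoˡ-≤ _ (≮⇒≥ ge) ⟩
      length (tailsOf true L) + length (tailsOf false L)    ≤⟨ tailsOf-length L ⟩
      length L                                              <⟨ lt ⟩
      2 ^ m + (2 ^ m + 0)                                   ≡⟨ cong (2 ^ m +_) (+-identityʳ _) ⟩
      2 ^ m + 2 ^ m                                         ∎)) (tailsOf-∈ L mem)
  where open ≤-Reasoning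

_∈ʷ?_ : (w : Word) (L : List Word) → Dec (w ∈ L)
w ∈ʷ? L = any? (w ≟ʷ_) L

-- Preferring 0^m makes the pads predictable as soon as no further words get forbidden.
pick : List Word → ℕ → Word
pick L m with zeros m ∈ʷ? map padOf L
... | yes _ = fresh (map padOf L) m
... | no  _ = zeros m

pick-length : ∀ L m → length (pick L m) ≡ m
pick-length L m with zeros m ∈ʷ? map padOf L
... | yes _ = fresh-length (map padOf L) m
... | no  _ = length-replicate m

pick-∉ : ∀ L m → length L < 2 ^ m → pick L m ∉ map padOf L
pick-∉ L m lt with zeros m ∈ʷ? map padOf L
... | yes _  = fresh-∉ (map padOf L) m (≤-trans (s≤s (≤-reflexive (length-map padOf L))) lt)
... | no  ∉L = ∉L

words : ℕ → List Word
words zero    = [] ∷ []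
words (suc m) = map (true ∷_) (words m) ++ map (false ∷_) (words m)

words-complete : ∀ x → x ∈ words (length x)
words-complete []          = here refl
words-complete (true ∷ x)  = ∈-++⁺ˡ (∈-map⁺ (true ∷_) (words-complete x))
words-complete (false ∷ x) = ∈-++⁺ʳ _ (∈-map⁺ (false ∷_) (words-complete x))

wordsBelow : ℕ → List Word
wordsBelow zero    = []
wordsBelow (suc m) = words m ++ wordsBelow m

wordsBelow-complete : ∀ {m} x → length x < m → x ∈ wordsBelow m
wordsBelow-complete {suc m} x (s≤s le) with m≤n⇒m<n∨m≡n le
... | inj₁ lt   = ∈-++⁺ʳ (words m) (wordsBelow-complete x lt)
... | inj₂ refl = ∈-++⁺ˡ (words-complete x)

CodedBelow : (Word → Bool) → (ℕ → Word) → ℕ → Lang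
CodedBelow χ y m q = ∃ λ x → length x < m × q ≡ code x (y (length x)) (χ x)

codedBelow? : ∀ χ y m → Decidable (CodedBelow χ y m)
codedBelow? χ y m q with any? (λ x → length x <? m ×-dec (q ≟ʷ code x (y (length x)) (χ x))) (wordsBelow m)
... | yes p = let x , _ , h = find p in yes (x , h)
... | no ¬p = no λ { (x , lt , e) → ¬p (lose (wordsBelow-complete x lt) (lt , e)) }

-- A machine with time bound c n^k + c makes at most 2 ^ (K lg n) queries on
-- nonempty inputs, so these can be avoided by pads of length cutoff c k n.
degree : ℕ → ℕ → ℕ
degree c k = suc (c + k)

cutoff : ℕ → ℕ → ℕ → ℕ
cutoff c k n = suc (degree c k * lg n)

-- With L = 2 ^ lg n, which is at least n and at least 2, c n^k + c ≤ 2 c L^k ≤ 2^(c+1) L^k ≤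
-- L^(c+1+k); this is the origin of `degree`. The 1 added in `cutoff` pays for the factor 2.
poly≤2^cutoff : ∀ c k n → 1 ≤ n → 2 * (c * n ^ k + c) ≤ 2 ^ cutoff c k n
poly≤2^cutoff c k n 1≤n = *-monoʳ-≤ 2 (begin
    c * n ^ k + c                  ≤⟨ +-mono-≤ (*-monoʳ-≤ c (^-monoˡ-≤ k n≤L)) (≤-trans (≤-reflexive (sym (*-identityʳ c))) (*-monoʳ-≤ c (m^n>0 L k))) ⟩
    c * L ^ k + c * L ^ k          ≡⟨ lem c (L ^ k) ⟩
    (2 * c) * L ^ k                ≤⟨ *-monoˡ-≤ (L ^ k) (*-monoʳ-≤ 2 (<⇒≤ (n<2^n c))) ⟩
    2 ^ suc c * L ^ k              ≤⟨ *-monoˡ-≤ (L ^ k) (^-monoˡ-≤ (suc c) 2≤L) ⟩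
    L ^ suc c * L ^ k              ≡⟨ sym (^-distribˡ-+-* L (suc c) k) ⟩
    L ^ degree c k                 ≡⟨ ^-*-assoc 2 (lg n) (degree c k) ⟩
    2 ^ (lg n * degree c k)        ≡⟨ cong (2 ^_) (*-comm (lg n) (degree c k)) ⟩
    2 ^ (degree c k * lg n)        ∎)
  where
  open ≤-Reasoning
  L = 2 ^ lg n
  n≤L : n ≤ L
  n≤L = <⇒≤ (<2^lg n)
  2≤L : 2 ≤ L
  2≤L = ≤-trans (s≤s 1≤n) (<2^lg n)
  lem : ∀ a b → a * b + a * b ≡ (2 * a) * b
  lem = solve-∀
  instance
    L≢0 : NonZero L
    L≢0 = >-nonZero (m^n>0 2 (lg n))

lg≤cutoff : ∀ c k n → lg n ≤ cutoff c k n
lg≤cutoff c k n = m≤n⇒m≤1+n (m≤m+n (lg n) _)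

-- Requirements and stages

abstract
  countable-Job : Countable (Table × ℕ × ℕ)
  countable-Job = countable-Σ countable-Table λ _ → countable-Σ countable-ℕ λ _ → countable-ℕ

job : ℕ → Maybe (Table × ℕ × ℕ)
job = proj₁ countable-Job

module Stages (χ : Word → Bool) where

  -- `idx` is the requirement currently attended to, `forb` collects the queries of the wrong paths
  -- to be preserved, and `pads` holds the pads fixed so far.
  record State : Set where
    constructor state
    field
      idx  : ℕ
      forb : List Word
      pads : ℕ → Word
  open State public

  -- Nonempty inputs only: the bound 2 ^ m on the queries relies on |x| ≥ 1. Short inputs are left
  -- to the table of the simulator.
  Active : ℕ → ℕ → ℕ → Word → Set
  Active m c k x = 1 ≤ length x × cutoff c k (length x) ≡ m

  time : ℕ → ℕ → Word → ℕ
  time c k x = c * length x ^ k + c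

  module _ (m : ℕ) (σ : State) where

    Oracle : Lang
    Oracle = CodedBelow χ (pads σ) m

    oracle? : Decidable Oracle
    oracle? = codedBelow? χ (pads σ) m

    EventAt : NOTM → ℕ → ℕ → Word → Set
    EventAt M c k x = Explore.Event M Oracle oracle? x (χ x) (time c k x)

    data Verdict : Set where
      vacant : job (idx σ) ≡ nothing → Verdict
      quiet  : ∀ {T c k} → job (idx σ) ≡ just (T , c , k) →
        (∀ x → Active m c k x → Good (tableMachine T) Oracle x (χ x) (time c k x)) → Verdict
      event  : ∀ {T c k x} → job (idx σ) ≡ just (T , c , k) → Active m c k x → EventAt (tableMachine T) c k x → Verdict

    scan : ∀ M c k (xs : List Word) →
      (∀ x → x ∈ xs → Active m c k x → Good M Oracle x (χ x) (time c k x)) ⊎ (∃ λ x → Active m c k x × EventAt M c k x)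
    scan M c k []       = inj₁ λ _ ()
    scan M c k (x ∷ xs) with scan M c k xs
    ... | inj₂ e = inj₂ e
    ... | inj₁ g with (1 ≤? length x) ×-dec (cutoff c k (length x) ≟ m)
    ... | no ¬a = inj₁ λ { _ (here refl) a → ⊥-elim (¬a a) ; _ (there i) a → g _ i a }
    ... | yes a with Explore.check M Oracle oracle? x (χ x) (time c k x)
    ... | inj₂ e  = inj₂ (x , a , e)
    ... | inj₁ gx = inj₁ λ { _ (here refl) _ → gx ; _ (there i) a → g _ i a }

    -- lg |x| ≤ m for the inputs of stage m, so a stage has finitely many of them to examine.
    active-below : ∀ {c k} x → Active m c k x → length x < 2 ^ m
    active-below {c} {k} x (_ , refl) = ≤-trans (<2^lg (length x)) (^-monoʳ-≤ 2 (lg≤cutoff c k (length x)))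

    verdict : Verdict
    verdict with job (idx σ) in eq
    ... | nothing = vacant eq
    ... | just (T , c , k) with scan (tableMachine T) c k (wordsBelow (2 ^ m))
    ... | inj₁ g           = quiet eq λ x a → g x (wordsBelow-complete x (active-below {c} {k} x a)) a
    ... | inj₂ (x , a , e) = event eq a e

    newForb : Verdict → List Word
    newForb (event _ _ (Explore.wrong {qs = qs} _ _ _)) = qs ++ forb σ
    newForb _ = forb σ

    newIdx : Verdict → ℕ
    newIdx (quiet _ _) = idx σ
    newIdx _           = suc (idx σ)

    next-state : State
    next-state = state (newIdx verdict) (newForb verdict)
      -- The event was observed with an oracle that codes no word of length m, so the pad of length
      -- m must already avoid the newly forbidden words.
      (λ i → if i ≡ᵇ m then pick (newForb verdict) m else pads σ i)

    -- One half of 2 ^ m is reserved for the old forbidden words, the other for the queries of the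
    -- new path. As 2 ^ m doubles from stage to stage, all of them fill less than half at the next
    -- one.
    newForb-length : ∀ v → 2 * length (forb σ) < 2 ^ m → length (newForb v) < 2 ^ m
    newForb-length v lt = go v
      where
      open ≤-Reasoning
      old : length (forb σ) < 2 ^ m
      old = ≤-trans (s≤s (m≤m+n _ _)) lt
      go : ∀ v → length (newForb v) < 2 ^ m
      go (vacant _) = old
      go (quiet _ _) = old
      go (event _ _ (Explore.slow _)) = old
      go (event _ _ (Explore.mute _ _)) = old
      go (event {T} {c} {k} {x} _ (1≤ , cm) (Explore.wrong {n} {_} {qs} n≤ mem _)) = *-cancelˡ-< 2 _ _ (begin-strict
        2 * length (qs ++ forb σ)                  ≡⟨ cong (2 *_) (length-++ qs) ⟩
        2 * (length qs + length (forb σ))          ≡⟨ *-distribˡ-+ 2 (length qs) _ ⟩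
        2 * length qs + 2 * length (forb σ)        <⟨ +-mono-≤-< qs≤ lt ⟩
        2 ^ m + 2 ^ m                              ≡⟨ cong (2 ^ m +_) (sym (+-identityʳ _)) ⟩
        2 * 2 ^ m                                  ∎)
        where
        qs≤ : 2 * length qs ≤ 2 ^ m
        qs≤ = begin
          2 * length qs        ≤⟨ *-monoʳ-≤ 2 (≤-trans (proj₁ (Explore.layer-sound (tableMachine T) Oracle oracle? x {D′ = Oracle} mem)) n≤) ⟩
          2 * time c k x       ≤⟨ poly≤2^cutoff c k (length x) 1≤ ⟩
          2 ^ cutoff c k (length x) ≡⟨ cong (2 ^_) cm ⟩
          2 ^ m                ∎

  st : ℕ → State
  st zero    = state 0 [] (λ _ → [])
  st (suc m) = next-state m (st m)

  y : ℕ → Word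
  y m = pick (forb (st (suc m))) m

  y-length : ∀ m → length (y m) ≡ m
  y-length m = pick-length (forb (st (suc m))) m

  forb-length : ∀ m → 2 * length (forb (st m)) < 2 ^ m
  forb-length zero    = s≤s z≤n
  forb-length (suc m) = *-monoʳ-< 2 (newForb-length m (st m) (verdict m (st m)) (forb-length m))

  forb-suc : ∀ {q} m → q ∈ forb (st m) → q ∈ forb (st (suc m))
  forb-suc m mem with verdict m (st m)
  ... | vacant _ = mem
  ... | quiet _ _ = mem
  ... | event _ _ (Explore.slow _) = mem
  ... | event _ _ (Explore.mute _ _) = mem
  ... | event _ _ (Explore.wrong {qs = qs} _ _ _) = ∈-++⁺ʳ qs mem

  forb-mono : ∀ {q m m′} → m ≤ m′ → q ∈ forb (st m) → q ∈ forb (st m′)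
  forb-mono {m = m} {m′} le mem with m≤n⇒m<n∨m≡n le
  ... | inj₂ refl = mem
  forb-mono {m = m} {suc m′} le mem | inj₁ (s≤s lt) = forb-suc m′ (forb-mono lt mem)

  pads-y : ∀ {i m} → i < m → pads (st m) i ≡ y i
  pads-y {i} {suc m} lt with i ≡ᵇ m in eq
  ... | true rewrite ≡ᵇ⇒≡ i m (subst T (sym eq) tt) = refl
  ... | false = pads-y (≤∧≢⇒< (s≤s⁻¹ lt) λ { refl → case trans (sym eq) (≡ᵇ-true {i} refl) of λ () })

  y-∉ : ∀ m → y m ∉ map padOf (forb (st (suc m)))
  y-∉ m = pick-∉ (forb (st (suc m))) m (newForb-length m (st m) (verdict m (st m)) (forb-length m))

  B : Lang
  B = Coded χ y

  -- A word of B missing from the oracle of stage m codes some x with |x| ≥ m, and the pad of that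
  -- length was chosen to differ from `padOf` of every word forbidden by then.
  preserved : ∀ m {q} → q ∈ forb (st (suc m)) → (Oracle m (st m) q → B q) × (¬ Oracle m (st m) q → ¬ B q)
  preserved m {q} mem = (λ { (x , lt , e) → x , trans e (cong (λ p → code x p (χ x)) (pads-y lt)) }) , neg
    where
    neg : ¬ Oracle m (st m) q → ¬ B q
    neg ¬o (x , e) with length x <? m
    ... | yes lt = ¬o (x , lt , trans e (cong (λ p → code x p (χ x)) (sym (pads-y lt))))
    ... | no  ge = y-∉ (length x) (subst (_∈ map padOf (forb (st (suc (length x)))))
          (trans (cong padOf e) (padOf-code x (y (length x)) (χ x) (y-length (length x))))
          (∈-map⁺ padOf (forb-mono (s≤s (≮⇒≥ ge)) mem)))

-- With q = n / d one has n < (q + 1) d, hence (n + 1)^d ≤ d^d (2^q)^d ≤ d^d 2^n.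
^≤2^ : ∀ d n → suc n ^ suc d ≤ suc d ^ suc d * 2 ^ n
^≤2^ d n = begin
  suc n ^ e                          ≤⟨ ^-monoˡ-≤ e lt ⟩
  (e * suc q) ^ e                    ≡⟨ ^-distribʳ-* e (suc q) e ⟩
  e ^ e * suc q ^ e                  ≤⟨ *-monoʳ-≤ (e ^ e) (^-monoˡ-≤ e (n<2^n q)) ⟩
  e ^ e * (2 ^ q) ^ e                ≡⟨ cong (e ^ e *_) (^-*-assoc 2 q e) ⟩
  e ^ e * 2 ^ (q * e)                ≤⟨ *-monoʳ-≤ (e ^ e) (^-monoʳ-≤ 2 (m/n*n≤m n e)) ⟩
  e ^ e * 2 ^ n                      ∎
  where
  open ≤-Reasoning
  e = suc d
  q = n / e
  lt : suc n ≤ e * suc q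
  lt = begin
    suc n                ≡⟨ cong suc (m≡m%n+[m/n]*n n e) ⟩
    suc (n % e + q * e)  ≤⟨ +-monoˡ-≤ (q * e) (m%n<n n e) ⟩
    suc q * e            ≡⟨ *-comm (suc q) e ⟩
    e * suc q            ∎

≤lg : ∀ {a n} → 2 ^ a ≤ n → a ≤ lg n
≤lg {a} {n} le with a ≤? lg n
... | yes p = p
... | no ¬p = ⊥-elim (<⇒≱ (<2^lg n) (≤-trans (^-monoʳ-≤ 2 (<⇒≤ (≰⇒> ¬p))) le))

-- Let l = lg n. Then C · 2 (2 + K l)^e ≤ a (l + 1)^e ≤ (l + 1)^(e+1) ≤ C · 2^l ≤ C · 2 n: once l ≥
-- a, one spare factor l + 1 absorbs all constants.
polylog≤ : ∀ K e → ∃ λ n₀ → ∀ n → n₀ ≤ n → (2 + K * lg n) ^ e ≤ n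
polylog≤ K e = 2 ^ suc a , λ { zero le → ⊥-elim (<⇒≱ (m^n>0 2 (suc a)) le) ; (suc n) le → bound n (≤-trans (n≤1+n a) (≤lg le)) }
  where
  C = suc e ^ suc e
  s = 2 + K
  a = 2 * s ^ e * C
  open ≤-Reasoning
  instance
    C≢0 : NonZero C
    C≢0 = >-nonZero (m^n>0 (suc e) (suc e))
  spread : ∀ l → 2 + K * l ≤ s * suc l
  spread l = ≤-trans (m≤m+n _ (2 * l + K)) (≤-reflexive (lem K l))
    where
    lem : ∀ K l → 2 + K * l + (2 * l + K) ≡ (2 + K) * suc l
    lem = solve-∀
  rearrange : ∀ C p r → C * (2 * (p * r)) ≡ 2 * p * C * r
  rearrange = solve-∀
  bound : ∀ n → a ≤ lg (suc n) → (2 + K * lg (suc n)) ^ e ≤ suc n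
  bound n a≤ = *-cancelˡ-≤ 2 (≤-trans (*-cancelˡ-≤ C (begin
    C * (2 * (2 + K * l) ^ e)       ≤⟨ *-monoʳ-≤ C (*-monoʳ-≤ 2 (^-monoˡ-≤ e (spread l))) ⟩
    C * (2 * (s * suc l) ^ e)       ≡⟨ cong (λ v → C * (2 * v)) (^-distribʳ-* s (suc l) e) ⟩
    C * (2 * (s ^ e * suc l ^ e))   ≡⟨ rearrange C (s ^ e) (suc l ^ e) ⟩
    a * suc l ^ e                   ≤⟨ *-monoˡ-≤ (suc l ^ e) (m≤n⇒m≤1+n a≤) ⟩
    suc l ^ suc e                   ≤⟨ ^≤2^ e l ⟩
    C * 2 ^ l                       ∎)) (≤-trans (2^lg≤ n) (≤-reflexive (cong (suc n +_) (sym (+-identityʳ (suc n)))))))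
    where l = lg (suc n)

-- The recursive simulation

-- Words of at most n letters as a finite type, so that a program state can hold one and look it up
-- in a table.
BoundedWord : ℕ → Set
BoundedWord zero    = ⊤
BoundedWord (suc n) = Maybe (Bool × BoundedWord n)

finite-BoundedWord : ∀ n → Finite (BoundedWord n)
finite-BoundedWord zero    = finite-⊤
finite-BoundedWord (suc n) = finite-Maybe (finite-× finite-Bool (finite-BoundedWord n))

emptyBW : ∀ n → BoundedWord n
emptyBW zero    = tt
emptyBW (suc n) = nothing

toWord : ∀ n → BoundedWord n → Word
toWord zero    _              = []
toWord (suc n) nothing        = []
toWord (suc n) (just (b , w)) = b ∷ toWord n w

consBW : ∀ n → Bool → BoundedWord n → Maybe (BoundedWord n)
consBW zero    b w               = nothing
consBW (suc n) b nothing         = just (just (b , emptyBW n))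
consBW (suc n) b (just (b′ , w)) = Maybe.map (λ w → just (b , w)) (consBW n b′ w)

consM : ∀ {n} → Bool → Maybe (BoundedWord n) → Maybe (BoundedWord n)
consM b nothing  = nothing
consM b (just w) = consBW _ b w

-- A state remembers a word exactly while it fits; afterwards it only knows that the word was too
-- long.
data Shadows {n} : Maybe (BoundedWord n) → Word → Set where
  exactly : ∀ {w u} → toWord n w ≡ u → length u ≤ n → Shadows (just w) u
  overflow : ∀ {u} → n < length u → Shadows nothing u

shadows-empty : ∀ n → Shadows {n} (just (emptyBW n)) []
shadows-empty zero    = exactly refl z≤n
shadows-empty (suc n) = exactly refl z≤n

shadows-cons : ∀ {n sh u} b → Shadows {n} sh u → Shadows (consM b sh) (b ∷ u)
shadows-cons b (overflow lt) = overflow (m<n⇒m<1+n lt)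
shadows-cons {n} b (exactly {w} refl le) = go n b w
  where
  empty : ∀ n → toWord n (emptyBW n) ≡ []
  empty zero    = refl
  empty (suc n) = refl
  go : ∀ n b w → Shadows {n} (consBW n b w) (b ∷ toWord n w)
  go zero    b w       = overflow (s≤s z≤n)
  go (suc n) b nothing = exactly (cong (b ∷_) (empty n)) (s≤s z≤n)
  go (suc n) b (just (b′ , w)) with consBW n b′ w | go n b′ w
  ... | nothing | overflow lt    = overflow (s≤s lt)
  ... | just w′ | exactly e le   = exactly (cong (b ∷_) e) (s≤s le)

-- Recursive simulation of M on x: a query coding a word x′ with
-- n₀ ≤ |x′| ≤ K lg |x| and pad zero is answered after simulating M on x′, short
-- queries are answered by the table tab, all others negatively.
-- Stacks: 0 query tape of M (initially the input), 1 tape left of the head,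
-- 2 tape from the head on, 3 unary counter K lg |x|, 4 the part of it used up by
-- the query being decoded, 5 and 6 scratch.  Stacks 1-4 hold one segment per
-- level of the recursion, separated by frames; those on stack 1 carry the value
-- expected by the query.
module Simulator (M : NOTM) (K n₀ : ℕ) (χ tab : Word → Bool) (out : Bool → Outcome) where
  open NOTM M

  data Cell : Set where
    cell  : Sym nΓ → Cell
    bitq  : Bool → Cell
    one   : Cell
    frame : Bool → Cell

  -- A code of x′ has 2 |x′| + 1 letters, so it has at most S letters exactly when |x′| < n₀.
  S : ℕ
  S = n₀ + n₀

  -- The value expected by the query, a copy of the letters read while they are few, and whether the
  -- pad letters read so far are all zero.
  Query : Set
  Query = Bool × Maybe (BoundedWord S) × Bool

  -- `hs`, `h1`, `h2`, `hk` build the counter K lg |x| by halving |x| in unary; `run`, `bl`, `lf`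
  -- simulate M; `ld1`, `ld2`, `ld3` decode a query; `clrC`, `unQ`, `unU`, `unR`, `rst` clean up and
  -- resume M with the reply. The flag of the halving states tells which of stacks 5 and 6 is being
  -- halved, that of the cleaning states is the reply.
  data VSt : Set where
    init        : Maybe (BoundedWord n₀) → VSt
    hs h1 h2    : Bool → VSt
    hk          : Bool → Fin (suc K) → VSt
    run bl lf   : Fin nS → VSt
    ld1 ld2 ld3 : Query → VSt
    clrC unQ unU unR rst fin : Bool → VSt
    dead        : VSt

  abstract
    finite-Cell : Finite Cell
    finite-Cell = finite-retract (finite-⊎ (finite-⊎ (finite-Fin (3 + nΓ)) finite-Bool) (finite-Maybe finite-Bool))
      (λ { (cell a) → inj₁ (inj₁ a) ; (bitq b) → inj₁ (inj₂ b) ; one → inj₂ nothing ; (frame b) → inj₂ (just b) })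
      (λ { (inj₁ (inj₁ a)) → cell a ; (inj₁ (inj₂ b)) → bitq b ; (inj₂ nothing) → one ; (inj₂ (just b)) → frame b })
      (λ { (cell _) → refl ; (bitq _) → refl ; one → refl ; (frame _) → refl })

    finite-VSt : Finite VSt
    finite-VSt = finite-retract
      (finite-⊎ (finite-Maybe (finite-BoundedWord n₀))
        (finite-⊎ (finite-× (finite-Fin 9) finite-Bool)
          (finite-⊎ (finite-× finite-Bool (finite-Fin (suc K)))
            (finite-⊎ (finite-× (finite-Fin 3) (finite-Fin nS))
              (finite-Maybe (finite-× (finite-Fin 3)
                (finite-× finite-Bool (finite-× (finite-Maybe (finite-BoundedWord S)) finite-Bool))))))))
      enc dec dec∘enc
      where
      Code : Set
      Code = Maybe (BoundedWord n₀) ⊎ (Fin 9 × Bool) ⊎ (Bool × Fin (suc K)) ⊎ (Fin 3 × Fin nS) ⊎ Maybe (Fin 3 × Query)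
      flag : Fin 9 → Bool → Code
      flag i b = inj₂ (inj₁ (i , b))
      enc : VSt → Code
      enc (init w) = inj₁ w
      enc (hs b)   = flag Fin.0F b
      enc (h1 b)   = flag Fin.1F b
      enc (h2 b)   = flag Fin.2F b
      enc (clrC b) = flag Fin.3F b
      enc (unQ b)  = flag Fin.4F b
      enc (unU b)  = flag Fin.5F b
      enc (unR b)  = flag Fin.6F b
      enc (rst b)  = flag Fin.7F b
      enc (fin b)  = flag Fin.8F b
      enc (hk b i) = inj₂ (inj₂ (inj₁ (b , i)))
      enc (run s)  = inj₂ (inj₂ (inj₂ (inj₁ (Fin.0F , s))))
      enc (bl s)   = inj₂ (inj₂ (inj₂ (inj₁ (Fin.1F , s))))
      enc (lf s)   = inj₂ (inj₂ (inj₂ (inj₁ (Fin.2F , s))))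
      enc (ld1 v)  = inj₂ (inj₂ (inj₂ (inj₂ (just (Fin.0F , v)))))
      enc (ld2 v)  = inj₂ (inj₂ (inj₂ (inj₂ (just (Fin.1F , v)))))
      enc (ld3 v)  = inj₂ (inj₂ (inj₂ (inj₂ (just (Fin.2F , v)))))
      enc dead     = inj₂ (inj₂ (inj₂ (inj₂ nothing)))
      dec : Code → VSt
      dec (inj₁ w)                = init w
      dec (inj₂ (inj₁ (i , b)))   = lookup (hs b ∷ h1 b ∷ h2 b ∷ clrC b ∷ unQ b ∷ unU b ∷ unR b ∷ rst b ∷ fin b ∷ []) i
      dec (inj₂ (inj₂ (inj₁ (b , i)))) = hk b i
      dec (inj₂ (inj₂ (inj₂ (inj₁ (i , s))))) = lookup (run s ∷ bl s ∷ lf s ∷ []) i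
      dec (inj₂ (inj₂ (inj₂ (inj₂ (just (i , v)))))) = lookup (ld1 v ∷ ld2 v ∷ ld3 v ∷ []) i
      dec (inj₂ (inj₂ (inj₂ (inj₂ nothing)))) = dead
      dec∘enc : ∀ s → dec (enc s) ≡ s
      dec∘enc (init _) = refl
      dec∘enc (hs _)   = refl
      dec∘enc (h1 _)   = refl
      dec∘enc (h2 _)   = refl
      dec∘enc (hk _ _) = refl
      dec∘enc (run _)  = refl
      dec∘enc (bl _)   = refl
      dec∘enc (lf _)   = refl
      dec∘enc (ld1 _)  = refl
      dec∘enc (ld2 _)  = refl
      dec∘enc (ld3 _)  = refl
      dec∘enc (clrC _) = refl
      dec∘enc (unQ _)  = refl
      dec∘enc (unU _)  = refl
      dec∘enc (unR _)  = refl
      dec∘enc (rst _)  = refl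
      dec∘enc (fin _)  = refl
      dec∘enc dead     = refl

  Pushes : Set
  Pushes = Vec (Maybe Cell) 7

  none : Pushes
  none = Vec.replicate 7 nothing

  pattern Qs = zero
  pattern Ls = suc zero
  pattern Rs = suc (suc zero)
  pattern Cs = suc (suc (suc zero))
  pattern Es = suc (suc (suc (suc zero)))
  pattern Us = suc (suc (suc (suc (suc zero))))
  pattern Ws = suc (suc (suc (suc (suc (suc zero)))))

  counter : Bool → Fin 7
  counter true  = Us
  counter false = Ws

  on : Fin 7 → Cell → Pushes → Pushes
  on i a p = updateAt p i (λ _ → just a)

  Rule : Set
  Rule = List⁺ (VSt × Pushes)

  only : VSt → Pushes → Rule
  only s p = (s , p) ∷ []

  written? : Maybe Bool → Pushes → Pushes
  written? nothing  p = p
  written? (just b) p = on Qs (bitq b) p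

  apply : Fin nS × Sym nΓ × Move × Maybe Bool → VSt × Pushes
  apply (s , a , right , w) = run s , written? w (on Ls (cell a) none)
  apply (s , a , stay  , w) = run s , written? w (on Rs (cell a) none)
  apply (s , a , left  , w) = lf s  , written? w (on Rs (cell a) none)

  moves : Fin nS → Sym nΓ → Rule
  moves s a = List⁺.map apply (δ s a)

  sameBit : Bool → Bool → Bool
  sameBit true  b = b
  sameBit false b = not b

  runSrc : Kind → Fin 7
  runSrc work     = Rs
  runSrc query    = Qs
  runSrc (halt o) = Ls

  runRule : Kind → Fin nS → Maybe Cell → Rule
  finish : Fin nS → Bool → Maybe Cell → Rule

  runRule work s (just (cell a))   = moves s a
  runRule work s (just (frame b))  = only (bl s) (on Rs (frame b) none)
  runRule work s nothing           = only (bl s) none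
  -- The last letter written is on top, so the expected value is read first. The frames separate the
  -- word about to be decoded from the tape of the caller and from older counts.
  runRule query s (just (bitq b))  = only (ld1 (b , consM b (just (emptyBW S)) , true)) (on Rs (frame b) (on Es (frame b) none))
  runRule query s nothing          = only (run noS) none
  runRule (halt acc) s a           = finish s true a
  runRule (halt rej) s a           = finish s false a
  runRule _ s _                    = only dead none

  -- What lies below the left part of the tape reveals the level: a frame with the value the caller
  -- expects, or nothing for the outermost simulation.
  finish s v (just (cell _))  = only (run s) none
  finish s v (just (frame b)) = only (clrC (sameBit b v)) none
  finish s v nothing          = only (fin v) none
  finish s v _                = only dead none

  ruleV : VSt → Maybe Cell → Rule
  ruleV (init sh) (just (bitq b))            = only (init (consM b sh)) (on Rs (cell (bitSym b)) (on Us one none))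
  -- χ is consulted on words of at most n₀ letters only, that is, through a finite table.
  ruleV (init (just w)) nothing              = only (fin (χ (toWord n₀ w))) none
  ruleV (init nothing) nothing               = only (hs true) none
  ruleV (hs d) (just one)                    = only (hk d (fromℕ K)) none
  ruleV (hs d) nothing                       = only (run start) none
  ruleV (hk d (suc i)) _                     = only (hk d (inject₁ i)) (on Cs one none)
  ruleV (hk d zero) _                        = only (h2 d) none
  ruleV (h2 d) (just one)                    = only (h1 d) (on (counter (not d)) one none)
  ruleV (h2 d) nothing                       = only (hs (not d)) none
  ruleV (h1 d) (just one)                    = only (h2 d) none
  ruleV (h1 d) nothing                       = only (hs (not d)) none
  ruleV (run s) a                            = runRule (kind s) s a
  ruleV (bl s) _                             = moves s blank
  ruleV (lf s) (just a@(cell _))             = only (run s) (on Rs a none)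
  ruleV (lf s) (just a@(frame _))            = only (run s) (on Ls a none)
  ruleV (lf s) nothing                       = only (run s) none
  ruleV (ld1 (b , sh , ok)) (just (bitq p))  = only (ld2 (b , consM p sh , ok ∧ not p)) none
  ruleV (ld1 (b , just w , ok)) nothing      = only (unQ (tab (toWord S w))) none
  -- x′ now lies on stack 2 and its length in unary on stack 5, just as at the start of the
  -- outermost simulation; two more frames complete the separation from the caller.
  ruleV (ld1 (b , nothing , true)) nothing   = only (hs true) (on Ls (frame b) (on Cs (frame b) none))
  ruleV (ld1 (b , nothing , false)) nothing  = only (unQ false) none
  ruleV (ld2 (b , sh , ok)) (just (bitq z))  = only (ld3 (b , consM z sh , ok)) (on Rs (cell (bitSym z)) (on Us one none))
  ruleV (ld2 _) nothing                      = only (unQ false) none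
  ruleV (ld3 v) (just one)                   = only (ld1 v) (on Es one none)
  -- Each decoded letter is charged to the counter, so meeting its end means |x′| > K lg |x|, beyond
  -- the oracle used on x. The frame is put back.
  ruleV (ld3 _) (just a@(frame _))           = only (unQ false) (on Cs a none)
  ruleV (ld3 _) nothing                      = only (unQ false) none
  ruleV (clrC v) (just one)                  = only (clrC v) none
  ruleV (clrC v) (just (frame _))            = only (unQ v) none
  ruleV (unQ v) (just (bitq _))              = only (unQ v) none
  ruleV (unQ v) nothing                      = only (unU v) none
  ruleV (unU v) (just one)                   = only (unU v) none
  ruleV (unU v) nothing                      = only (unR v) none
  ruleV (unR v) (just (cell _))              = only (unR v) none
  ruleV (unR v) (just (frame _))             = only (rst v) none
  ruleV (rst v) (just one)                   = only (rst v) (on Cs one none)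
  ruleV (rst v) (just (frame _))             = only (run (if v then yesS else noS)) none
  ruleV _ _                                  = only dead none

  srcV : VSt → Fin 7
  srcV (init _) = Qs
  srcV (hs d)   = counter d
  srcV (h1 d)   = counter d
  srcV (h2 d)   = counter d
  -- A step always pops some stack; `hk` and `bl` name one that is empty at that moment.
  srcV (hk _ _) = Qs
  srcV (run s)  = runSrc (kind s)
  srcV (bl _)   = Us
  srcV (lf _)   = Ls
  srcV (ld1 _)  = Qs
  srcV (ld2 _)  = Qs
  srcV (ld3 _)  = Cs
  srcV (clrC _) = Cs
  srcV (unQ _)  = Qs
  srcV (unU _)  = Us
  srcV (unR _)  = Rs
  srcV (rst _)  = Es
  srcV (fin _)  = Qs
  srcV dead     = Qs

  runHalts : Kind → Maybe Outcome
  runHalts (halt unk) = just unk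
  runHalts _          = nothing

  haltsV : VSt → Maybe Outcome
  -- Of the halting states of M only ? ends the path, at whatever depth; the two answers first have
  -- their segment cleared.
  haltsV (run s) = runHalts (kind s)
  haltsV (fin v) = just (out v)
  haltsV dead    = just unk
  haltsV _       = nothing

  prog : Prog
  prog = record
    { St = VSt ; Γ = Cell ; k = 6 ; finSt = finite-VSt ; finΓ = finite-Cell
    ; start = init (just (emptyBW n₀)) ; src = srcV ; halts = haltsV ; rule = ruleV ; bit = bitq }

  open Run prog public

-- Following a program along all paths or along one

module Paths (P : Prog) where
  open Prog P
  open Run P

  after : Fin (suc k) → St × Vec (Maybe Γ) (suc k) → Vec (List Γ) (suc k) → PC
  after i (s , p) σ = s , zipWith push? p (updateAt σ i pop)

  -- Every path from c meets Q or dies within n steps.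
  data Must (Q : PC → Set) : ℕ → PC → Set where
    now  : ∀ {n c} → Q c → Must Q n c
    dies : ∀ {n s σ} → halts s ≡ just unk → Must Q n (s , σ)
    step : ∀ {n s σ i} → src s ≡ i → halts s ≡ nothing →
      (∀ e → e ∈ toList (rule s (head (lookup σ i))) → Must Q n (after i e σ)) → Must Q (suc n) (s , σ)

  data May (Q : PC → Set) : PC → Set where
    now  : ∀ {c} → Q c → May Q c
    step : ∀ {s σ i e} → src s ≡ i → halts s ≡ nothing →
      e ∈ toList (rule s (head (lookup σ i))) → May Q (after i e σ) → May Q (s , σ)

  data Det : ℕ → PC → PC → Set where
    stop : ∀ {n c} → Det n c c
    step : ∀ {n s σ i e c} → src s ≡ i → halts s ≡ nothing →
      rule s (head (lookup σ i)) ≡ e ∷ [] → Det n (after i e σ) c → Det (suc n) (s , σ) c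

  det-weaken : ∀ {m n c c′} → m ≤ n → Det m c c′ → Det n c c′
  det-weaken le       stop             = stop
  det-weaken (s≤s le) (step a b e d) = step a b e (det-weaken le d)

  det-trans : ∀ {m n c c′ c″} → Det m c c′ → Det n c′ c″ → Det (m + n) c c″
  det-trans {m} {n} stop d′            = det-weaken (m≤n+m n m) d′
  det-trans (step a b e d) d′          = step a b e (det-trans d d′)

  must-weaken : ∀ {Q m n c} → m ≤ n → Must Q m c → Must Q n c
  must-weaken le       (now q)      = now q
  must-weaken le       (dies h)     = dies h
  must-weaken (s≤s le) (step a b f) = step a b λ e m → must-weaken le (f e m)

  must-bind : ∀ {Q R m n c} → Must R m c → (∀ {c} → R c → Must Q n c) → Must Q (m + n) c
  must-bind {m = m} {n} (now r) f = must-weaken (m≤n+m n m) (f r)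
  must-bind (dies h) f            = dies h
  must-bind (step a b g) f        = step a b λ e m → must-bind (g e m) f

  may-bind : ∀ {Q R c} → May R c → (∀ {c} → R c → May Q c) → May Q c
  may-bind (now r) f        = f r
  may-bind (step a b m p) f = step a b m (may-bind p f)

  det-must : ∀ {Q m n c c′} → Det m c c′ → Must Q n c′ → Must Q (m + n) c
  det-must {m = m} {n} stop q = must-weaken (m≤n+m n m) q
  det-must (step a b eq d) q = step a b λ e m → case subst (λ l → e ∈ toList l) eq m of λ { (here refl) → det-must d q }

  det-may : ∀ {Q n c c′} → Det n c c′ → May Q c′ → May Q c
  det-may stop q            = q
  det-may (step a b eq d) q = step a b (subst (λ l → _ ∈ toList l) (sym eq) (here refl)) (det-may d q)

  data Star : ℕ → PC → PC → Set where
    []  : ∀ {c} → Star 0 c c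
    _∷_ : ∀ {n c c′ c″} → c ⟶ c′ → Star n c′ c″ → Star (suc n) c c″

  star-snoc : ∀ {n c c′ c″} → Star n c c′ → c′ ⟶ c″ → Star (suc n) c c″
  star-snoc []       st = st ∷ []
  star-snoc (s ∷ p) st = s ∷ star-snoc p st

  run-star : ∀ {x n c} → Run x n c → Star n (initPC x) c
  run-star here        = []
  run-star (next r st) = star-snoc (run-star r) st

  Halted : Outcome → PC → Set
  Halted o (s , _) = halts s ≡ just o

  must-star : ∀ {o n c m c′} → Must (Halted o) n c → Star m c c′ → m ≤ n × (∀ {o′} → Halted o′ c′ → o′ ≡ o ⊎ o′ ≡ unk)
  must-star (now h) []  = z≤n , λ h′ → inj₁ (case trans (sym h′) h of λ { refl → refl })
  must-star (dies h) [] = z≤n , λ h′ → inj₂ (case trans (sym h′) h of λ { refl → refl })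
  must-star (step _ h _) [] = z≤n , λ h′ → case trans (sym h′) h of λ ()
  must-star (now h) (step h′ _ ∷ _)  = case trans (sym h) h′ of λ ()
  must-star (dies h) (step h′ _ ∷ _) = case trans (sym h) h′ of λ ()
  must-star (step refl _ f) (step _ mem ∷ p) with must-star (f _ mem) p
  ... | le , r = s≤s le , r

  may-run : ∀ {Q x n c} → Run x n c → May Q c → ∃ λ m → ∃ λ c′ → Run x m c′ × Q c′
  may-run r (now q)               = _ , _ , r , q
  may-run r (step refl h mem p) = may-run (next r (step h mem)) p

module _ (P : Prog) (T : ℕ → ℕ) (pbT : PolyBounded T) (χ : Word → Bool)
         (must : ∀ x → Paths.Must P (Paths.Halted P (answer (χ x))) (T (length x)) (Run.initPC P x))
         (may : ∀ x → Paths.May P (Paths.Halted P (answer (χ x))) (Run.initPC P x)) where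
  open Paths P
  open Run P

  private
    module C = Compiled P T pbT (λ x r c rn → proj₁ (must-star (must x) (run-star rn)))

  -- `must` bounds the time and excludes the wrong answer on every path, while `may` supplies an
  -- accepting path when one is due.
  prog-InNP : ∀ {A} → (∀ x → (χ x ≡ true → A x) × (χ x ≡ false → ¬ A x)) → InNP A
  prog-InNP {A} dec = C.nptm , λ x → mk⇔ (forth x) (back x)
    where
    forth : ∀ x → A x → Lof C.nptm emptyOracle x
    forth x a with χ x in e | may-run here (may x)
    ... | true  | n , c , rn , h = C.accepted (n , c , rn , h)
    ... | false | _ = ⊥-elim (proj₂ (dec x) e a)
    back : ∀ x → Lof C.nptm emptyOracle x → A x
    back x o with C.accepts {emptyOracle} {x} o
    ... | n , c , rn , h with χ x in e | proj₂ (must-star (must x) (run-star rn)) h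
    ... | true  | _         = proj₁ (dec x) e
    ... | false | inj₁ ()
    ... | false | inj₂ ()

double-injective : ∀ m n → m + m ≡ n + n → m ≡ n
double-injective zero    zero    e = refl
double-injective (suc m) (suc n) e = cong suc (double-injective m n
  (suc-injective (trans (sym (+-suc m m)) (trans (suc-injective e) (+-suc n n)))))

double≢suc-double : ∀ m n → m + m ≢ suc (n + n)
double≢suc-double (suc m) zero    e = case trans (sym (+-suc m m)) (suc-injective e) of λ ()
double≢suc-double (suc m) (suc n) e = double≢suc-double m n (suc-injective (trans (sym (+-suc m m)) (trans (suc-injective e) (cong suc (+-suc n n)))))

double-≤ : ∀ {m n} → m + m ≤ n + n → m ≤ n
double-≤ {m} {n} le with m ≤? n
... | yes p = p
... | no ¬p = ⊥-elim (<⇒≱ (+-mono-< (≰⇒> ¬p) (≰⇒> ¬p)) le)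

-- Loops of the simulator

module Segments (M : NOTM) (K n₀ : ℕ) (χ tab : Word → Bool) (out : Bool → Outcome) where
  open NOTM M
  open Simulator M K n₀ χ tab out
  open Paths prog

  ones : ℕ → List Cell → List Cell
  ones zero    c = c
  ones (suc n) c = one ∷ ones n c

  ones-one : ∀ n c → ones n (one ∷ c) ≡ one ∷ ones n c
  ones-one zero    c = refl
  ones-one (suc n) c = cong (one ∷_) (ones-one n c)

  ones-+ : ∀ m n c → ones m (ones n c) ≡ ones (m + n) c
  ones-+ zero    n c = refl
  ones-+ (suc m) n c = cong (one ∷_) (ones-+ m n c)

  cells : List (Sym nΓ) → List Cell → List Cell
  cells []       r = r
  cells (a ∷ as) r = cell a ∷ cells as r

  bits : Word → List Cell
  bits = map bitq

  -- The part of a stack below the current segment.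
  data Bottom : List Cell → Set where
    empty  : Bottom []
    framed : ∀ {b w} → Bottom (frame b ∷ w)

  module _ {l r c e : List Cell} where

    unQ-loop : ∀ v w {u} → Det (suc (length w))
      (unQ v , bits w ∷ l ∷ r ∷ c ∷ e ∷ u ∷ [] ∷ []) (unU v , [] ∷ l ∷ r ∷ c ∷ e ∷ u ∷ [] ∷ [])
    unQ-loop v []      = step refl refl refl stop
    unQ-loop v (b ∷ w) = step refl refl refl (unQ-loop v w)

    unU-loop : ∀ v n → Det (suc n)
      (unU v , [] ∷ l ∷ r ∷ c ∷ e ∷ ones n [] ∷ [] ∷ []) (unR v , [] ∷ l ∷ r ∷ c ∷ e ∷ [] ∷ [] ∷ [])
    unU-loop v zero    = step refl refl refl stop
    unU-loop v (suc n) = step refl refl refl (unU-loop v n)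

    unR-loop : ∀ v as {b} → Det (suc (length as))
      (unR v , [] ∷ l ∷ cells as (frame b ∷ r) ∷ c ∷ e ∷ [] ∷ [] ∷ []) (rst v , [] ∷ l ∷ r ∷ c ∷ e ∷ [] ∷ [] ∷ [])
    unR-loop v []       = step refl refl refl stop
    unR-loop v (a ∷ as) = step refl refl refl (unR-loop v as)

  rst-loop : ∀ v j {b l r c e} → Det (suc j)
    (rst v , [] ∷ l ∷ r ∷ c ∷ ones j (frame b ∷ e) ∷ [] ∷ [] ∷ [])
    (run (if v then yesS else noS) , [] ∷ l ∷ r ∷ ones j c ∷ e ∷ [] ∷ [] ∷ [])
  rst-loop v zero = step refl refl refl stop
  rst-loop v (suc j) {b} {l} {r} {c} {e} = step refl refl refl (subst
    (λ c′ → Det (suc j) (rst v , [] ∷ l ∷ r ∷ (one ∷ c) ∷ ones j (frame b ∷ e) ∷ [] ∷ [] ∷ [])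
      (run (if v then yesS else noS) , [] ∷ l ∷ r ∷ c′ ∷ e ∷ [] ∷ [] ∷ []))
    (ones-one j c) (rst-loop v j))

  undo : ∀ v w n as j {b b′ l r c e} → Det (suc (length w) + (suc n + (suc (length as) + suc j)))
    (unQ v , bits w ∷ l ∷ cells as (frame b ∷ r) ∷ c ∷ ones j (frame b′ ∷ e) ∷ ones n [] ∷ [] ∷ [])
    (run (if v then yesS else noS) , [] ∷ l ∷ r ∷ ones j c ∷ e ∷ [] ∷ [] ∷ [])
  undo v w n as j = det-trans (unQ-loop v w) (det-trans (unU-loop v n) (det-trans (unR-loop v as) (rst-loop v j)))

  clrC-loop : ∀ v n {b q l r c e} → Det (suc n)
    (clrC v , q ∷ l ∷ r ∷ ones n (frame b ∷ c) ∷ e ∷ [] ∷ [] ∷ []) (unQ v , q ∷ l ∷ r ∷ c ∷ e ∷ [] ∷ [] ∷ [])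
  clrC-loop v zero    = step refl refl refl stop
  clrC-loop v (suc n) = step refl refl refl (clrC-loop v n)

  halt-rule : ∀ v s a → runRule (halt (answer v)) s a ≡ finish s v a
  halt-rule true  s a = refl
  halt-rule false s a = refl

  halt-live : ∀ v → runHalts (halt (answer v)) ≡ nothing
  halt-live true  = refl
  halt-live false = refl

  module _ {s v} (ks : kind s ≡ halt (answer v)) where

    haltStep : ∀ {n σ x c} → finish s v (head (lookup σ Ls)) ≡ x ∷ [] → Det n (after Ls x σ) c → Det (suc n) (run s , σ) c
    haltStep {σ = σ} eq = step (cong runSrc ks) (trans (cong runHalts ks) (halt-live v))
      (trans (cong (λ κ → runRule κ s (head (lookup σ Ls))) ks) (trans (halt-rule v s (head (lookup σ Ls))) eq))

    clrL-loop : ∀ as {b q l r c e} → Det (suc (length as))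
      (run s , q ∷ cells as (frame b ∷ l) ∷ r ∷ c ∷ e ∷ [] ∷ [] ∷ []) (clrC (sameBit b v) , q ∷ l ∷ r ∷ c ∷ e ∷ [] ∷ [] ∷ [])
    clrL-loop []       = haltStep refl stop
    clrL-loop (a ∷ as) = haltStep refl (clrL-loop as)

    finish-loop : ∀ as {q r c e} → Det (suc (length as))
      (run s , q ∷ cells as [] ∷ r ∷ c ∷ e ∷ [] ∷ [] ∷ []) (fin v , q ∷ [] ∷ r ∷ c ∷ e ∷ [] ∷ [] ∷ [])
    finish-loop []       = haltStep refl stop
    finish-loop (a ∷ as) = haltStep refl (finish-loop as)

    return : ∀ w ls rs m j {b b₁ b₂ b₃ l r c e} →
      Det (suc (length ls) + (suc m + (suc (length w) + (1 + (suc (length rs) + suc j)))))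
        (run s , bits w ∷ cells ls (frame b ∷ l) ∷ cells rs (frame b₁ ∷ r) ∷ ones m (frame b₂ ∷ c) ∷ ones j (frame b₃ ∷ e) ∷ [] ∷ [] ∷ [])
        (run (if sameBit b v then yesS else noS) , [] ∷ l ∷ r ∷ ones j c ∷ e ∷ [] ∷ [] ∷ [])
    return w ls rs m j = det-trans (clrL-loop ls) (det-trans (clrC-loop _ m) (undo _ w 0 rs j))

  counting : Bool → List Cell → List Cell → List Cell → List Cell → List Cell → List Cell → Vec (List Cell) 7
  counting d l r c e a b = [] ∷ l ∷ r ∷ c ∷ e ∷ (if d then a else b) ∷ (if d then b else a) ∷ []

  halve-shift : ∀ d j i {n l r c e x} →
    Det n x (hs (not d) , counting (not d) l r c e (ones (⌊ suc j /2⌋ + suc i) []) []) →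
    Det n x (hs (not d) , counting (not d) l r c e (one ∷ ones (⌊ suc j /2⌋ + i) []) [])
  halve-shift d j i {n} {l} {r} {c} {e} {x} =
    subst (λ m → Det n x (hs (not d) , counting (not d) l r c e (ones m []) [])) (+-suc ⌊ suc j /2⌋ i)

  -- The step leaving `hs` has already consumed one of the `suc j` ones, so the `j` that remain
  -- still yield half of `suc j`.
  halve-loop : ∀ d j i {l r c e} → Det (suc j)
    (h2 d , counting d l r c e (ones j []) (ones i [])) (hs (not d) , counting (not d) l r c e (ones (⌊ suc j /2⌋ + i) []) [])
  halve-loop true  zero          i = step refl refl refl stop
  halve-loop false zero          i = step refl refl refl stop
  halve-loop true  (suc zero)    i = step refl refl refl (step refl refl refl stop)
  halve-loop false (suc zero)    i = step refl refl refl (step refl refl refl stop)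
  halve-loop true  (suc (suc j)) i = step refl refl refl (step refl refl refl (halve-shift true j i (halve-loop true j (suc i))))
  halve-loop false (suc (suc j)) i = step refl refl refl (step refl refl refl (halve-shift false j i (halve-loop false j (suc i))))

  mark-loop : ∀ d n i {l r c e a b} → Fin.toℕ i ≡ n → Det (suc n)
    (hk d i , counting d l r c e a b) (h2 d , counting d l r (ones n c) e a b)
  mark-loop d zero    zero    _ = step refl refl refl stop
  mark-loop d (suc n) (suc i) {l} {r} {c} {e} {a} {b} eq = step refl refl refl (subst
    (λ c′ → Det (suc n) (hk d (inject₁ i) , counting d l r (one ∷ c) e a b) (h2 d , counting d l r c′ e a b))
    (ones-one n c) (mark-loop d n (inject₁ i) (trans (Fin.toℕ-inject₁ i) (suc-injective eq))))

  halving-round : ∀ d n {l r c e} → Det (suc (suc K + suc n))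
    (hs d , counting d l r c e (ones (suc n) []) []) (hs (not d) , counting (not d) l r (ones K c) e (ones ⌊ suc n /2⌋ []) [])
  halving-round d n {l} {r} {c} {e} = subst
    (λ m → Det (suc (suc K + suc n)) (hs d , counting d l r c e (ones (suc n) []) []) (hs (not d) , counting (not d) l r (ones K c) e (ones m []) []))
    (+-identityʳ ⌊ suc n /2⌋) (first d)
    where
    first : ∀ d → Det (suc (suc K + suc n)) (hs d , counting d l r c e (ones (suc n) []) [])
      (hs (not d) , counting (not d) l r (ones K c) e (ones (⌊ suc n /2⌋ + 0) []) [])
    first true  = step refl refl refl (det-trans (mark-loop true K (fromℕ K) (Fin.toℕ-fromℕ K)) (halve-loop true n 0))
    first false = step refl refl refl (det-trans (mark-loop false K (fromℕ K) (Fin.toℕ-fromℕ K)) (halve-loop false n 0))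

  -- Every round adds K to the counter and there are lg n rounds. The time is bounded generously by
  -- n rounds of full length.
  halving : ∀ n d {l r c e} → Det (suc (n * (2 + K + n)))
    (hs d , counting d l r c e (ones n []) []) (run start , [] ∷ l ∷ r ∷ ones (K * lg n) c ∷ e ∷ [] ∷ [] ∷ [])
  halving n d = go n n d ≤-refl ≤-refl
    where
    go : ∀ B n d {l r c e N} → n ≤ B → n ≤ N → Det (suc (n * (2 + K + N)))
      (hs d , counting d l r c e (ones n []) []) (run start , [] ∷ l ∷ r ∷ ones (K * lg n) c ∷ e ∷ [] ∷ [] ∷ [])
    go B zero true  _ _ rewrite *-zeroʳ K = step refl refl refl stop
    go B zero false _ _ rewrite *-zeroʳ K = step refl refl refl stop
    go (suc B) (suc n) d {l} {r} {c} {e} {N} (s≤s n≤B) n≤N = subst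
      (λ c′ → Det (suc (suc n * (2 + K + N))) (hs d , counting d l r c e (ones (suc n) []) []) (run start , [] ∷ l ∷ r ∷ c′ ∷ e ∷ [] ∷ [] ∷ []))
      marks (det-weaken time (det-trans (halving-round d n)
        (go B ⌊ suc n /2⌋ (not d) (≤-trans (half-< n) n≤B) (≤-trans (half-< n) (≤-trans (n≤1+n n) n≤N)))))
      where
      open ≤-Reasoning hiding (start)
      time : suc (suc K + suc n) + suc (⌊ suc n /2⌋ * (2 + K + N)) ≤ suc (suc n * (2 + K + N))
      time = begin
        suc (suc K + suc n) + suc (⌊ suc n /2⌋ * (2 + K + N))   ≡⟨ +-suc (suc (suc K + suc n)) _ ⟩
        suc (suc (suc K + suc n) + ⌊ suc n /2⌋ * (2 + K + N))   ≤⟨ s≤s (+-mono-≤ (s≤s (s≤s (+-monoʳ-≤ K n≤N))) (*-monoˡ-≤ (2 + K + N) (half-< n))) ⟩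
        suc (2 + (K + N) + n * (2 + K + N))                     ∎
      marks : ones (K * lg ⌊ suc n /2⌋) (ones K c) ≡ ones (K * lg (suc n)) c
      marks = trans (ones-+ _ K c) (cong (λ m → ones m c) (trans (+-comm _ K)
        (trans (sym (*-suc K (lg ⌊ suc n /2⌋))) (cong (K *_) (sym (lg-suc n))))))

-- Decoding a query

module Queries (M : NOTM) (K n₀ : ℕ) (χ tab : Word → Bool) (out : Bool → Outcome) (y : ℕ → Word)
  (y-length : ∀ m → length (y m) ≡ m) (y-zeros : ∀ m → n₀ ≤ m → y m ≡ zeros m)
  (tab-spec : ∀ q → (tab q ≡ true → CodedBelow χ y (suc (n₀ + n₀)) q) × (tab q ≡ false → ¬ CodedBelow χ y (suc (n₀ + n₀)) q)) where
  open NOTM M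
  open Simulator M K n₀ χ tab out
  open Segments M K n₀ χ tab out
  open Paths prog

  Answers : ℕ → Word → Bool → Set
  Answers lim q v = (v ≡ true → CodedBelow χ y (suc lim) q) × (v ≡ false → ¬ CodedBelow χ y (suc lim) q)

  -- Either the reply is found at once and the caller's stacks are as before, or a recursive call is
  -- about to start with everything needed for the return below its frames.
  data QueryRun (lim t : ℕ) (q : Word) (l r c e : List Cell) (pc : PC) : Set where
    settled : ∀ v → Answers lim q v →
      Det t pc (run (if v then yesS else noS) , [] ∷ l ∷ r ∷ ones lim c ∷ e ∷ [] ∷ [] ∷ []) →
      QueryRun lim t q l r c e pc
    recurse : ∀ x b b′ j → n₀ ≤ length x → length x + j ≡ lim → q ≡ code x (y (length x)) b →
      Det t pc (hs true , [] ∷ (frame b ∷ l) ∷ cells (map bitSym x) (frame b′ ∷ r) ∷ (frame b ∷ ones j c) ∷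
                          ones (length x) (frame b′ ∷ e) ∷ ones (length x) [] ∷ [] ∷ []) →
      QueryRun lim t q l r c e pc

  queryRun-prefix : ∀ {lim m t q l r c e pc pc′} → Det m pc pc′ → QueryRun lim t q l r c e pc′ → QueryRun lim (m + t) q l r c e pc
  queryRun-prefix d (settled v a d′)           = settled v a (det-trans d d′)
  queryRun-prefix d (recurse x b b′ j p e f d′) = recurse x b b′ j p e f (det-trans d d′)

  queryRun-weaken : ∀ {lim m t q l r c e pc} → m ≤ t → QueryRun lim m q l r c e pc → QueryRun lim t q l r c e pc
  queryRun-weaken le (settled v a d′)           = settled v a (det-weaken le d′)
  queryRun-weaken le (recurse x b b′ j p e f d′) = recurse x b b′ j p e f (det-weaken le d′)

  settle : ∀ {lim q l r c e b b′} v w n as p j Q → Answers lim q v →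
    length w ≤ Q → n ≤ Q → length as ≤ Q → p ≤ Q → p + j ≡ lim →
    QueryRun lim (4 * Q + 4) q l r c e
      (unQ v , bits w ∷ l ∷ cells as (frame b ∷ r) ∷ ones j c ∷ ones p (frame b′ ∷ e) ∷ ones n [] ∷ [] ∷ [])
  settle {l = l} {r} {c} {e} {b} {b′} v w n as p j Q a w≤ n≤ as≤ p≤ refl = settled v a (subst
    (λ c′ → Det (4 * Q + 4) (unQ v , bits w ∷ l ∷ cells as (frame b ∷ r) ∷ ones j c ∷ ones p (frame b′ ∷ e) ∷ ones n [] ∷ [] ∷ [])
      (run (if v then yesS else noS) , [] ∷ l ∷ r ∷ c′ ∷ e ∷ [] ∷ [] ∷ []))
    (ones-+ p j c) (det-weaken time (undo v w n as p)))
    where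
    time : suc (length w) + (suc n + (suc (length as) + suc p)) ≤ 4 * Q + 4
    time = ≤-trans (+-mono-≤ (s≤s w≤) (+-mono-≤ (s≤s n≤) (+-mono-≤ (s≤s as≤) (s≤s p≤)))) (≤-reflexive (lem Q))
      where
      lem : ∀ Q → suc Q + (suc Q + (suc Q + suc Q)) ≡ 4 * Q + 4
      lem = solve-∀

  coded-length : ∀ {m q} → CodedBelow χ y m q → ∃ λ k → k < m × length q ≡ suc (k + k)
  coded-length (x , lt , refl) = length x , lt , length-code x (y (length x)) (χ x) (y-length (length x))

  no-answer : ∀ {lim q} → ¬ CodedBelow χ y (suc lim) q → Answers lim q false
  no-answer ¬d = (λ ()) , λ _ → ¬d

  Zeroness : Bool → Word → Set
  Zeroness ok ys = (ok ≡ true → ys ≡ zeros (length ys)) × (ok ≡ false → ys ≢ zeros (length ys))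

  zeroness-cons : ∀ {ok ys} c → Zeroness ok ys → Zeroness (ok ∧ not c) (c ∷ ys)
  zeroness-cons {true}  true  _       = (λ ()) , λ _ ()
  zeroness-cons {true}  false (p , q) = (λ _ → cong (false ∷_) (p refl)) , λ ()
  zeroness-cons {false} c     (p , q) = (λ ()) , λ _ e → q refl (proj₂ (∷-injective e))

  counter-empty : ∀ {v q l r c e u w} → Bottom c →
    Det 1 (ld3 v , q ∷ l ∷ r ∷ c ∷ e ∷ u ∷ w ∷ []) (unQ false , q ∷ l ∷ r ∷ c ∷ e ∷ u ∷ w ∷ [])
  counter-empty empty  = step refl refl refl stop
  counter-empty framed = step refl refl refl stop

  module Load {q : Word} {lim : ℕ} {l r c e : List Cell} (bot : Bottom c) (b b′ : Bool) where

    cost : ℕ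
    cost = 4 * length q + 6

    loaded : VSt → Word → Word → ℕ → ℕ → PC
    loaded s rest xs u j = s , bits rest ∷ l ∷ cells (map bitSym xs) (frame b′ ∷ r) ∷ ones j c ∷ ones (length xs) (frame b′ ∷ e) ∷ ones u [] ∷ [] ∷ []

    q-length : ∀ {rest xs ys} → length ys ≡ length xs → q ≡ reverse rest ++ code xs ys b →
      length q ≡ length rest + suc (length xs + length xs)
    q-length {rest} {xs} {ys} e refl = trans (length-++ (reverse rest)) (cong₂ _+_ (length-reverse rest) (length-code xs ys b e))

    slack : 1 + (4 * length q + 4) ≤ cost
    slack = ≤-trans (≤-reflexive (+-comm 1 _)) (≤-trans (≤-reflexive (+-assoc (4 * length q) 4 1)) (+-monoʳ-≤ (4 * length q) (m≤m+n 5 1)))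

    slack₂ : 2 + (4 * length q + 4) ≤ cost
    slack₂ = ≤-reflexive (trans (+-comm 2 _) (+-assoc (4 * length q) 4 2))

    -- A short `q` is looked up; its length fixes that of the coded word, so the limits of table and
    -- oracle can be exchanged (`shorter`). For a long `q` the valid pad is zero: with another pad
    -- it is no code, and with this one only the value of A at `xs` remains unknown.
    load-end : ∀ xs ys sh ok j → length ys ≡ length xs → length xs + j ≡ lim → Shadows {S} sh (code xs ys b) → Zeroness ok ys →
      q ≡ code xs ys b → QueryRun lim cost q l r c e (loaded (ld1 (b , sh , ok)) [] xs (length xs) j)
    load-end xs ys (just w) ok j el lj (exactly ew le) z eq = queryRun-weaken slack (queryRun-prefix
      (step {n = 0} refl refl refl stop)
      (settle (tab (toWord S w)) [] (length xs) (map bitSym xs) (length xs) j (length q) ans z≤n xs≤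
        (≤-trans (≤-reflexive (length-map bitSym xs)) xs≤) xs≤ lj))
      where
      lq : length q ≡ suc (length xs + length xs)
      lq = q-length {[]} {xs} el eq
      xs≤ : length xs ≤ length q
      xs≤ = ≤-trans (m≤m+n _ _) (≤-trans (n≤1+n _) (≤-reflexive (sym lq)))
      qw : toWord S w ≡ q
      qw = trans ew (sym eq)
      shorter : ∀ {a} → CodedBelow χ y a q → ∀ {m} → length xs < m → CodedBelow χ y m q
      shorter d@(x , lt , e′) {m} lm = x , subst (_< m) (sym same) lm , e′
        where
        same : length x ≡ length xs
        same = double-injective _ _ (suc-injective (trans (sym (length-code x (y (length x)) (χ x) (y-length (length x))))
          (trans (cong length (sym e′)) lq)))
      ans : Answers lim q (tab (toWord S w))
      ans rewrite qw =
        (λ t → shorter (proj₁ (tab-spec q) t) (s≤s (≤-trans (m≤m+n _ j) (≤-reflexive lj)))) ,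
        (λ f d → proj₂ (tab-spec q) f (shorter d (s≤s (≤-trans xs≤ (≤-trans (≤-reflexive (cong length eq)) le)))))
    load-end xs ys nothing true j el lj (overflow lt) z eq = recurse xs b b′ j big lj pad
      (det-weaken (≤-trans (s≤s z≤n) slack) (step {n = 0} refl refl refl stop))
      where
      big : n₀ ≤ length xs
      big = double-≤ (s≤s⁻¹ (≤-trans lt (≤-reflexive (length-code xs ys b el))))
      pad : q ≡ code xs (y (length xs)) b
      pad = trans eq (cong (λ p → code xs p b) (trans (proj₁ z refl) (trans (cong zeros el) (sym (y-zeros (length xs) big)))))
    load-end xs ys nothing false j el lj (overflow lt) z eq = queryRun-weaken slack (queryRun-prefix
      (step {n = 0} refl refl refl stop)
      (settle false [] (length xs) (map bitSym xs) (length xs) j (length q) (no-answer ¬d) z≤n xs≤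
        (≤-trans (≤-reflexive (length-map bitSym xs)) xs≤) xs≤ lj))
      where
      xs≤ : length xs ≤ length q
      xs≤ = ≤-trans (m≤m+n _ _) (≤-trans (n≤1+n _) (≤-reflexive (sym (q-length {[]} {xs} el eq))))
      big : n₀ ≤ length xs
      big = double-≤ (s≤s⁻¹ (≤-trans lt (≤-reflexive (length-code xs ys b el))))
      ¬d : ¬ CodedBelow χ y (suc lim) q
      ¬d (x , _ , e′) with code-injective xs x ys (y (length x)) b (χ x) el (y-length (length x)) (trans (sym eq) e′)
      ... | refl , ey , _ = proj₂ z refl (trans ey (trans (y-zeros (length xs) big) (cong zeros (sym el))))

    -- Letters come from the end in pairs of pad and word, which rebuilds `xs` with its first letter
    -- on top. A leftover single letter makes the length even, and an exhausted counter makes the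
    -- word too long; neither is a code in question.
    load : ∀ n rest xs ys sh ok j → length rest ≤ n → length ys ≡ length xs → length xs + j ≡ lim →
      Shadows {S} sh (code xs ys b) → Zeroness ok ys → q ≡ reverse rest ++ code xs ys b →
      QueryRun lim (3 * n + cost) q l r c e (loaded (ld1 (b , sh , ok)) rest xs (length xs) j)
    load n [] xs ys sh ok j le el lj s z eq = queryRun-weaken (m≤n+m cost (3 * n)) (load-end xs ys sh ok j el lj s z eq)
    load n (p ∷ []) xs ys sh ok j le el lj s z eq = queryRun-weaken (≤-trans slack₂ (m≤n+m cost (3 * n))) (queryRun-prefix
      (step {n = 1} refl refl refl (step refl refl refl stop))
      (settle false [] (length xs) (map bitSym xs) (length xs) j (length q) (no-answer ¬d) z≤n xs≤
        (≤-trans (≤-reflexive (length-map bitSym xs)) xs≤) xs≤ lj))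
      where
      lq : length q ≡ suc (suc (length xs + length xs))
      lq = q-length {p ∷ []} {xs} el eq
      xs≤ : length xs ≤ length q
      xs≤ = ≤-trans (m≤m+n _ _) (≤-trans (n≤1+n _) (≤-trans (n≤1+n _) (≤-reflexive (sym lq))))
      ¬d : ¬ CodedBelow χ y (suc lim) q
      ¬d d with coded-length d
      ... | k , _ , ek = double≢suc-double k (length xs) (suc-injective (trans (sym ek) lq))
    load (suc n) (p ∷ z′ ∷ rest) xs ys sh ok j le el lj s z eq = queryRun-weaken time (queryRun-prefix
        (step {n = 1} refl refl refl (step refl refl refl stop)) (counted j lj))
      where
      xs′ = z′ ∷ xs
      ys′ = p ∷ ys
      sh′ = consM z′ (consM p sh)
      ok′ = ok ∧ not p
      eq′ : q ≡ reverse rest ++ code xs′ ys′ b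
      eq′ = trans eq (trans (cong (_++ code xs ys b) (trans (unfold-reverse p (z′ ∷ rest)) (cong (_++ [ p ]) (unfold-reverse z′ rest))))
        (trans (++-assoc (reverse rest ++ [ z′ ]) [ p ] _) (++-assoc (reverse rest) [ z′ ] _)))
      lq : length q ≡ length rest + suc (suc (length xs) + suc (length xs))
      lq = q-length {rest} {xs′} (cong suc el) eq′
      time : 2 + (1 + (3 * n + cost)) ≤ 3 * suc n + cost
      time = ≤-reflexive (cong (_+ cost) (sym (*-suc 3 n)))
      xs≤ : suc (length xs) ≤ length q
      xs≤ = ≤-trans (m≤m+n _ _) (≤-trans (n≤1+n _) (≤-trans (m≤n+m _ (length rest)) (≤-reflexive (sym lq))))
      rest≤ : length rest ≤ length q
      rest≤ = ≤-trans (m≤m+n _ _) (≤-reflexive (sym lq))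
      mid : ℕ → PC
      mid j = ld3 (b , sh′ , ok′) , bits rest ∷ l ∷ cells (map bitSym xs′) (frame b′ ∷ r) ∷ ones j c ∷ ones (length xs) (frame b′ ∷ e) ∷ ones (length xs′) [] ∷ [] ∷ []
      too-long : length xs ≡ lim → ¬ CodedBelow χ y (suc lim) q
      too-long refl d with coded-length d
      ... | k , lt , ek = <⇒≱ lt (double-≤ (≤-trans (m≤n+m _ (length rest)) (≤-reflexive (suc-injective (trans (sym (+-suc (length rest) _)) (trans (sym lq) ek))))))
      counted : ∀ j → length xs + j ≡ lim → QueryRun lim (1 + (3 * n + cost)) q l r c e (mid j)
      counted zero lj = queryRun-weaken (s≤s (≤-trans (+-monoʳ-≤ (4 * length q) (m≤m+n 4 2)) (m≤n+m cost (3 * n))))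
        (queryRun-prefix (counter-empty bot) (settle false rest (length xs′) (map bitSym xs′) (length xs) 0 (length q)
          (no-answer (too-long (trans (sym (+-identityʳ _)) lj))) rest≤ xs≤
          (≤-trans (≤-reflexive (length-map bitSym xs′)) xs≤) (≤-trans (n≤1+n _) xs≤) lj))
      counted (suc j) lj = queryRun-prefix (step {n = 0} refl refl refl stop)
        (load n rest xs′ ys′ sh′ ok′ j (≤-trans (n≤1+n _) (s≤s⁻¹ le)) (cong suc el) (trans (sym (+-suc (length xs) j)) lj)
          (shadows-cons z′ (shadows-cons p s)) (zeroness-cons p z) eq′)

-- Cost of the recursion

lg≤ : ∀ n → lg n ≤ n
lg≤ n = go n n
  where
  go : ∀ f n → lgWith f n ≤ f
  go zero    n       = z≤n
  go (suc f) zero    = z≤n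
  go (suc f) (suc n) = s≤s (go f ⌊ suc n /2⌋)

pb-mono : ∀ {f g} → (∀ n → f n ≤ g n) → PolyBounded g → PolyBounded f
pb-mono le (e , p) = e , λ n → ≤-trans (le n) (p n)

-- Time bounds for the simulation on inputs of length n of a machine with time
-- bound a n^k + a: machine steps, resuming the caller, one machine step
-- (including the recursive simulation it may trigger), and all of it.
module Costs (a k K : ℕ) where
  machineTime returnTime stepTime simTime totalTime : ℕ → ℕ
  machineTime n = a * n ^ k + a
  returnTime n = 3 * machineTime n + (2 * n + (K * lg n + 6))
  stepTime n = 7 * machineTime n + (n + 10)
  simTime n = suc (n * (2 + K + n)) + suc (machineTime n) * stepTime n
  totalTime n = suc n + (simTime n + suc (machineTime n))

  abstract
    pb-machine : PolyBounded machineTime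
    pb-machine = pb-+ (pb-* (pb-const a) (pb-^ k)) (pb-const a)

    pb-sim : PolyBounded simTime
    pb-sim = pb-+ (pb-+ (pb-const 1) (pb-* pb-id (pb-+ (pb-const (2 + K)) pb-id)))
      (pb-* (pb-+ (pb-const 1) pb-machine) (pb-+ (pb-* (pb-const 7) pb-machine) (pb-+ pb-id (pb-const 10))))

    pb-total : PolyBounded totalTime
    pb-total = pb-+ (pb-+ (pb-const 1) pb-id) (pb-+ pb-sim (pb-+ (pb-const 1) pb-machine))

    pb-call : PolyBounded (λ n → simTime n + returnTime n)
    pb-call = pb-+ pb-sim (pb-+ (pb-* (pb-const 3) pb-machine) (pb-+ (pb-* (pb-const 2) pb-id)
      (pb-+ (pb-* (pb-const K) (pb-mono lg≤ pb-id)) (pb-const 6))))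

  id<simTime : ∀ n → n < simTime n
  id<simTime n = s≤s (≤-trans (m≤m*n n (2 + K + n)) (m≤m+n _ _))

  -- The cost of a call is polynomial in m, hence polylogarithmic in n. This closes the time
  -- recurrence: the summand n in `stepTime` pays for an entire recursive call.
  calls≤ : ∃ λ n₀ → ∀ n → n₀ ≤ n → ∀ m → m ≤ K * lg n → simTime m + returnTime m ≤ n
  calls≤ = proj₁ bound , λ n n₀≤ m m≤ →
    ≤-trans (proj₂ pb-call m) (≤-trans (^-monoˡ-≤ (proj₁ pb-call) (+-monoʳ-≤ 2 m≤)) (proj₂ bound n n₀≤))
    where bound = polylog≤ K (proj₁ pb-call)

-- Correctness of the recursive simulation

module Recursion (M : NOTM) (K a k n₀ : ℕ) (χ tab : Word → Bool) (out : Bool → Outcome) (y : ℕ → Word)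
  (y-length : ∀ m → length (y m) ≡ m) (y-zeros : ∀ m → n₀ ≤ m → y m ≡ zeros m)
  (tab-spec : ∀ q → (tab q ≡ true → CodedBelow χ y (suc (n₀ + n₀)) q) × (tab q ≡ false → ¬ CodedBelow χ y (suc (n₀ + n₀)) q))
  (call≤ : ∀ n → n₀ ≤ n → ∀ m → m ≤ K * lg n → Costs.simTime a k K m + Costs.returnTime a k K m ≤ n)
  (good : ∀ x → n₀ ≤ length x → Good M (CodedBelow χ y (suc (K * lg (length x)))) x (χ x) (Costs.machineTime a k K (length x)))
  where
  open NOTM M
  open Simulator M K n₀ χ tab out
  open Segments M K n₀ χ tab out
  open Queries M K n₀ χ tab out y y-length y-zeros tab-spec
  open Paths prog
  open Costs a k K

  below : (ℕ → Sym nΓ) → ℕ → List (Sym nΓ)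
  below t zero    = []
  below t (suc h) = t h ∷ below t h

  nth : List (Sym nΓ) → ℕ → Sym nΓ
  nth []       _       = blank
  nth (b ∷ bs) zero    = b
  nth (b ∷ bs) (suc j) = nth bs j

  below-length : ∀ t h → length (below t h) ≡ h
  below-length t zero    = refl
  below-length t (suc h) = cong suc (below-length t h)

  below-write : ∀ {t} {b : Sym nΓ} {g} h → h ≤ g → below (writeTape g b t) h ≡ below t h
  below-write zero    _  = refl
  below-write {t} {b} {g} (suc h) lt = cong₂ _∷_ (cong (λ v → if v then b else t h) (≡ᵇ-false (<⇒≢ lt))) (below-write h (<⇒≤ lt))

  write-here : ∀ (t : ℕ → Sym nΓ) h b → writeTape h b t h ≡ b
  write-here t h b = cong (λ v → if v then b else t h) (≡ᵇ-true {h} refl)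

  write-above : ∀ (t : ℕ → Sym nΓ) h b j → writeTape h b t (suc (h + j)) ≡ t (suc (h + j))
  write-above t h b j = cong (λ v → if v then b else t (suc (h + j))) (≡ᵇ-false (λ e → <⇒≢ (s≤s (m≤m+n h j)) (sym e)))

  nth-input : ∀ x j → inputTape x j ≡ nth (map bitSym x) j
  nth-input []      j       = refl
  nth-input (b ∷ x) zero    = refl
  nth-input (b ∷ x) (suc j) = nth-input x j

  record Context : Set where
    constructor context
    field
      {l r c e} : List Cell
      bot-l     : Bottom l
      bot-r     : Bottom r
      bot-c     : Bottom c

  module Level (x : Word) (F : Context) where
    open Context F

    n : ℕ
    n = length x

    D : Lang
    D = CodedBelow χ y (suc (K * lg n))

    stacks : Word → List (Sym nΓ) → List (Sym nΓ) → Vec (List Cell) 7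
    stacks qs ls rs = bits qs ∷ cells ls l ∷ cells rs r ∷ ones (K * lg n) c ∷ e ∷ [] ∷ [] ∷ []

    -- Contents of the stacks when M has reached a configuration after i steps.
    data At (i : ℕ) : Config M → Word → List (Sym nΓ) → List (Sym nΓ) → Set where
      represents : ∀ {s h t q qs ls rs} → qs ≡ reverse q → ls ≡ below t h → (∀ j → t (h + j) ≡ nth rs j) →
        length q ≤ i → h ≤ i → length rs ≤ n + i → At i (cfg s h t q) qs ls rs

    pcOf : Config M → Word → List (Sym nΓ) → List (Sym nΓ) → PC
    pcOf cf qs ls rs = run (Config.state cf) , stacks qs ls rs

    data Post : PC → Set where
      post : ∀ {i cf qs ls rs} → At i cf qs ls rs → i ≤ machineTime n →
        kind (Config.state cf) ≡ halt (answer (χ x)) → Post (pcOf cf qs ls rs)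

    entry : PC
    entry = hs true , [] ∷ l ∷ cells (map bitSym x) r ∷ c ∷ e ∷ ones n [] ∷ [] ∷ []

    started : Det (suc (n * (2 + K + n))) entry (run start , stacks [] [] (map bitSym x))
    started = halving n true

    at-start : At 0 (initCfg M x) [] [] (map bitSym x)
    at-start = represents refl refl (nth-input x) z≤n z≤n (≤-trans (≤-reflexive (length-map bitSym x)) (m≤m+n n 0))

    -- The scanned symbol is either on top of stack 2 or, at the end of the segment, a blank
    -- supplied by `bl`; from here on the two cases look alike.
    data Poised (s : Fin nS) (b : Sym nΓ) (σ′ : Vec (List Cell) 7) : PC → Set where
      poised : ∀ {s₁ σ} i → srcV s₁ ≡ i → haltsV s₁ ≡ nothing → ruleV s₁ (head (lookup σ i)) ≡ moves s b →
        updateAt σ i pop ≡ σ′ → Poised s b σ′ (s₁ , σ)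

    poise : ∀ {s qs ls} rs → kind s ≡ work → ∃ λ pc → Det 1 (run s , stacks qs ls rs) pc ×
      Poised s (nth rs 0) (stacks qs ls (pop rs)) pc
    poise {s} (b ∷ rs) ks = _ , stop , poised Rs (cong runSrc ks) (cong runHalts ks) (cong (λ κ → runRule κ s (just (cell b))) ks) refl
    poise {s} [] ks with r | bot-r
    ... | []          | empty  = _ , step (cong runSrc ks) (cong runHalts ks) (cong (λ κ → runRule κ s nothing) ks) stop ,
                                  poised Us refl refl refl refl
    ... | frame b ∷ _ | framed = _ , step (cong runSrc ks) (cong runHalts ks) (cong (λ κ → runRule κ s (just (frame b))) ks) stop ,
                                  poised Us refl refl refl refl

    appended : Maybe Bool → Word → Word
    appended nothing  qs = qs
    appended (just b) qs = b ∷ qs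

    appended-reverse : ∀ w q → appended w (reverse q) ≡ reverse (appendQ q w)
    appended-reverse nothing  q = refl
    appended-reverse (just b) q = sym (reverse-++ q [ b ])

    appendQ-length : ∀ w q → length (appendQ q w) ≤ suc (length q)
    appendQ-length nothing  q = n≤1+n _
    appendQ-length (just b) q = ≤-reflexive (trans (length-++ q) (+-comm (length q) 1))

    pop-length : ∀ (rs : List (Sym nΓ)) → length (pop rs) ≤ length rs
    pop-length []       = z≤n
    pop-length (_ ∷ rs) = n≤1+n _

    left-length : ∀ {i} (rs : List (Sym nΓ)) → 1 ≤ i → length rs ≤ n + i → 2 + length (pop rs) ≤ n + suc i
    left-length {i} []       1≤ le = ≤-trans (s≤s 1≤) (m≤n+m (suc i) n)
    left-length {i} (_ ∷ rs) 1≤ le = ≤-trans (s≤s le) (≤-reflexive (sym (+-suc n i)))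

    nth-pop : ∀ rs j → nth rs (suc j) ≡ nth (pop rs) j
    nth-pop []       j = refl
    nth-pop (_ ∷ rs) j = refl

    lf-bottom : ∀ s qs rs → Det 1 (lf s , stacks qs [] rs) (run s , stacks qs [] rs)
    lf-bottom s qs rs with l | bot-l
    ... | []          | empty  = step refl refl refl stop
    ... | frame _ ∷ _ | framed = step refl refl refl stop

    pushed : ∀ tr qs ls rs → Vec (List Cell) 7
    pushed tr qs ls rs = zipWith push? (proj₂ (apply tr)) (stacks qs ls rs)

    Landed : ℕ → Config M → PC → Set
    Landed i cf pc = ∃ λ qs → ∃ λ ls → ∃ λ rs → Det 1 pc (pcOf cf qs ls rs) × At i cf qs ls rs

    landed : ∀ {i s h t q qs ls rs} → At i (cfg s h t q) qs ls rs → ∀ s′ b m w →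
      Landed (suc i) (cfg s′ (moveHead m h) (writeTape h b t) (appendQ q w))
        (proj₁ (apply (s′ , b , m , w)) , pushed (s′ , b , m , w) qs ls (pop rs))
    landed {i} {_} {h} {t} {q} {qs} {ls} {rs} (represents eq el er lq lh lr) s′ b m w = go m h el er lh
      where
      eq′ : appended w qs ≡ reverse (appendQ q w)
      eq′ = trans (cong (appended w) eq) (appended-reverse w q)
      lq′ : length (appendQ q w) ≤ suc i
      lq′ = ≤-trans (appendQ-length w q) (s≤s lq)
      lr′ : length (pop rs) ≤ n + suc i
      lr′ = ≤-trans (pop-length rs) (≤-trans lr (+-monoʳ-≤ n (n≤1+n i)))
      lr₁ : suc (length (pop rs)) ≤ n + suc i
      lr₁ = ≤-trans (s≤s (≤-trans (pop-length rs) lr)) (≤-reflexive (sym (+-suc n i)))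
      above : ∀ {h} → (∀ j → t (h + j) ≡ nth rs j) → ∀ j → writeTape h b t (suc (h + j)) ≡ nth (pop rs) j
      above {h} er j = trans (write-above t h b j) (trans (cong t (sym (+-suc h j))) (trans (er (suc j)) (nth-pop rs j)))
      same : ∀ {h} → (∀ j → t (h + j) ≡ nth rs j) → ∀ j → writeTape h b t (h + j) ≡ nth (b ∷ pop rs) j
      same {h} er zero rewrite +-identityʳ h = write-here t h b
      same {h} er (suc j) rewrite +-suc h j  = above er j
      go : ∀ m h → ls ≡ below t h → (∀ j → t (h + j) ≡ nth rs j) → h ≤ i →
        Landed (suc i) (cfg s′ (moveHead m h) (writeTape h b t) (appendQ q w))
          (proj₁ (apply (s′ , b , m , w)) , pushed (s′ , b , m , w) qs ls (pop rs))
      go right h el er lh = appended w qs , b ∷ ls , pop rs , moved w ,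
        represents eq′ (cong₂ _∷_ (sym (write-here t h b)) (trans el (sym (below-write h ≤-refl)))) (above er) lq′ (s≤s lh) lr′
        where
        moved : ∀ w → Det 1 (run s′ , pushed (s′ , b , right , w) qs ls (pop rs)) (run s′ , stacks (appended w qs) (b ∷ ls) (pop rs))
        moved nothing  = stop
        moved (just _) = stop
      go stay h el er lh = appended w qs , ls , b ∷ pop rs , moved w ,
        represents eq′ (trans el (sym (below-write h ≤-refl))) (same er) lq′ (m≤n⇒m≤1+n lh) lr₁
        where
        moved : ∀ w → Det 1 (run s′ , pushed (s′ , b , stay , w) qs ls (pop rs)) (run s′ , stacks (appended w qs) ls (b ∷ pop rs))
        moved nothing  = stop
        moved (just _) = stop
      go left zero refl er lh = appended w qs , [] , b ∷ pop rs , moved w ,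
        represents eq′ refl (same er) lq′ z≤n lr₁
        where
        moved : ∀ w → Det 1 (lf s′ , pushed (s′ , b , left , w) qs [] (pop rs)) (run s′ , stacks (appended w qs) [] (b ∷ pop rs))
        moved nothing  = lf-bottom s′ qs (b ∷ pop rs)
        moved (just b′) = lf-bottom s′ (b′ ∷ qs) (b ∷ pop rs)
      go left (suc h) refl er lh = appended w qs , below t h , t h ∷ b ∷ pop rs , moved w ,
        represents eq′ (sym (below-write h (n≤1+n h))) shifted lq′ (≤-trans (n≤1+n h) (m≤n⇒m≤1+n lh)) (left-length rs (≤-trans (s≤s z≤n) lh) lr)
        where
        shifted : ∀ j → writeTape (suc h) b t (h + j) ≡ nth (t h ∷ b ∷ pop rs) j
        shifted zero rewrite +-identityʳ h = cong (λ v → if v then b else t h) (≡ᵇ-false (<⇒≢ (n<1+n h)))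
        shifted (suc j) rewrite +-suc h j  = same er j
        moved : ∀ w → Det 1 (lf s′ , pushed (s′ , b , left , w) qs (t h ∷ below t h) (pop rs)) (run s′ , stacks (appended w qs) (below t h) (t h ∷ b ∷ pop rs))
        moved nothing  = step refl refl refl stop
        moved (just _) = step refl refl refl stop

    head-symbol : ∀ {i s h t q qs ls rs} → At i (cfg s h t q) qs ls rs → nth rs 0 ≡ t h
    head-symbol {h = h} {t} (represents _ _ er _ _ _) = trans (sym (er 0)) (cong t (+-identityʳ h))

    work-must : ∀ {Q i s h t q qs ls rs m} → At i (cfg s h t q) qs ls rs → kind s ≡ work →
      (∀ {cf qs ls rs} → Step M D (cfg s h t q) cf → At (suc i) cf qs ls rs → Must Q m (pcOf cf qs ls rs)) →
      Must Q (3 + m) (run s , stacks qs ls rs)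
    work-must {Q} {i} {s} {h} {t} {q} {qs} {ls} {rs} {m} a ks f with poise {qs = qs} {ls} rs ks
    ... | _ , d , poised {s₁} {σ} j src≡ live rule≡ base≡ = det-must d (step src≡ live λ e mem →
        choose e (∈-map⁻ apply (subst (λ ρ → e ∈ toList ρ) (trans rule≡ (cong (moves s) (head-symbol a))) mem)))
      where
      choose : ∀ e → (∃ λ tr → tr ∈ toList (δ s (t h)) × e ≡ apply tr) → Must Q (suc m) (after j e σ)
      choose _ ((s′ , b , mv , w) , mem , refl) with landed a s′ b mv w
      ... | _ , _ , _ , d′ , a′ = subst (λ σ′ → Must Q (suc m) (proj₁ tr , zipWith push? (proj₂ tr) σ′)) (sym base≡)
          (det-must d′ (f (work-step ks mem) a′))
        where tr = apply (s′ , b , mv , w)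

    work-may : ∀ {Q i s h t q qs ls rs s′ b mv w} → At i (cfg s h t q) qs ls rs → kind s ≡ work →
      (s′ , b , mv , w) ∈ toList (δ s (t h)) →
      (∀ {qs ls rs} → At (suc i) (cfg s′ (moveHead mv h) (writeTape h b t) (appendQ q w)) qs ls rs → May Q (run s′ , stacks qs ls rs)) →
      May Q (run s , stacks qs ls rs)
    work-may {Q} {s = s} {qs = qs} {ls} {rs} {s′} {b} {mv} {w} a ks mem f with poise {qs = qs} {ls} rs ks | landed a s′ b mv w
    ... | _ , d , poised {s₁} {σ} j src≡ live rule≡ base≡ | _ , _ , _ , d′ , a′ = det-may d (step src≡ live
        (subst (λ ρ → apply (s′ , b , mv , w) ∈ toList ρ) (sym (trans rule≡ (cong (moves s) (head-symbol a)))) (∈-map⁺ apply mem))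
        (subst (λ σ′ → May Q (proj₁ tr , zipWith push? (proj₂ tr) σ′)) (sym base≡) (det-may d′ (f a′))))
      where tr = apply (s′ , b , mv , w)

    query-run : ∀ {i s h t q qs ls rs} → At i (cfg s h t q) qs ls rs → kind s ≡ query → i ≤ machineTime n →
      QueryRun (K * lg n) (7 * machineTime n + 7) q (cells ls l) (cells rs r) c e (run s , stacks qs ls rs)
    query-run {i} {s} {h} {t} {q} {[]} (represents eq el er lq lh lr) ks i≤ = settled false (no-answer ¬d)
        (det-weaken (≤-trans (m≤m+n 1 6) (m≤n+m 7 (7 * machineTime n)))
          (step {n = 0} (cong runSrc ks) (cong runHalts ks) (cong (λ κ → runRule κ s nothing) ks) stop))
      where
      ¬d : ¬ CodedBelow χ y (suc (K * lg n)) q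
      ¬d d with coded-length d
      ... | _ , _ , ek = case trans (cong length eq) (trans (length-reverse q) ek) of λ ()
    query-run {i} {s} {h} {t} {q} {b ∷ rest} (represents eq el er lq lh lr) ks i≤ = queryRun-weaken time (queryRun-prefix
        (step {n = 0} (cong runSrc ks) (cong runHalts ks) (cong (λ κ → runRule κ s (just (bitq b))) ks) stop)
        (Load.load bot-c b b (length rest) rest [] [] (consM b (just (emptyBW S))) true (K * lg n) ≤-refl refl refl
          (shadows-cons b (shadows-empty S)) ((λ _ → refl) , λ ()) q≡))
      where
      q≡ : q ≡ reverse rest ++ [ b ]
      q≡ = trans (sym (reverse-involutive q)) (trans (cong reverse (sym eq)) (unfold-reverse b rest))
      q≤ : length q ≤ machineTime n
      q≤ = ≤-trans lq i≤
      rest≤ : length rest ≤ machineTime n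
      rest≤ = ≤-trans (n≤1+n _) (≤-trans (≤-reflexive (trans (cong length eq) (length-reverse q))) q≤)
      time : 1 + (3 * length rest + (4 * length q + 6)) ≤ 7 * machineTime n + 7
      time = ≤-trans (s≤s (+-mono-≤ (*-monoʳ-≤ 3 rest≤) (+-monoˡ-≤ 6 (*-monoʳ-≤ 4 q≤)))) (≤-reflexive (lem (machineTime n)))
        where
        lem : ∀ P → suc (3 * P + (4 * P + 6)) ≡ 7 * P + 7
        lem = solve-∀

    reply : ∀ {q s h t} v → kind s ≡ query → Answers (K * lg n) q v →
      Step M D (cfg s h t q) (cfg (if v then yesS else noS) h t [])
    reply true  ks (p , _) = query-yes ks (p refl)
    reply false ks (_ , p) = query-no ks (p refl)

    replied : ∀ {i s h t q qs ls rs s′} → At i (cfg s h t q) qs ls rs → At (suc i) (cfg s′ h t []) [] ls rs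
    replied {i} (represents eq el er lq lh lr) = represents refl el er z≤n (m≤n⇒m≤1+n lh) (≤-trans lr (+-monoʳ-≤ n (n≤1+n i)))

    recursive-answer : ∀ {q} x′ b j → length x′ + j ≡ K * lg n → q ≡ code x′ (y (length x′)) b →
      Answers (K * lg n) q (sameBit b (χ x′))
    recursive-answer {q} x′ b j le eq = yes′ , no′
      where
      same : ∀ b v → sameBit b v ≡ true → b ≡ v
      same true  true  _ = refl
      same false false _ = refl
      refl-same : ∀ b → sameBit b b ≡ true
      refl-same true  = refl
      refl-same false = refl
      yes′ : sameBit b (χ x′) ≡ true → CodedBelow χ y (suc (K * lg n)) q
      yes′ t = x′ , s≤s (≤-trans (m≤m+n _ j) (≤-reflexive le)) , trans eq (cong (code x′ (y (length x′))) (same b (χ x′) t))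
      no′ : sameBit b (χ x′) ≡ false → ¬ CodedBelow χ y (suc (K * lg n)) q
      no′ f (x″ , _ , eq″) with code-injective x′ x″ _ _ b (χ x″) (y-length (length x′)) (y-length (length x″)) (trans (sym eq) eq″)
      ... | refl , _ , refl = case trans (sym f) (refl-same (χ x′)) of λ ()

    callee : Word → Bool → Bool → ℕ → List (Sym nΓ) → List (Sym nΓ) → Context
    callee x′ b b′ j ls rs = record
      { l = frame b ∷ cells ls l ; r = frame b′ ∷ cells rs r ; c = frame b ∷ ones j c ; e = ones (length x′) (frame b′ ∷ e)
      ; bot-l = framed ; bot-r = framed ; bot-c = framed }

  -- All contexts are needed, since a recursive call runs on top of the suspended stacks of its
  -- callers.
  Simulates : Word → Set
  Simulates x = ∀ F → Must (Level.Post x F) (simTime (length x)) (Level.entry x F) × May (Level.Post x F) (Level.entry x F)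

  module Caller (x : Word) (F : Context) (n₀≤ : n₀ ≤ length x)
    (calls : ∀ x′ → n₀ ≤ length x′ → length x′ < length x → Simulates x′) where
    open Context F
    open Level x F

    resume : ∀ {x′ b b′ j ls rs pc} → length x′ + j ≡ K * lg n → Level.Post x′ (callee x′ b b′ j ls rs) pc →
      Det (returnTime (length x′)) pc (run (if sameBit b (χ x′) then yesS else noS) , stacks [] ls rs)
    resume {x′} {b} {b′} {j} {ls} {rs} le (Level.post {i} {qs = qs} {ls′} {rs′} (Level.represents {s} {h} {t} {q} eq el er lq lh lr) i≤ ks) =
      subst (λ c′ → Det (returnTime m) (run s , Level.stacks x′ (callee x′ b b′ j ls rs) qs ls′ rs′)
          (run (if sameBit b (χ x′) then yesS else noS) , [] ∷ cells ls l ∷ cells rs r ∷ c′ ∷ e ∷ [] ∷ [] ∷ []))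
        (trans (ones-+ m j c) (cong (λ v → ones v c) le))
        (det-weaken time (return ks qs ls′ rs′ (K * lg m) m))
      where
      m = length x′
      P = machineTime m
      qs≤ : length qs ≤ P
      qs≤ = ≤-trans (≤-reflexive (trans (cong length eq) (length-reverse q))) (≤-trans lq i≤)
      ls≤ : length ls′ ≤ P
      ls≤ = ≤-trans (≤-reflexive (trans (cong length el) (below-length t h))) (≤-trans lh i≤)
      rs≤ : length rs′ ≤ m + P
      rs≤ = ≤-trans lr (+-monoʳ-≤ m i≤)
      time : suc (length ls′) + (suc (K * lg m) + (suc (length qs) + (1 + (suc (length rs′) + suc m)))) ≤ returnTime m
      time = ≤-trans (+-mono-≤ (s≤s ls≤) (+-monoʳ-≤ (suc (K * lg m)) (+-mono-≤ (s≤s qs≤) (s≤s (+-monoˡ-≤ (suc m) (s≤s rs≤))))))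
        (≤-reflexive (lem P m (K * lg m)))
        where
        lem : ∀ P m L → suc P + (suc L + (suc P + (1 + (suc (m + P) + suc m)))) ≡ 3 * P + (2 * m + (L + 6))
        lem = solve-∀

    smaller : ∀ {x′ : Word} {j} → length x′ + j ≡ K * lg n → simTime (length x′) + returnTime (length x′) ≤ n
    smaller {x′} {j} le = call≤ n n₀≤ (length x′) (≤-trans (m≤m+n _ j) (≤-reflexive le))

    shorter : ∀ {x′ : Word} {j} → length x′ + j ≡ K * lg n → length x′ < n
    shorter {x′} le = ≤-trans (id<simTime (length x′)) (≤-trans (m≤m+n _ _) (smaller {x′} le))

    query-must : ∀ {Q i s h t q qs ls rs m} → At i (cfg s h t q) qs ls rs → kind s ≡ query → i ≤ machineTime n →
      (∀ {cf qs ls rs} → Step M D (cfg s h t q) cf → At (suc i) cf qs ls rs → Must Q m (pcOf cf qs ls rs)) →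
      Must Q (stepTime n + m) (run s , stacks qs ls rs)
    query-must {m = m} a ks i≤ f with query-run a ks i≤
    ... | settled v ans d = must-weaken (+-monoˡ-≤ m (+-monoʳ-≤ (7 * machineTime n) (≤-trans (m≤m+n 7 3) (m≤n+m 10 n))))
        (det-must d (f (reply v ks ans) (replied a)))
    ... | recurse x′ b b′ j big le eq d = must-weaken time (det-must d (must-bind
        (proj₁ (calls x′ big (shorter {x′} le) (callee x′ b b′ j _ _)))
        (λ p → det-must (resume le p) (f (reply _ ks (recursive-answer x′ b j le eq)) (replied a)))))
      where
      time : (7 * machineTime n + 7) + (simTime (length x′) + (returnTime (length x′) + m)) ≤ stepTime n + m
      time = ≤-trans (≤-reflexive (lem (7 * machineTime n) (simTime (length x′)) (returnTime (length x′)) m))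
        (+-monoˡ-≤ m (+-monoʳ-≤ (7 * machineTime n) (+-mono-≤ (smaller {x′} le) (m≤m+n 7 3))))
        where
        lem : ∀ P T R m → (P + 7) + (T + (R + m)) ≡ (P + ((T + R) + 7)) + m
        lem = solve-∀

    query-may : ∀ {Q i s h t q qs ls rs} → At i (cfg s h t q) qs ls rs → kind s ≡ query → i ≤ machineTime n →
      (∀ {cf qs ls rs} → Step M D (cfg s h t q) cf → At (suc i) cf qs ls rs → May Q (pcOf cf qs ls rs)) →
      May Q (run s , stacks qs ls rs)
    query-may a ks i≤ f with query-run a ks i≤
    ... | settled v ans d = det-may d (f (reply v ks ans) (replied a))
    ... | recurse x′ b b′ j big le eq d = det-may d (may-bind
        (proj₂ (calls x′ big (shorter {x′} le) (callee x′ b b′ j _ _)))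
        (λ p → det-may (resume le p) (f (reply _ ks (recursive-answer x′ b j le eq)) (replied a))))

    open Good (good x n₀≤)

    -- An answer other than `χ x` would be its negation, which `exact` excludes. Thus every
    -- simulation that survives returns the true value.
    right-answer : ∀ {i cf b} → Reach M D x i cf → kind (Config.state cf) ≡ halt (answer b) → b ≡ χ x
    right-answer {b = b} rc ks with b ≟ᵇ χ x
    ... | yes e = e
    ... | no ¬e = ⊥-elim (exact (_ , _ , rc , trans ks (cong (halt ∘ answer) (other b (χ x) ¬e))))
      where
      other : ∀ b v → b ≢ v → b ≡ not v
      other true  true  ne = ⊥-elim (ne refl)
      other true  false ne = refl
      other false true  ne = refl
      other false false ne = ⊥-elim (ne refl)

    simulate-must : ∀ fuel {i cf qs ls rs} → machineTime n ≤ i + fuel → Reach M D x i cf → At i cf qs ls rs →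
      Must Post (suc fuel * stepTime n) (pcOf cf qs ls rs)
    simulate-must fuel {i} {cfg s h t q} {qs} {ls} {rs} le rc a = go (kind s) refl
      where
      onward : ∀ fuel → machineTime n ≤ i + fuel → ∀ {cf qs ls rs} → Step M D (cfg s h t q) cf → At (suc i) cf qs ls rs →
        Must Post (fuel * stepTime n) (pcOf cf qs ls rs)
      onward zero le st a′ = ⊥-elim (<⇒≱ (fast (next rc st)) (≤-trans le (≤-reflexive (+-identityʳ i))))
      onward (suc fuel) le st a′ = simulate-must fuel (≤-trans le (≤-reflexive (+-suc i fuel))) (next rc st) a′
      final : ∀ b → kind s ≡ halt (answer b) → Must Post (suc fuel * stepTime n) (pcOf (cfg s h t q) qs ls rs)
      final b ks = now (post a (fast rc) (trans ks (cong (halt ∘ answer) (right-answer rc ks))))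
      go : ∀ κ → kind s ≡ κ → Must Post (suc fuel * stepTime n) (pcOf (cfg s h t q) qs ls rs)
      go work ks = must-weaken (+-monoˡ-≤ (fuel * stepTime n) (≤-trans (m≤m+n 3 7) (≤-trans (m≤n+m 10 n) (m≤n+m (n + 10) (7 * machineTime n)))))
        (work-must a ks (onward fuel le))
      go query ks = query-must a ks (fast rc) (onward fuel le)
      go (halt unk) ks = dies (cong runHalts ks)
      go (halt acc) ks = final true ks
      go (halt rej) ks = final false ks

    -- Induction along a path of M in continuation style: the stacks that represent its last
    -- configuration are known only once the earlier steps have been simulated.
    simulate-may : ∀ {i cf} → Reach M D x i cf → (∀ {qs ls rs} → At i cf qs ls rs → May Post (pcOf cf qs ls rs)) → May Post entry
    simulate-may here f = det-may started (f at-start)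
    simulate-may (next {c = cfg s h t q} rc (work-step ks mem)) f = simulate-may rc λ a → work-may a ks mem f
    simulate-may {cf = cf} (next {c = cfg s h t q} rc st@(query-yes ks d)) f = simulate-may rc λ a →
      query-may a ks (fast rc) λ { (work-step ks′ _) _ → case trans (sym ks) ks′ of λ ()
                                 ; (query-yes _ _) a′ → f a′
                                 ; (query-no _ ¬d) _ → ⊥-elim (¬d d) }
    simulate-may {cf = cf} (next {c = cfg s h t q} rc st@(query-no ks ¬d)) f = simulate-may rc λ a →
      query-may a ks (fast rc) λ { (work-step ks′ _) _ → case trans (sym ks) ks′ of λ ()
                                 ; (query-no _ _) a′ → f a′
                                 ; (query-yes _ d) _ → ⊥-elim (¬d d) }

    simulated : Must Post (simTime n) entry × May Post entry
    simulated = det-must started (simulate-must (machineTime n) ≤-refl here at-start) , reached found-answer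
      where
      reached : Out M D x (answer (χ x)) → May Post entry
      reached (i , cf , rc , ks) = simulate-may rc λ a → now (post a (fast rc) ks)

  simulates : ∀ x → n₀ ≤ length x → Simulates x
  simulates x = go (length x) x ≤-refl
    where
    go : ∀ B x → length x ≤ B → n₀ ≤ length x → Simulates x
    go B x x≤ n₀≤ F = Caller.simulated x F n₀≤ (calls B x≤)
      where
      calls : ∀ B → length x ≤ B → ∀ x′ → n₀ ≤ length x′ → length x′ < length x → Simulates x′
      calls zero    x≤ x′ _ lt = ⊥-elim (n≮0 (≤-trans lt x≤))
      calls (suc B) x≤ x′ big lt = go B x′ (s≤s⁻¹ (≤-trans lt x≤)) big

  top : Context
  top = context {e = []} empty empty empty

  loading : ∀ {Q m z} w xs sh → Shadows {n₀} sh xs → reverse w ++ xs ≡ z →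
    (∀ σ → Must Q m (fin (χ z) , σ) × May Q (fin (χ z) , σ)) →
    (n₀ < length z → Must Q m (Level.entry z top) × May Q (Level.entry z top)) →
    let c = (init sh , bits w ∷ [] ∷ cells (map bitSym xs) [] ∷ [] ∷ [] ∷ ones (length xs) [] ∷ [] ∷ []) in
    Must Q (suc (length w) + m) c × May Q c
  loading [] xs (just w) (exactly refl le) refl short long =
    det-must (step {n = 0} refl refl refl stop) (proj₁ (short _)) , det-may (step {n = 0} refl refl refl stop) (proj₂ (short _))
  loading [] xs nothing (overflow lt) refl short long =
    det-must (step {n = 0} refl refl refl stop) (proj₁ (long lt)) , det-may (step {n = 0} refl refl refl stop) (proj₂ (long lt))
  loading {Q} {m} (b ∷ w) xs sh s eq short long
    with loading {Q} {m} w (b ∷ xs) (consM b sh) (shadows-cons b s)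
           (trans (sym (trans (cong (_++ xs) (unfold-reverse b w)) (++-assoc (reverse w) [ b ] xs))) eq) short long
  ... | must , may = det-must (step {n = 0} refl refl refl stop) must , det-may (step {n = 0} refl refl refl stop) may

  correct : ∀ x → Must (Halted (out (χ x))) (totalTime (length x)) (initPC x) × May (Halted (out (χ x))) (initPC x)
  correct x = must-weaken (+-monoˡ-≤ _ (s≤s (≤-reflexive (length-reverse x)))) (proj₁ both) , proj₂ both
    where
    n = length x
    finished : ∀ {pc} → Level.Post x top pc → ∃ λ σ → Det (suc (machineTime n)) pc (fin (χ x) , σ)
    finished (Level.post {i} {qs = qs} {ls} {rs} (Level.represents {h = h} {t} eq el er lq lh lr) i≤ ks) = _ ,
      det-weaken (s≤s (≤-trans (≤-reflexive (trans (cong length el) (below-length t h))) (≤-trans lh i≤))) (finish-loop ks ls)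
    both = loading {Halted (out (χ x))} {simTime n + suc (machineTime n)} (reverse x) [] (just (emptyBW n₀)) (shadows-empty n₀)
      (trans (++-identityʳ _) (reverse-involutive x)) (λ _ → now refl , now refl)
      (λ lt → must-bind (proj₁ (simulates x (<⇒≤ lt) top))
                (λ p → must-weaken (≤-reflexive (+-identityʳ _)) (det-must (proj₂ (finished p)) (now {n = 0} refl))) ,
              may-bind (proj₂ (simulates x (<⇒≤ lt) top)) (λ p → det-may (proj₂ (finished p)) (now refl)))

-- The diagonal argument

reach-equivalent : ∀ {M D D′ x n c} → (∀ {q} → D q → D′ q) → (∀ {q} → D′ q → D q) → Reach M D x n c → Reach M D′ x n c
reach-equivalent f g here                      = here
reach-equivalent f g (next rc (work-step k m)) = next (reach-equivalent f g rc) (work-step k m)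
reach-equivalent f g (next rc (query-yes k d)) = next (reach-equivalent f g rc) (query-yes k (f d))
reach-equivalent f g (next rc (query-no k ¬d)) = next (reach-equivalent f g rc) (query-no k (¬d ∘ g))

good-equivalent : ∀ {M D D′ x b P} → (∀ {q} → D q → D′ q) → (∀ {q} → D′ q → D q) → Good M D x b P → Good M D′ x b P
good-equivalent f g G = record
  { fast = λ rc → fast (reach-equivalent g f rc)
  ; found-answer = let n , c , rc , h = found-answer in n , c , reach-equivalent f g rc , h
  ; exact = λ { (n , c , rc , h) → exact (n , c , reach-equivalent g f rc , h) } }
  where open Good G

-- Membership in NP and coNP by self-reduction

module SelfReduction {A : Lang} {χ : Word → Bool} (dec : Decides χ A) (M : NOTM) (a k : ℕ)
  (y : ℕ → Word) (y-length : ∀ m → length (y m) ≡ m) (s : ℕ) (y-zeros : ∀ m → s ≤ m → y m ≡ zeros m)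
  (good : ∀ x → 1 ≤ length x → s ≤ cutoff a k (length x) →
    Good M (CodedBelow χ y (cutoff a k (length x))) x (χ x) (a * length x ^ k + a)) where

  private
    K = degree a k
    bound = Costs.calls≤ a k K
    -- The first summand makes calls cheap. The second gives lg |x| ≥ s, hence a cutoff of at least
    -- s, where M is known to be good; and s ≤ 2 ^ s makes all pads from n₀ on zero.
    n₀ = proj₁ bound + 2 ^ s

    tab : Word → Bool
    tab q = does (codedBelow? χ y (suc (n₀ + n₀)) q)

    tab-spec : ∀ q → (tab q ≡ true → CodedBelow χ y (suc (n₀ + n₀)) q) × (tab q ≡ false → ¬ CodedBelow χ y (suc (n₀ + n₀)) q)
    tab-spec q with codedBelow? χ y (suc (n₀ + n₀)) q
    ... | yes d = (λ _ → d) , λ ()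
    ... | no ¬d = (λ ()) , λ _ → ¬d

    large : ∀ {n} → n₀ ≤ n → 2 ^ s ≤ n
    large le = ≤-trans (m≤n+m (2 ^ s) (proj₁ bound)) le

    module R (out : Bool → Outcome) = Recursion M K a k n₀ χ tab out y y-length
      (λ m le → y-zeros m (≤-trans (<⇒≤ (n<2^n s)) (large le))) tab-spec
      (λ n le → proj₂ bound n (≤-trans (m≤m+n (proj₁ bound) (2 ^ s)) le))
      (λ x le → good x (≤-trans (m^n>0 2 s) (large le)) (≤-trans (≤lg (large le)) (lg≤cutoff a k (length x))))

    program : (Bool → Outcome) → Prog
    program out = Simulator.prog M K n₀ χ tab out

    negated : ∀ x → (not (χ x) ≡ true → ¬ A x) × (not (χ x) ≡ false → ¬ ¬ A x)
    negated x with χ x | dec x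
    ... | true  | p , _ = (λ ()) , λ _ ¬a → ¬a (p refl)
    ... | false | _ , p = (λ _ → p refl) , λ ()

  A∈NP : InNP A
  A∈NP = prog-InNP (program answer) (Costs.totalTime a k K) (Costs.pb-total a k K) χ
    (λ x → proj₁ (R.correct answer x)) (λ x → proj₂ (R.correct answer x)) dec

  -- Only the outermost answer is swapped, recursive calls still work with χ. This suffices because
  -- surviving paths are correct on both sides.
  A∈coNP : InCoNP A
  A∈coNP = prog-InNP (program (answer ∘ not)) (Costs.totalTime a k K) (Costs.pb-total a k K) (not ∘ χ)
    (λ x → proj₁ (R.correct (answer ∘ not) x)) (λ x → proj₂ (R.correct (answer ∘ not) x)) negated

zeros-∈ : ∀ {m} (L : List Word) → zeros m ∈ L → m ≤ sum (map length L)
zeros-∈ {m} (_ ∷ L) (here refl) = ≤-trans (≤-reflexive (sym (length-replicate m))) (m≤m+n _ _)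
zeros-∈ (w ∷ L) (there i)       = ≤-trans (zeros-∈ L i) (m≤n+m _ (length w))

-- A finite list can forbid 0^m for finitely many m only; the total length of its pads is a crude
-- bound for these m.
pick-zeros : ∀ L m → sum (map length (map padOf L)) < m → pick L m ≡ zeros m
pick-zeros L m lt with zeros m ∈ʷ? map padOf L
... | yes i = ⊥-elim (<⇒≱ lt (zeros-∈ (map padOf L) i))
... | no  _ = refl

-- Progress through the requirements

module Diagonal {A : Lang} {χ : Word → Bool} (dec : Decides χ A) (hard : ¬ (InNP A × InCoNP A)) where
  open Stages χ

  index : ℕ → ℕ
  index m = idx (st m)

  module _ (m : ℕ) (stuck : ∀ m′ → m ≤ m′ → index m′ ≡ index m) where

    Calm : ℕ → Set
    Calm m′ = (∃ λ T → ∃ λ a → ∃ λ k → job (index m′) ≡ just (T , a , k) ×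
        (∀ x → Active m′ a k x → Good (tableMachine T) (Oracle m′ (st m′)) x (χ x) (time a k x))) ×
      forb (st (suc m′)) ≡ forb (st m′)

    calm : ∀ m′ → m ≤ m′ → Calm m′
    calm m′ le with verdict m′ (st m′) | trans (stuck (suc m′) (m≤n⇒m≤1+n le)) (sym (stuck m′ le))
    ... | quiet {T} {a} {k} jb g | _ = (T , a , k , jb , g) , refl
    ... | vacant _               | e = ⊥-elim (1+n≢n e)
    ... | event _ _ _            | e = ⊥-elim (1+n≢n e)

    forb-constant : ∀ d → forb (st (d + m)) ≡ forb (st m)
    forb-constant zero    = refl
    forb-constant (suc d) = trans (proj₂ (calm (d + m) (m≤n+m m d))) (forb-constant d)

    F = forb (st m)

    s : ℕ
    s = m + suc (sum (map length (map padOf F)))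

    y-zeros : ∀ m′ → s ≤ m′ → y m′ ≡ zeros m′
    y-zeros m′ le = trans (cong (λ L → pick L m′) forb≡) (pick-zeros F m′ (≤-trans (m≤n+m _ m) le))
      where
      m≤ : m ≤ suc m′
      m≤ = m≤n⇒m≤1+n (≤-trans (m≤m+n m _) le)
      forb≡ : forb (st (suc m′)) ≡ F
      forb≡ = trans (cong (forb ∘ st) (sym (m∸n+n≡m m≤))) (forb-constant (suc m′ ∸ m))

    oracle-y : ∀ {m′ q} → Oracle m′ (st m′) q → CodedBelow χ y m′ q
    oracle-y (x , lt , e) = x , lt , trans e (cong (λ p → code x p (χ x)) (pads-y lt))

    y-oracle : ∀ {m′ q} → CodedBelow χ y m′ q → Oracle m′ (st m′) q
    y-oracle (x , lt , e) = x , lt , trans e (cong (λ p → code x p (χ x)) (sym (pads-y lt)))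

    -- Each x with cutoff at least s is examined at the stage given by its cutoff. This stage is not
    -- before m, so its requirement is still that of stage m, and its quiet verdict is the evidence
    -- the self-reduction asks for.
    not-stuck : ⊥
    not-stuck with proj₁ (calm m ≤-refl)
    ... | T , a , k , jb , _ = hard (SR.A∈NP , SR.A∈coNP)
      where
      good : ∀ x → 1 ≤ length x → s ≤ cutoff a k (length x) →
        Good (tableMachine T) (CodedBelow χ y (cutoff a k (length x))) x (χ x) (a * length x ^ k + a)
      good x 1≤ le with proj₁ (calm (cutoff a k (length x)) (≤-trans (m≤m+n m _) le))
      ... | T′ , a′ , k′ , jb′ , g with trans (sym jb) (trans (cong job (sym (stuck _ (≤-trans (m≤m+n m _) le)))) jb′)
      ... | refl = good-equivalent oracle-y y-oracle (g x (1≤ , refl))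
      module SR = SelfReduction {A} {χ} dec (tableMachine T) a k y y-length s y-zeros good

  Advances : ℕ → Set
  Advances j = ∃ λ m → index m ≡ j × index (suc m) ≡ suc j

  index-step : ∀ m → index (suc m) ≡ index m ⊎ index (suc m) ≡ suc (index m)
  index-step m with verdict m (st m)
  ... | vacant _    = inj₂ refl
  ... | quiet _ _   = inj₁ refl
  ... | event _ _ _ = inj₂ refl

  -- The index grows by 0 or 1 at each stage; if no stage left its value, it would be constant from
  -- m on.
  advances-from : ∀ m → ¬ ¬ Advances (index m)
  advances-from m ¬adv = not-stuck m λ m′ le →
      subst (λ m′ → index m′ ≡ index m) (m∸n+n≡m le) (stays (m′ ∸ m))
    where
    stays : ∀ d → index (d + m) ≡ index m
    stays zero = refl
    stays (suc d) with index-step (d + m)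
    ... | inj₁ e = trans e (stays d)
    ... | inj₂ e = ⊥-elim (¬adv (d + m , stays d , trans e (cong suc (stays d))))

  advances : ∀ j → ¬ ¬ Advances j
  advances zero    = advances-from 0
  advances (suc j) ¬adv = advances j λ { (m , _ , e) → advances-from (suc m) (subst (¬_ ∘ Advances) (sym e) ¬adv) }

  not-≤RS : ¬ (A ≤RS B)
  not-≤RS (N , over , under , same) = advances j contradiction′
    where
    M = NPTM.machine N
    a = proj₁ (NPTM.poly N)
    k = proj₁ (proj₂ (NPTM.poly N))
    bounded = proj₂ (proj₂ (NPTM.poly N))
    j = proj₁ (proj₂ countable-Job (table M , a , k))
    job-j : job j ≡ just (table M , a , k)
    job-j = proj₂ (proj₂ countable-Job (table M , a , k))
    wrong-answer : ∀ x → ¬ Out M B x (answer (not (χ x)))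
    wrong-answer x o with χ x | dec x
    -- A rejecting path alone does not contradict x ∈ A; together with the accepting path that A ≡
    -- L(N) provides, it violates underproductivity.
    ... | true  | p , _ = under B x (Equivalence.to (same x) (p refl) , o)
    ... | false | _ , p = p refl (Equivalence.from (same x) o)
    impossible : ∀ m x → (e : EventAt m (st m) (tableMachine (table M)) a k x) →
      -- Only a `wrong` event has queries to be kept, so this is assumed through an equation with
      -- that constructor.
      (∀ {n c qs n≤ mem h} → e ≡ Explore.wrong {n = n} {c} {qs} n≤ mem h → ∀ {q} → q ∈ qs → q ∈ forb (st (suc m))) → ⊥
    impossible m x (Explore.slow rc) _ = <⇒≱ (n<1+n _) (bounded _ x _ _ (reach (tabulated-≗ M) rc))
    impossible m x (Explore.mute ¬acc ¬rej) _ with over (Oracle m (st m)) x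
    ... | inj₁ o = ¬acc (out-≗ (≗-tabulated M) o)
    ... | inj₂ o = ¬rej (out-≗ (≗-tabulated M) o)
    impossible m x (Explore.wrong {n} {c} {qs} n≤ mem h) keep-qs = wrong-answer x (out-≗ (tabulated-≗ M) (n , c ,
      proj₂ (Explore.layer-sound (tableMachine (table M)) (Oracle m (st m)) (oracle? m (st m)) x {D′ = B} mem)
        (λ q∈ → preserved m (keep-qs refl q∈)) , h))
    contradiction′ : ¬ Advances j
    contradiction′ (m , e₁ , e₂) = go (verdict m (st m)) refl
      where
      at-j : ∀ {z} → job (index m) ≡ z → just (table M , a , k) ≡ z
      at-j jb = trans (sym job-j) (trans (cong job (sym e₁)) jb)
      go : ∀ v → verdict m (st m) ≡ v → ⊥
      go (vacant jb) _ = case at-j jb of λ ()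
      go (quiet jb g) ev = 1+n≢n (trans (sym e₂) (trans (cong (newIdx m (st m)) ev) e₁))
      go (event {x = x} jb act e) ev with at-j jb
      ... | refl = impossible m x e λ { refl q∈ → subst (λ v → _ ∈ newForb m (st m) v) (sym ev) (∈-++⁺ˡ q∈) }

theorem3p1 : (A : Lang) → Recursive A → ¬ (InNP A × InCoNP A) →
    Σ Lang λ B → (A ≤SN B) × ¬ (A ≤RS B)
theorem3p1 A A? hard = B , coded-≤SN {y = y} decides y-length , Diagonal.not-≤RS decides hard
  where
  χ : Word → Bool
  χ x = does (A? x)
  decides : Decides χ A
  decides x with A? x
  ... | yes a = (λ _ → a) , λ ()
  ... | no ¬a = (λ ()) , λ _ → ¬a
  open Stages χ
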